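{- Let $\varphi=\frac{1+\sqrt5}{2}$. (i) If $x\in[0,1]\setminus\mathbb{Q}$ and all partial quotients of the continued fraction expansion of $x$ are at most $2$, then $g'_{\varphi^{ -1}}(x)=+\infty$. (ii) There exists $y\in[0,1]\setminus\mathbb{Q}$ all of whose partial quotients are at most $3$ such that $g'_{\varphi^{ -1}}(y)=0$.
   Context: For irrational $x\in(0,1)$, $x=[0;a_1,a_2,\ldots]$ is its regular continued fraction with partial quotients $a_i$. For $\lambda\in(0,1)$ the Denjoy–Tichy–Uitz function $g_\lambda:[0,1]\to[0,1]$ is defined by $g_\lambda(0)=0$, $g_\lambda(1)=1$, and, whenever $g_\lambda$ is defined at two consecutive Farey fractions $\frac pq<\frac rs$, $g_\lambda\!\left(\frac{p+r}{q+s}\right)=(1-\lambda)g_\lambda\!\left(\frac pq\right)+\lambda g_\lambda\!\left(\frac rs\right)$, extended by continuity. For irrational $x$, $g_{\varphi^{ -1}}(x)=\sum_{i\ge1}(-1)^{i-1}\varphi^{ -(a_1+2a_2+a_3+2a_4+\cdots+c_ia_i-1)}$ where $c_i=1$ for odd $i$ and $c_i=2$ for even $i$. Derivatives are two-sided and may equal $+\infty$. -}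

module Defs where

open import Data.Integer.Base as ℤ using (+_; +[1+_]; +<+)
import Data.Integer.Properties as ℤ
open import Data.Nat.Base as ℕ using (ℕ; zero; suc)
import Data.Nat.Properties as ℕ
open import Data.Nat.Solver using () renaming (module +-*-Solver to ℕ-Solver)
open import Data.Product.Base using (∃-syntax; _×_; _,_; proj₁; proj₂)
open import Data.Rational.Base as ℚ using (ℚ; mkℚ; 0ℚ; 1ℚ; ½; ↥_; ↧ₙ_)
import Data.Rational.Properties as ℚ
open import Data.Rational.Solver using () renaming (module +-*-Solver to ℚ-Solver)
open import Data.Rational.Unnormalised.Base as ℚᵘ using (mkℚᵘ; *<*; *≡*)
import Data.Rational.Unnormalised.Properties as ℚᵘ
open import Data.Sum.Base using (_⊎_; inj₁; inj₂)
open import Data.Empty using (⊥-elim)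
open import Relation.Binary.PropositionalEquality
  using (_≡_; _≢_; refl; sym; trans; cong; cong₂; subst; subst₂)
open import Relation.Nullary using (¬_; yes; no)

IsCauchy : (ℕ → ℚ) → Set
IsCauchy s = ∀ ε → 0ℚ ℚ.< ε →
  ∃[ N ] (∀ m n → N ℕ.≤ m → N ℕ.≤ n → ℚ.∣ s m ℚ.- s n ∣ ℚ.< ε)

-- Cauchy reals: equality of reals is the setoid relation _≃_, not _≡_.
record ℝ : Set where
  constructor mkℝ
  field
    seq    : ℕ → ℚ
    cauchy : IsCauchy seq

open ℝ public

infix 4 _≃_ _<_ _≤_ _#_

_≃_ : ℝ → ℝ → Set
x ≃ y = ∀ ε → 0ℚ ℚ.< ε → ∃[ N ] (∀ n → N ℕ.≤ n → ℚ.∣ seq x n ℚ.- seq y n ∣ ℚ.< ε)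

_<_ : ℝ → ℝ → Set
x < y = ∃[ ε ] 0ℚ ℚ.< ε × ∃[ N ] (∀ n → N ℕ.≤ n → seq x n ℚ.+ ε ℚ.≤ seq y n)

_≤_ : ℝ → ℝ → Set
x ≤ y = ¬ (y < x)

_#_ : ℝ → ℝ → Set
x # y = x < y ⊎ y < x

0<⇒pos : ∀ {p} → 0ℚ ℚ.< p → ℚ.Positive p
0<⇒pos = ℚ.positive

∣p∣≤∣q∣+∣p-q∣ : ∀ p q → ℚ.∣ p ∣ ℚ.≤ ℚ.∣ q ∣ ℚ.+ ℚ.∣ p ℚ.- q ∣
∣p∣≤∣q∣+∣p-q∣ p q =
  subst (λ r → ℚ.∣ r ∣ ℚ.≤ ℚ.∣ q ∣ ℚ.+ ℚ.∣ p ℚ.- q ∣)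
    (solve 2 (λ p q → q :+ (p :- q) := p) refl p q)
    (ℚ.∣p+q∣≤∣p∣+∣q∣ q (p ℚ.- q))
  where open ℚ-Solver

∣p-q∣≡∣q-p∣ : ∀ p q → ℚ.∣ p ℚ.- q ∣ ≡ ℚ.∣ q ℚ.- p ∣
∣p-q∣≡∣q-p∣ p q = trans (sym (ℚ.∣-p∣≡∣p∣ (p ℚ.- q)))
  (cong ℚ.∣_∣ (solve 2 (λ p q → :- (p :- q) := q :- p) refl p q))
  where open ℚ-Solver

p-q≤r : ∀ {p q r} → p ℚ.≤ q ℚ.+ r → p ℚ.- q ℚ.≤ r
p-q≤r {p} {q} {r} h = subst (p ℚ.- q ℚ.≤_)
  (solve 2 (λ q r → (q :+ r) :- q := r) refl q r)
  (ℚ.+-monoˡ-≤ (ℚ.- q) h)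
  where open ℚ-Solver

p-q<r : ∀ {p q r} → p ℚ.< q ℚ.+ r → p ℚ.- q ℚ.< r
p-q<r {p} {q} {r} h = subst (p ℚ.- q ℚ.<_)
  (solve 2 (λ q r → (q :+ r) :- q := r) refl q r)
  (ℚ.+-monoˡ-< (ℚ.- q) h)
  where open ℚ-Solver

∣p-q∣-elim : ∀ (P : ℚ → Set) p q → P (p ℚ.- q) → P (q ℚ.- p) → P ℚ.∣ p ℚ.- q ∣
∣p-q∣-elim P p q h k with ℚ.∣p∣≡p∨∣p∣≡-p (p ℚ.- q)
... | inj₁ eq = subst P (sym eq) h
... | inj₂ eq = subst P
  (sym (trans eq (solve 2 (λ p q → :- (p :- q) := q :- p) refl p q))) k
  where open ℚ-Solver

∣∣p∣-∣q∣∣≤∣p-q∣ : ∀ p q → ℚ.∣ ℚ.∣ p ∣ ℚ.- ℚ.∣ q ∣ ∣ ℚ.≤ ℚ.∣ p ℚ.- q ∣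
∣∣p∣-∣q∣∣≤∣p-q∣ p q = ∣p-q∣-elim (ℚ._≤ ℚ.∣ p ℚ.- q ∣) ℚ.∣ p ∣ ℚ.∣ q ∣
  (p-q≤r (∣p∣≤∣q∣+∣p-q∣ p q))
  (p-q≤r (subst (λ r → ℚ.∣ q ∣ ℚ.≤ ℚ.∣ p ∣ ℚ.+ r) (∣p-q∣≡∣q-p∣ q p) (∣p∣≤∣q∣+∣p-q∣ q p)))

dominated : ∀ s (x y : ℝ) C → 0ℚ ℚ.< C → ∀ N₀ →
  (∀ m n → N₀ ℕ.≤ m → N₀ ℕ.≤ n →
    ℚ.∣ s m ℚ.- s n ∣ ℚ.≤
      C ℚ.* (ℚ.∣ seq x m ℚ.- seq x n ∣ ℚ.+ ℚ.∣ seq y m ℚ.- seq y n ∣)) →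
  IsCauchy s
dominated s x y C 0<C N₀ bound ε 0<ε = N , λ m n N≤m N≤n →
  ℚ.≤-<-trans
    (bound m n (ℕ.≤-trans N₀≤N N≤m) (ℕ.≤-trans N₀≤N N≤n))
    (subst (_ ℚ.<_) C[η+η]≡ε
      (ℚ.*-monoʳ-<-pos C
        (ℚ.+-mono-<
          (proj₂ X m n (ℕ.≤-trans X≤N N≤m) (ℕ.≤-trans X≤N N≤n))
          (proj₂ Y m n (ℕ.≤-trans Y≤N N≤m) (ℕ.≤-trans Y≤N N≤n)))))
  where
  instance
    C-pos : ℚ.Positive C
    C-pos = 0<⇒pos 0<C
    C-nonZero : ℚ.NonZero C
    C-nonZero = ℚ.pos⇒nonZero C
    1/C-pos : ℚ.Positive (ℚ.1/ C)
    1/C-pos = ℚ.1/pos⇒pos C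
    ε-pos : ℚ.Positive ε
    ε-pos = 0<⇒pos 0<ε
  η : ℚ
  η = ½ ℚ.* (ε ℚ.* ℚ.1/ C)
  0<η : 0ℚ ℚ.< η
  0<η = ℚ.positive⁻¹ η
    {{ℚ.pos*pos⇒pos ½ (ε ℚ.* ℚ.1/ C) {{ℚ.pos*pos⇒pos ε (ℚ.1/ C)}}}}
  C[η+η]≡ε : C ℚ.* (η ℚ.+ η) ≡ ε
  C[η+η]≡ε = trans
    (solve 3 (λ c e i → c :* (con ½ :* (e :* i) :+ con ½ :* (e :* i)) := e :* (c :* i))
      refl C ε (ℚ.1/ C))
    (trans (cong (ε ℚ.*_) (ℚ.*-inverseʳ C)) (ℚ.*-identityʳ ε))
    where open ℚ-Solver
  X = cauchy x η 0<η
  Y = cauchy y η 0<η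
  N = N₀ ℕ.⊔ (proj₁ X ℕ.⊔ proj₁ Y)
  N₀≤N : N₀ ℕ.≤ N
  N₀≤N = ℕ.m≤m⊔n N₀ _
  X≤N : proj₁ X ℕ.≤ N
  X≤N = ℕ.≤-trans (ℕ.m≤m⊔n _ (proj₁ Y)) (ℕ.m≤n⊔m N₀ _)
  Y≤N : proj₁ Y ℕ.≤ N
  Y≤N = ℕ.≤-trans (ℕ.m≤n⊔m (proj₁ X) _) (ℕ.m≤n⊔m N₀ _)

0<1 : 0ℚ ℚ.< 1ℚ
0<1 = ℚ.positive⁻¹ 1ℚ

p≤1*[p+q] : ∀ p q → 0ℚ ℚ.≤ q → p ℚ.≤ 1ℚ ℚ.* (p ℚ.+ q)
p≤1*[p+q] p q 0≤q = subst₂ ℚ._≤_ (ℚ.+-identityʳ p) (sym (ℚ.*-identityˡ (p ℚ.+ q)))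
  (ℚ.+-monoʳ-≤ p 0≤q)

bounded : (x : ℝ) → ∃[ B ] 0ℚ ℚ.< B × ∃[ N ] (∀ n → N ℕ.≤ n → ℚ.∣ seq x n ∣ ℚ.≤ B)
bounded x = ℚ.∣ seq x N ∣ ℚ.+ 1ℚ
  , subst (ℚ._< ℚ.∣ seq x N ∣ ℚ.+ 1ℚ) (ℚ.+-identityˡ 0ℚ) (ℚ.+-mono-≤-< (ℚ.0≤∣p∣ (seq x N)) 0<1)
  , N
  , λ n N≤n → ℚ.≤-trans (∣p∣≤∣q∣+∣p-q∣ (seq x n) (seq x N))
      (ℚ.+-monoʳ-≤ ℚ.∣ seq x N ∣ (ℚ.<⇒≤ (h n N N≤n ℕ.≤-refl)))
  where
  N = proj₁ (cauchy x 1ℚ 0<1)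
  h = proj₂ (cauchy x 1ℚ 0<1)

fromℚ : ℚ → ℝ
fromℚ p = mkℝ (λ _ → p) λ ε 0<ε → 0 , λ _ _ _ _ →
  subst (ℚ._< ε) (cong ℚ.∣_∣ (sym (ℚ.+-inverseʳ p))) 0<ε

0ℝ 1ℝ : ℝ
0ℝ = fromℚ 0ℚ
1ℝ = fromℚ 1ℚ

infixl 6 _+_ _-_
infixl 7 _*_
infix  8 -_

_+_ : ℝ → ℝ → ℝ
seq    (x + y) n = seq x n ℚ.+ seq y n
cauchy (x + y) = dominated s x y 1ℚ 0<1 0 λ m n _ _ →
  subst₂ ℚ._≤_
    (cong ℚ.∣_∣ (solve 4 (λ a b c d → (a :- c) :+ (b :- d) := (a :+ b) :- (c :+ d)) refl
      (seq x m) (seq y m) (seq x n) (seq y n)))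
    (sym (ℚ.*-identityˡ _))
    (ℚ.∣p+q∣≤∣p∣+∣q∣ (seq x m ℚ.- seq x n) (seq y m ℚ.- seq y n))
  where
  open ℚ-Solver
  s = λ n → seq x n ℚ.+ seq y n

-_ : ℝ → ℝ
seq    (- x) n = ℚ.- seq x n
cauchy (- x) = dominated s x x 1ℚ 0<1 0 λ m n _ _ →
  subst (ℚ._≤ 1ℚ ℚ.* (ℚ.∣ seq x m ℚ.- seq x n ∣ ℚ.+ ℚ.∣ seq x m ℚ.- seq x n ∣))
    (trans (∣p-q∣≡∣q-p∣ (seq x m) (seq x n))
      (cong ℚ.∣_∣ (solve 2 (λ a b → b :- a := (:- a) :- (:- b)) refl (seq x m) (seq x n))))
    (p≤1*[p+q] _ _ (ℚ.0≤∣p∣ (seq x m ℚ.- seq x n)))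
  where
  open ℚ-Solver
  s = λ n → ℚ.- seq x n

_-_ : ℝ → ℝ → ℝ
x - y = x + - y

∣_∣ : ℝ → ℝ
seq    ∣ x ∣ n = ℚ.∣ seq x n ∣
cauchy ∣ x ∣ = dominated s x x 1ℚ 0<1 0 λ m n _ _ →
  ℚ.≤-trans (∣∣p∣-∣q∣∣≤∣p-q∣ (seq x m) (seq x n))
    (p≤1*[p+q] _ _ (ℚ.0≤∣p∣ (seq x m ℚ.- seq x n)))
  where
  s = λ n → ℚ.∣ seq x n ∣

_*_ : ℝ → ℝ → ℝ
seq    (x * y) n = seq x n ℚ.* seq y n
cauchy (x * y) = dominated s x y C 0<C N bound
  where
  open ℚ-Solver
  s = λ n → seq x n ℚ.* seq y n
  Bx = proj₁ (bounded x)
  By = proj₁ (bounded y)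
  0<Bx = proj₁ (proj₂ (bounded x))
  0<By = proj₁ (proj₂ (bounded y))
  Nx = proj₁ (proj₂ (proj₂ (bounded x)))
  Ny = proj₁ (proj₂ (proj₂ (bounded y)))
  C = Bx ℚ.+ By
  0<C : 0ℚ ℚ.< C
  0<C = subst (ℚ._< C) (ℚ.+-identityˡ 0ℚ) (ℚ.+-mono-< 0<Bx 0<By)
  N = Nx ℕ.⊔ Ny
  scale : ∀ p q {B} → ℚ.∣ p ∣ ℚ.≤ B → B ℚ.≤ C → ℚ.∣ p ℚ.* q ∣ ℚ.≤ C ℚ.* ℚ.∣ q ∣
  scale p q ∣p∣≤B B≤C = subst (ℚ._≤ C ℚ.* ℚ.∣ q ∣) (sym (ℚ.∣p*q∣≡∣p∣*∣q∣ p q))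
    (ℚ.*-monoʳ-≤-nonNeg ℚ.∣ q ∣ {{ℚ.∣-∣-nonNeg q}} (ℚ.≤-trans ∣p∣≤B B≤C))
  bound : ∀ m n → N ℕ.≤ m → N ℕ.≤ n →
    ℚ.∣ seq x m ℚ.* seq y m ℚ.- seq x n ℚ.* seq y n ∣ ℚ.≤
      C ℚ.* (ℚ.∣ seq x m ℚ.- seq x n ∣ ℚ.+ ℚ.∣ seq y m ℚ.- seq y n ∣)
  bound m n N≤m N≤n = subst₂ ℚ._≤_
    (cong ℚ.∣_∣ (solve 4
      (λ a b c d → d :* (a :- c) :+ a :* (b :- d) := a :* b :- c :* d) refl
      (seq x m) (seq y m) (seq x n) (seq y n)))
    (sym (ℚ.*-distribˡ-+ C _ _))
    (ℚ.≤-trans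
      (ℚ.∣p+q∣≤∣p∣+∣q∣ (seq y n ℚ.* (seq x m ℚ.- seq x n)) (seq x m ℚ.* (seq y m ℚ.- seq y n)))
      (ℚ.+-mono-≤
        (scale (seq y n) (seq x m ℚ.- seq x n)
          (proj₂ (proj₂ (proj₂ (bounded y))) n (ℕ.≤-trans (ℕ.m≤n⊔m Nx Ny) N≤n))
          (subst (ℚ._≤ C) (ℚ.+-identityˡ By) (ℚ.+-monoˡ-≤ By (ℚ.<⇒≤ 0<Bx))))
        (scale (seq x m) (seq y m ℚ.- seq y n)
          (proj₂ (proj₂ (proj₂ (bounded x))) m (ℕ.≤-trans (ℕ.m≤m⊔n Nx Ny) N≤m))
          (subst (ℚ._≤ C) (ℚ.+-identityʳ Bx) (ℚ.+-monoʳ-≤ Bx (ℚ.<⇒≤ 0<By))))))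

-- The reciprocal on ℚ, with the junk value 0 at 0.
recip : ℚ → ℚ
recip p with p ℚ.≟ 0ℚ
... | yes _   = 0ℚ
... | no  p≢0 = (ℚ.1/ p) {{ℚ.≢-nonZero p≢0}}

recip-inverseʳ : ∀ p → p ≢ 0ℚ → p ℚ.* recip p ≡ 1ℚ
recip-inverseʳ p p≢0 with p ℚ.≟ 0ℚ
... | yes p≡0 = ⊥-elim (p≢0 p≡0)
... | no  p≢0 = ℚ.*-inverseʳ p {{ℚ.≢-nonZero p≢0}}

apart⇒bounded-below : (x : ℝ) → x # 0ℝ →
  ∃[ ε ] 0ℚ ℚ.< ε × ∃[ N ] (∀ n → N ℕ.≤ n → ε ℚ.≤ ℚ.∣ seq x n ∣)
apart⇒bounded-below x (inj₁ (ε , 0<ε , N , h)) = ε , 0<ε , N , λ n N≤n →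
  subst₂ ℚ._≤_ (ε≡ n) (ℚ.∣-p∣≡∣p∣ (seq x n))
    (ℚ.≤-trans
      (subst ((seq x n ℚ.+ ε) ℚ.- seq x n ℚ.≤_) (ℚ.+-identityˡ (ℚ.- seq x n)) (ℚ.+-monoˡ-≤ (ℚ.- seq x n) (h n N≤n)))
      (p≤∣p∣ (ℚ.- seq x n)))
  where
  open ℚ-Solver
  ε≡ : ∀ n → (seq x n ℚ.+ ε) ℚ.+ (ℚ.- seq x n) ≡ ε
  ε≡ n = solve 2 (λ a e → (a :+ e) :+ (:- a) := e) refl (seq x n) ε
  p≤∣p∣ : ∀ p → p ℚ.≤ ℚ.∣ p ∣
  p≤∣p∣ p with ℚ.≤-total 0ℚ p
  ... | inj₁ 0≤p = ℚ.≤-reflexive (sym (ℚ.0≤p⇒∣p∣≡p 0≤p))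
  ... | inj₂ p≤0 = ℚ.≤-trans p≤0 (ℚ.0≤∣p∣ p)
apart⇒bounded-below x (inj₂ (ε , 0<ε , N , h)) = ε , 0<ε , N , λ n N≤n →
  let ε≤xₙ = subst (ℚ._≤ seq x n) (ℚ.+-identityˡ ε) (h n N≤n) in
  ℚ.≤-trans ε≤xₙ
    (ℚ.≤-reflexive (sym (ℚ.0≤p⇒∣p∣≡p (ℚ.≤-trans (ℚ.<⇒≤ 0<ε) ε≤xₙ))))

recipℝ : (x : ℝ) → x # 0ℝ → ℝ
seq    (recipℝ x x#0) n = recip (seq x n)
cauchy (recipℝ x x#0) = dominated s x x C 0<C N bound
  where
  open ℚ-Solver
  s = λ n → recip (seq x n)
  ε = proj₁ (apart⇒bounded-below x x#0)
  0<ε = proj₁ (proj₂ (apart⇒bounded-below x x#0))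
  N = proj₁ (proj₂ (proj₂ (apart⇒bounded-below x x#0)))
  h = proj₂ (proj₂ (proj₂ (apart⇒bounded-below x x#0)))
  instance
    ε-pos : ℚ.Positive ε
    ε-pos = 0<⇒pos 0<ε
    ε-nonZero : ℚ.NonZero ε
    ε-nonZero = ℚ.pos⇒nonZero ε
    1/ε-pos : ℚ.Positive (ℚ.1/ ε)
    1/ε-pos = ℚ.1/pos⇒pos ε
    1/ε-nonNeg : ℚ.NonNegative (ℚ.1/ ε)
    1/ε-nonNeg = ℚ.pos⇒nonNeg (ℚ.1/ ε)
  C = ℚ.1/ ε ℚ.* ℚ.1/ ε
  0<C : 0ℚ ℚ.< C
  0<C = ℚ.positive⁻¹ C {{ℚ.pos*pos⇒pos (ℚ.1/ ε) (ℚ.1/ ε)}}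
  xₙ≢0 : ∀ n → N ℕ.≤ n → seq x n ≢ 0ℚ
  xₙ≢0 n N≤n eq = ℚ.<-irrefl refl
    (ℚ.<-≤-trans 0<ε (subst (λ p → ε ℚ.≤ ℚ.∣ p ∣) eq (h n N≤n)))
  inv : ∀ n → N ℕ.≤ n → seq x n ℚ.* recip (seq x n) ≡ 1ℚ
  inv n N≤n = recip-inverseʳ (seq x n) (xₙ≢0 n N≤n)
  ∣recip∣≤ : ∀ n → N ℕ.≤ n → ℚ.∣ recip (seq x n) ∣ ℚ.≤ ℚ.1/ ε
  ∣recip∣≤ n N≤n = subst₂ ℚ._≤_
    (trans (sym (ℚ.*-assoc (ℚ.1/ ε) ε ∣r∣))
      (trans (cong (ℚ._* ∣r∣) (ℚ.*-inverseˡ ε)) (ℚ.*-identityˡ ∣r∣)))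
    (trans (cong (ℚ.1/ ε ℚ.*_)
        (trans (sym (ℚ.∣p*q∣≡∣p∣*∣q∣ (seq x n) r)) (cong ℚ.∣_∣ (inv n N≤n))))
      (ℚ.*-identityʳ (ℚ.1/ ε)))
    (ℚ.*-monoˡ-≤-nonNeg (ℚ.1/ ε)
      (ℚ.*-monoʳ-≤-nonNeg ∣r∣ {{ℚ.∣-∣-nonNeg r}} (h n N≤n)))
    where
    r = recip (seq x n)
    ∣r∣ = ℚ.∣ r ∣
  bound : ∀ m n → N ℕ.≤ m → N ℕ.≤ n →
    ℚ.∣ recip (seq x m) ℚ.- recip (seq x n) ∣ ℚ.≤
      C ℚ.* (ℚ.∣ seq x m ℚ.- seq x n ∣ ℚ.+ ℚ.∣ seq x m ℚ.- seq x n ∣)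
  bound m n N≤m N≤n = ℚ.≤-trans
    (subst (ℚ._≤ C ℚ.* D) (sym difference) (ℚ.*-monoʳ-≤-nonNeg D {{D-nonNeg}} ∣ab∣≤C))
    (ℚ.*-monoˡ-≤-nonNeg C {{ℚ.pos⇒nonNeg C {{0<⇒pos 0<C}}}}
      (subst (ℚ._≤ D ℚ.+ D) (ℚ.+-identityʳ D) (ℚ.+-monoʳ-≤ D (ℚ.0≤∣p∣ _))))
    where
    a = recip (seq x m)
    b = recip (seq x n)
    D = ℚ.∣ seq x m ℚ.- seq x n ∣
    D-nonNeg = ℚ.∣-∣-nonNeg (seq x m ℚ.- seq x n)
    ∣ab∣≤C : ℚ.∣ a ℚ.* b ∣ ℚ.≤ C
    ∣ab∣≤C = subst (ℚ._≤ C) (sym (ℚ.∣p*q∣≡∣p∣*∣q∣ a b))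
      (ℚ.≤-trans
        (ℚ.*-monoʳ-≤-nonNeg ℚ.∣ b ∣ {{ℚ.∣-∣-nonNeg b}} (∣recip∣≤ m N≤m))
        (ℚ.*-monoˡ-≤-nonNeg (ℚ.1/ ε) (∣recip∣≤ n N≤n)))
    a-b : a ℚ.- b ≡ (a ℚ.* b) ℚ.* (seq x n ℚ.- seq x m)
    a-b = trans
      (cong₂ ℚ._-_
        (trans (sym (ℚ.*-identityʳ a)) (cong (a ℚ.*_) (sym (inv n N≤n))))
        (trans (sym (ℚ.*-identityʳ b)) (cong (b ℚ.*_) (sym (inv m N≤m)))))
      (solve 4 (λ a b u v → a :* (v :* b) :- b :* (u :* a) := (a :* b) :* (v :- u)) refl
        a b (seq x m) (seq x n))
    difference : ℚ.∣ a ℚ.- b ∣ ≡ ℚ.∣ a ℚ.* b ∣ ℚ.* D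
    difference = trans (cong ℚ.∣_∣ a-b)
      (trans (ℚ.∣p*q∣≡∣p∣*∣q∣ (a ℚ.* b) (seq x n ℚ.- seq x m))
        (cong (ℚ.∣ a ℚ.* b ∣ ℚ.*_) (∣p-q∣≡∣q-p∣ (seq x n) (seq x m))))

div : (x y : ℝ) → y # 0ℝ → ℝ
div x y y#0 = x * recipℝ y y#0

⌊√_⌋ : ℕ → ℕ
⌊√ zero ⌋ = 0
⌊√ suc n ⌋ with suc ⌊√ n ⌋ ℕ.* suc ⌊√ n ⌋ ℕ.≤? suc n
... | yes _ = suc ⌊√ n ⌋
... | no  _ = ⌊√ n ⌋

⌊√⌋-lower : ∀ n → ⌊√ n ⌋ ℕ.* ⌊√ n ⌋ ℕ.≤ n
⌊√⌋-lower zero = ℕ.z≤n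
⌊√⌋-lower (suc n) with suc ⌊√ n ⌋ ℕ.* suc ⌊√ n ⌋ ℕ.≤? suc n
... | yes le = le
... | no  _  = ℕ.m≤n⇒m≤1+n (⌊√⌋-lower n)

⌊√⌋-upper : ∀ n → n ℕ.< suc ⌊√ n ⌋ ℕ.* suc ⌊√ n ⌋
⌊√⌋-upper zero = ℕ.s≤s ℕ.z≤n
⌊√⌋-upper (suc n) with suc ⌊√ n ⌋ ℕ.* suc ⌊√ n ⌋ ℕ.≤? suc n
... | yes _   = ℕ.≤-<-trans (⌊√⌋-upper n)
  (ℕ.*-mono-< (ℕ.n<1+n (suc ⌊√ n ⌋)) (ℕ.n<1+n (suc ⌊√ n ⌋)))
... | no  nle = ℕ.≰⇒> nle

√-approx : ℕ → ℕ → ℚ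
√-approx n k = + ⌊√ n ℕ.* (suc k ℕ.* suc k) ⌋ ℚ./ suc k

square-cancel-< : ∀ a b → a ℕ.* a ℕ.< b ℕ.* b → a ℕ.< b
square-cancel-< a b h = ℕ.≰⇒> λ b≤a → ℕ.<⇒≱ h (ℕ.*-mono-≤ b≤a b≤a)

/-cancel-< : ∀ a M b N → a ℕ.* suc N ℕ.< b ℕ.* suc M → + a ℚ./ suc M ℚ.< + b ℚ./ suc N
/-cancel-< a M b N h = ℚ.toℚᵘ-cancel-<
  (ℚᵘ.<-respˡ-≃ (ℚᵘ.≃-sym (ℚ.toℚᵘ-fromℚᵘ (mkℚᵘ (+ a) M)))
    (ℚᵘ.<-respʳ-≃ (ℚᵘ.≃-sym (ℚ.toℚᵘ-fromℚᵘ (mkℚᵘ (+ b) N)))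
      (*<* (subst₂ ℤ._<_ (ℤ.pos-* a (suc N)) (ℤ.pos-* b (suc M)) (+<+ h)))))

suc-/ : ∀ b N → + suc b ℚ./ suc N ≡ + b ℚ./ suc N ℚ.+ + 1 ℚ./ suc N
suc-/ b N = ℚ.toℚᵘ-injective
  (ℚᵘ.≃-trans (ℚ.toℚᵘ-fromℚᵘ (mkℚᵘ (+ suc b) N))
    (ℚᵘ.≃-trans (*≡* eq)
      (ℚᵘ.≃-sym
        (ℚᵘ.≃-trans (ℚ.toℚᵘ-homo-+ (+ b ℚ./ suc N) (+ 1 ℚ./ suc N))
          (ℚᵘ.+-cong (ℚ.toℚᵘ-fromℚᵘ (mkℚᵘ (+ b) N)) (ℚ.toℚᵘ-fromℚᵘ (mkℚᵘ (+ 1) N)))))))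
  where
  open ℕ-Solver
  numerators : + b ℤ.* + suc N ℤ.+ + 1 ℤ.* + suc N ≡ + (suc b ℕ.* suc N)
  numerators = trans
    (cong₂ ℤ._+_ (sym (ℤ.pos-* b (suc N))) (sym (ℤ.pos-* 1 (suc N))))
    (cong +_ (solve 2 (λ b n → b :* (con 1 :+ n) :+ con 1 :* (con 1 :+ n)
      := (con 1 :+ b) :* (con 1 :+ n)) refl b N))
  eq : + suc b ℤ.* + (suc N ℕ.* suc N) ≡
    (+ b ℤ.* + suc N ℤ.+ + 1 ℤ.* + suc N) ℤ.* + suc N
  eq = trans (sym (ℤ.pos-* (suc b) (suc N ℕ.* suc N)))
    (trans (cong +_ (sym (ℕ.*-assoc (suc b) (suc N) (suc N))))
      (trans (ℤ.pos-* (suc b ℕ.* suc N) (suc N)) (cong (ℤ._* + suc N) (sym numerators))))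

√-approx-< : ∀ n k l → √-approx n k ℚ.- √-approx n l ℚ.< + 1 ℚ./ suc l
√-approx-< n k l = p-q<r (subst (√-approx n k ℚ.<_) (suc-/ b l)
  (/-cancel-< a k (suc b) l (square-cancel-< (a ℕ.* L) (suc b ℕ.* K) squares)))
  where
  open ℕ-Solver
  K = suc k
  L = suc l
  a = ⌊√ n ℕ.* (K ℕ.* K) ⌋
  b = ⌊√ n ℕ.* (L ℕ.* L) ⌋
  squares : (a ℕ.* L) ℕ.* (a ℕ.* L) ℕ.< (suc b ℕ.* K) ℕ.* (suc b ℕ.* K)
  squares = ℕ.≤-<-trans
    (subst₂ ℕ._≤_
      (solve 2 (λ a l → a :* a :* (l :* l) := a :* l :* (a :* l)) refl a L)
      (solve 3 (λ n k l → n :* (k :* k) :* (l :* l) := n :* (l :* l) :* (k :* k)) refl n K L)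
      (ℕ.*-monoˡ-≤ (L ℕ.* L) (⌊√⌋-lower (n ℕ.* (K ℕ.* K)))))
    (subst ((n ℕ.* (L ℕ.* L)) ℕ.* (K ℕ.* K) ℕ.<_)
      (solve 2 (λ b k → b :* b :* (k :* k) := b :* k :* (b :* k)) refl (suc b) K)
      (ℕ.*-monoˡ-< (K ℕ.* K) (⌊√⌋-upper (n ℕ.* (L ℕ.* L)))))

archimedean : ∀ ε → 0ℚ ℚ.< ε → ∃[ N ] (∀ n → N ℕ.≤ n → + 1 ℚ./ suc n ℚ.< ε)
archimedean ε@(mkℚ (+ zero)  d c) 0<ε =
  ⊥-elim (ℚ.<-irrefl (sym (ℚ.↥p≡0⇒p≡0 ε refl)) 0<ε)
archimedean ε@(mkℚ +[1+ p ] d c) _ = suc d , λ n d<n →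
  subst (+ 1 ℚ./ suc n ℚ.<_) (ℚ.↥p/↧p≡p ε)
    (/-cancel-< 1 n (suc p) d
      (ℕ.<-≤-trans
        (subst (ℕ._< suc n) (sym (ℕ.+-identityʳ (suc d))) (ℕ.s≤s d<n))
        (ℕ.m≤m+n (suc n) (p ℕ.* suc n))))
archimedean (mkℚ (ℤ.-[1+ p ]) d c) (ℚ.*<* ())

√ : ℕ → ℝ
√ n = mkℝ (√-approx n) λ ε 0<ε →
  proj₁ (archimedean ε 0<ε) , λ k l N≤k N≤l →
    ∣p-q∣-elim (ℚ._< ε) (√-approx n k) (√-approx n l)
      (ℚ.<-trans (√-approx-< n k l) (proj₂ (archimedean ε 0<ε) l N≤l))
      (ℚ.<-trans (√-approx-< n l k) (proj₂ (archimedean ε 0<ε) k N≤k))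

φ : ℝ
φ = fromℚ ½ * (1ℝ + √ 5)

φ#0 : φ # 0ℝ
φ#0 = inj₂ (½ , ℚ.positive⁻¹ ½ , 0 , λ n _ →
  ℚ.*-monoˡ-≤-nonNeg ½
    (ℚ.+-monoʳ-≤ 1ℚ
      (ℚ.nonNegative⁻¹ (√-approx 5 n)
        {{ℚ.normalize-nonNeg ⌊√ 5 ℕ.* (suc n ℕ.* suc n) ⌋ (suc n)}})))

φ⁻¹ : ℝ
φ⁻¹ = recipℝ φ φ#0

_∈[0,1] : ℝ → Set
x ∈[0,1] = 0ℝ ≤ x × x ≤ 1ℝ

Irrational : ℝ → Set
Irrational x = ∀ p → ¬ (x ≃ fromℚ p)

_⟶_ : (ℕ → ℝ) → ℝ → Set
u ⟶ x = ∀ ε → 0ℝ < ε → ∃[ N ] (∀ n → N ℕ.≤ n → ∣ u n - x ∣ < ε)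

-- convergent a n is [0; a 0, …, a (n - 1)]; the sequence is indexed from 0,
-- so a i is the partial quotient aᵢ₊₁.
convergent : (ℕ → ℕ) → ℕ → ℚ
convergent a zero    = 0ℚ
convergent a (suc n) = recip (+ a 0 ℚ./ 1 ℚ.+ convergent (λ i → a (suc i)) n)

record IsContinuedFraction (a : ℕ → ℕ) (x : ℝ) : Set where
  field
    positive  : ∀ i → 1 ℕ.≤ a i
    converges : (λ n → fromℚ (convergent a n)) ⟶ x

PartialQuotients≤ : ℕ → ℝ → Set
PartialQuotients≤ k x = ∃[ a ] IsContinuedFraction a x × (∀ i → a i ℕ.≤ k)

_∈Farey_ : ℚ → ℕ → Set
p ∈Farey n = 0ℚ ℚ.≤ p × p ℚ.≤ 1ℚ × ↧ₙ p ℕ.≤ n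

ConsecutiveFarey : ℚ → ℚ → Set
ConsecutiveFarey p q = ∃[ n ]
  p ∈Farey n × q ∈Farey n × p ℚ.< q × (∀ r → r ∈Farey n → ¬ (p ℚ.< r × r ℚ.< q))

mediant : ℚ → ℚ → ℚ
mediant p@record{} q@record{} = (↥ p ℤ.+ ↥ q) ℚ./ (↧ₙ p ℕ.+ ↧ₙ q)

ContinuousOn[0,1] : (ℝ → ℝ) → Set
ContinuousOn[0,1] g = ∀ x → x ∈[0,1] → ∀ ε → 0ℝ < ε →
  ∃[ δ ] 0ℝ < δ × (∀ y → y ∈[0,1] → ∣ y - x ∣ < δ → ∣ g y - g x ∣ < ε)

-- Only the values on [0,1] are constrained.  There the conditions determine g
-- up to _≃_, since every rational in [0,1] is reached by mediants;
-- compatibility with _≃_ is part of continuity.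
record IsDenjoyTichyUitz (lam : ℝ) (g : ℝ → ℝ) : Set where
  field
    mapsTo     : ∀ x → x ∈[0,1] → g x ∈[0,1]
    at-0       : g 0ℝ ≃ 0ℝ
    at-1       : g 1ℝ ≃ 1ℝ
    at-mediant : ∀ p q → ConsecutiveFarey p q →
      g (fromℚ (mediant p q)) ≃ (1ℝ - lam) * g (fromℚ p) + lam * g (fromℚ q)
    continuous : ContinuousOn[0,1] g

slope : (g : ℝ → ℝ) (x y : ℝ) → (y - x) # 0ℝ → ℝ
slope g x y y-x#0 = div (g y - g x) (y - x) y-x#0

HasDerivativeAt : (ℝ → ℝ) → ℝ → ℝ → Set
HasDerivativeAt g x l = ∀ ε → 0ℝ < ε → ∃[ δ ] 0ℝ < δ ×
  (∀ y → y ∈[0,1] → (y-x#0 : (y - x) # 0ℝ) → ∣ y - x ∣ < δ → ∣ slope g x y y-x#0 - l ∣ < ε)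

HasDerivative+∞At : (ℝ → ℝ) → ℝ → Set
HasDerivative+∞At g x = ∀ M → ∃[ δ ] 0ℝ < δ ×
  (∀ y → y ∈[0,1] → (y-x#0 : (y - x) # 0ℝ) → ∣ y - x ∣ < δ → M < slope g x y y-x#0)

{-# OPTIONS --safe #-}

-- A left step in the Farey tree multiplies the increment of g by λ and a right step by 1 - λ, and
-- only 3/5 ≤ λ ≤ 5/8 is used of λ = φ⁻¹.  The expansion of x is read as the sequence of blocks
-- "a left steps, then b right steps" of its path.  If y is separated from x just after the k-th
-- block, with Farey denominators Q and S at that point, then the slope between x and y is, up to a
-- bounded factor, w Q S with w the increment of g over the k-th interval.  Each block with
-- a, b ≤ 2 multiplies w (2 Q + S)² by at least 33/32, so the slope tends to infinity; each block
-- with a = 1, b = 3 multiplies w (5 Q + 4 S)² by at most 12/13, so at [0; 1, 3, 1, 3, …] the slope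
-- tends to 0.  Comparing y with the endpoints of the intervals is undecidable for a real y, so
-- secant inequalities are proved for rational approximations and carried over by continuity.

module Submission where

open import Defs hiding (_<_; _≤_; _+_; _-_; _*_; -_; ∣_∣; _≃_)
import Defs as ℝ
open import Data.Rational.Base as ℚ using (ℚ; mkℚ; 0ℚ; 1ℚ; ½; ↧ₙ_; _+_; _*_; _-_; -_; _≤_; _<_; ∣_∣; _/_)
import Data.Rational.Properties as ℚ
open import Data.Rational.Solver using () renaming (module +-*-Solver to ℚ-Solver)
open import Data.Rational.Unnormalised.Base using (mkℚᵘ; *≡*)
import Data.Rational.Unnormalised.Properties as ℚᵘ
open import Data.Integer.Base as ℤ using (+_; -[1+_])
import Data.Integer.Properties as ℤ
open import Data.Nat.Base as ℕ using (ℕ; zero; suc)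
import Data.Nat.Properties as ℕ
open import Data.Nat.Coprimality using (Coprime; 1-coprimeTo)
open import Data.Nat.Divisibility using (_∣_; ∣m+n∣m⇒∣n; ∣n⇒∣m*n; ∣m⇒∣m*n; ∣1⇒≡1)
open import Data.Nat.Solver using () renaming (module +-*-Solver to ℕ-Solver)
open import Data.Product.Base using (∃-syntax; _×_; _,_; proj₁; proj₂)
open import Data.Sum.Base using (_⊎_; inj₁; inj₂; [_,_]′)
open import Data.Empty using (⊥-elim)
open import Relation.Binary.PropositionalEquality using (_≡_; _≢_; refl; sym; trans; cong; cong₂; subst; subst₂)
open import Relation.Binary.Definitions using (tri<; tri≈; tri>)
open import Relation.Nullary using (¬_; yes; no)
open import Relation.Nullary.Decidable using (from-yes)

-- A Farey interval has width exactly 1 / (Q S), so w Q S is the mean slope of `g` over it. This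
-- product cannot be followed block by block: the block (1, 2) carries Q = S to 5 Q and 2 Q, so Q S
-- gains only a factor 10, while the lower bound for w is multiplied by (3/5) (3/8)² = 27/320. A
-- linear form x Q + y S with x, y > 0 grows over a block by at least the smaller of its two
-- coefficient ratios, whatever Q / S is, and for coefficients near an eigenvector of the block this
-- ratio is near the eigenvalue. Hence squares of linear forms are followed, and they are compared
-- with products of denominators only at the end. Besides the bounds for its increments, only
-- monotonicity on the rationals and continuity of `g` enter. If a Farey interval J lies in [u, v]
-- and [u, v] lies in a Farey interval I, the increment over [u, v] is between those over J and I,
-- and v - u is between the two widths. So it suffices to find, next to x, an interval J that is not
-- much smaller than I and is crossed on the way to y.

0≤+ : ∀ {p q} → 0ℚ ≤ p → 0ℚ ≤ q → 0ℚ ≤ p + q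
0≤+ {p} {q} 0≤p 0≤q = subst (_≤ p + q) (ℚ.+-identityˡ 0ℚ) (ℚ.+-mono-≤ 0≤p 0≤q)

0≤* : ∀ {p q} → 0ℚ ≤ p → 0ℚ ≤ q → 0ℚ ≤ p * q
0≤* {p} {q} 0≤p 0≤q = ℚ.nonNegative⁻¹ (p * q)
  {{ℚ.nonNeg*nonNeg⇒nonNeg p {{ℚ.nonNegative 0≤p}} q {{ℚ.nonNegative 0≤q}}}}

0<+ : ∀ {p q} → 0ℚ < p → 0ℚ ≤ q → 0ℚ < p + q
0<+ {p} {q} 0<p 0≤q = subst (_< p + q) (ℚ.+-identityˡ 0ℚ) (ℚ.+-mono-<-≤ 0<p 0≤q)

0<* : ∀ {p q} → 0ℚ < p → 0ℚ < q → 0ℚ < p * q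
0<* {p} {q} 0<p 0<q = ℚ.positive⁻¹ (p * q)
  {{ℚ.pos*pos⇒pos p {{ℚ.positive 0<p}} q {{ℚ.positive 0<q}}}}

p≤q⇒0≤q-p : ∀ {p q} → p ≤ q → 0ℚ ≤ q - p
p≤q⇒0≤q-p {p} {q} p≤q = subst (_≤ q - p) (ℚ.+-inverseʳ p) (ℚ.+-monoˡ-≤ (- p) p≤q)

p<q⇒0<q-p : ∀ {p q} → p < q → 0ℚ < q - p
p<q⇒0<q-p {p} {q} p<q = subst (_< q - p) (ℚ.+-inverseʳ p) (ℚ.+-monoˡ-< (- p) p<q)

-- The form in which inequalities are certified below: `t` is a sum of products of nonnegative
-- terms, and the ring solver checks that it equals the difference.
≤-by : ∀ {p q t} → 0ℚ ≤ t → q - p ≡ t → p ≤ q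
≤-by {p} {q} {t} 0≤t eq = subst₂ _≤_ (ℚ.+-identityˡ p)
  (trans (cong (_+ p) (sym eq)) (solve 2 (λ p q → (q :- p) :+ p := q) refl p q))
  (ℚ.+-monoˡ-≤ p 0≤t)
  where open ℚ-Solver

<-by : ∀ {p q t} → 0ℚ < t → q - p ≡ t → p < q
<-by {p} {q} {t} 0<t eq = subst₂ _<_ (ℚ.+-identityˡ p)
  (trans (cong (_+ p) (sym eq)) (solve 2 (λ p q → (q :- p) :+ p := q) refl p q))
  (ℚ.+-monoˡ-< p 0<t)
  where open ℚ-Solver

≤+ε : ∀ {p q ε} → 0ℚ ≤ ε → p ≤ q → p ≤ q + ε
≤+ε {p} {q} 0≤ε p≤q = subst (_≤ _) (ℚ.+-identityʳ p) (ℚ.+-mono-≤ p≤q 0≤ε)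

half-< : ∀ {ε} → 0ℚ < ε → 0ℚ < ½ * ε
half-< = 0<* (ℚ.positive⁻¹ ½)

∣p∣<⇒< : ∀ {p q} → ∣ p ∣ < q → p < q
∣p∣<⇒< {p} ∣p∣<q with ℚ.≤-total 0ℚ p
... | inj₁ 0≤p = subst (_< _) (ℚ.0≤p⇒∣p∣≡p 0≤p) ∣p∣<q
... | inj₂ p≤0 = ℚ.≤-<-trans (ℚ.≤-trans p≤0 (ℚ.0≤∣p∣ p)) ∣p∣<q

-- Eventual inequalities between rational sequences

Eventually : (ℕ → Set) → Set
Eventually P = ∃[ N ] (∀ n → N ℕ.≤ n → P n)

always : ∀ {P : ℕ → Set} → (∀ n → P n) → Eventually P
always h = 0 , λ n _ → h n

ev-map : ∀ {P Q : ℕ → Set} → (∀ n → P n → Q n) → Eventually P → Eventually Q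
ev-map f (N , h) = N , λ n N≤n → f n (h n N≤n)

ev-zip : ∀ {P Q R : ℕ → Set} → (∀ n → P n → Q n → R n) →
  Eventually P → Eventually Q → Eventually R
ev-zip f (M , h) (N , k) = M ℕ.⊔ N , λ n le →
  f n (h n (ℕ.≤-trans (ℕ.m≤m⊔n M N) le)) (k n (ℕ.≤-trans (ℕ.m≤n⊔m M N) le))

ev-witness : ∀ {P : ℕ → Set} → Eventually P → ∃[ n ] P n
ev-witness (N , h) = N , h N ℕ.≤-refl

infix 4 _≲_

-- The order of the limits in positive form, free of the negation in `ℝ._≤_` and applicable to
-- sequences without a Cauchy proof. Being a record, it lets `u` and `v` be inferred.
record _≲_ (u v : ℕ → ℚ) : Set where
  constructor approx
  field within : ∀ ε → 0ℚ < ε → Eventually (λ n → u n ≤ v n + ε)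

open _≲_

const : ℚ → ℕ → ℚ
const p _ = p

ev≤⇒≲ : ∀ {u v} → Eventually (λ n → u n ≤ v n) → u ≲ v
ev≤⇒≲ h = approx λ ε 0<ε → ev-map (λ n → ≤+ε (ℚ.<⇒≤ 0<ε)) h

≲-refl : ∀ {u} → u ≲ u
≲-refl = ev≤⇒≲ (always λ _ → ℚ.≤-refl)

≲-trans : ∀ {u v w} → u ≲ v → v ≲ w → u ≲ w
≲-trans {u} {v} {w} h k = approx λ ε 0<ε → ev-zip
  (λ n p q → ≤-by (0≤+ (p≤q⇒0≤q-p p) (p≤q⇒0≤q-p q))
    (solve 4 (λ u v w ε → (w :+ ε) :- u :=
      ((v :+ con ½ :* ε) :- u) :+ ((w :+ con ½ :* ε) :- v)) refl (u n) (v n) (w n) ε))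
  (within h (½ * ε) (half-< 0<ε)) (within k (½ * ε) (half-< 0<ε))
  where open ℚ-Solver

≲-shift : ∀ {u v u′ v′} → (∀ n → v′ n - u′ n ≡ v n - u n) → u ≲ v → u′ ≲ v′
≲-shift {u} {v} {u′} {v′} eq h = approx λ ε 0<ε → ev-map
  (λ n p → ≤-by (p≤q⇒0≤q-p p)
    (trans (solve 3 (λ u v ε → (v :+ ε) :- u := (v :- u) :+ ε) refl (u′ n) (v′ n) ε)
      (trans (cong (_+ ε) (eq n))
        (solve 3 (λ u v ε → (v :- u) :+ ε := (v :+ ε) :- u) refl (u n) (v n) ε))))
  (within h ε 0<ε)
  where open ℚ-Solver

const-≲-cancel : ∀ {p q} → const p ≲ const q → p ≤ q
const-≲-cancel {p} {q} h with p ℚ.≤? q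
... | yes p≤q = p≤q
... | no p≰q = ⊥-elim (ℚ.<-irrefl refl (ℚ.<-≤-trans 0<½d (≤-by (p≤q⇒0≤q-p p≤)
    (solve 2 (λ p q → con 0ℚ :- con ½ :* (p :- q) := (q :+ con ½ :* (p :- q)) :- p) refl p q))))
  where
  open ℚ-Solver
  0<½d : 0ℚ < ½ * (p - q)
  0<½d = half-< (p<q⇒0<q-p (ℚ.≰⇒> p≰q))
  p≤ : p ≤ q + ½ * (p - q)
  p≤ = proj₂ (ev-witness (within h _ 0<½d))

≃⇒≲ : ∀ {x y} → x ℝ.≃ y → seq x ≲ seq y
≃⇒≲ {x} {y} h = approx λ ε 0<ε → ev-map
  (λ n p → ≤-by (p≤q⇒0≤q-p (ℚ.<⇒≤ (∣p∣<⇒< p)))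
    (solve 3 (λ x y ε → (y :+ ε) :- x := ε :- (x :- y)) refl (seq x n) (seq y n) ε))
  (h ε 0<ε)
  where open ℚ-Solver

≃-sym : ∀ {x y} → x ℝ.≃ y → y ℝ.≃ x
≃-sym {x} {y} h ε 0<ε = ev-map
  (λ n → subst (_< ε) (∣p-q∣≡∣q-p∣ (seq x n) (seq y n))) (h ε 0<ε)

-- The factor is a sequence because λ is a real, and `D` is above `w` only up to `ε`; `κ ≤ 1` keeps
-- that error from being magnified.
scale-lower : ∀ {κ D e : ℕ → ℚ} {k w} → 0ℚ ≤ w →
  Eventually (λ n → k ≤ κ n) → Eventually (λ n → 0ℚ ≤ κ n) → Eventually (λ n → κ n ≤ 1ℚ) →
  (λ n → κ n * D n) ≲ e → const w ≲ D → const (k * w) ≲ e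
scale-lower {κ} {D} {e} {k} {w} 0≤w k≤κ 0≤κ κ≤1 κD≲e w≲D = ≲-trans step κD≲e
  where
  open ℚ-Solver
  step : const (k * w) ≲ (λ n → κ n * D n)
  step = approx λ ε 0<ε → ev-zip
    (λ { n (a , b) (c , d) → ≤-by
      (0≤+ (0≤+ (0≤* (p≤q⇒0≤q-p a) 0≤w) (0≤* b (p≤q⇒0≤q-p d)))
        (0≤* (p≤q⇒0≤q-p c) (ℚ.<⇒≤ 0<ε)))
      (solve 5 (λ κ D k w ε → (κ :* D :+ ε) :- k :* w :=
        ((κ :- k) :* w :+ κ :* ((D :+ ε) :- w)) :+ (con 1ℚ :- κ) :* ε) refl (κ n) (D n) k w ε) })
    (ev-zip (λ _ → _,_) k≤κ 0≤κ) (ev-zip (λ _ → _,_) κ≤1 (within w≲D ε 0<ε))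

scale-upper : ∀ {κ D e : ℕ → ℚ} {k w} → 0ℚ ≤ w →
  Eventually (λ n → κ n ≤ k) → Eventually (λ n → 0ℚ ≤ κ n) → Eventually (λ n → κ n ≤ 1ℚ) →
  e ≲ (λ n → κ n * D n) → D ≲ const w → e ≲ const (k * w)
scale-upper {κ} {D} {e} {k} {w} 0≤w κ≤k 0≤κ κ≤1 e≲κD D≲w = ≲-trans e≲κD step
  where
  open ℚ-Solver
  step : (λ n → κ n * D n) ≲ const (k * w)
  step = approx λ ε 0<ε → ev-zip
    (λ { n (a , b) (c , d) → ≤-by
      (0≤+ (0≤+ (0≤* (p≤q⇒0≤q-p a) 0≤w) (0≤* b (p≤q⇒0≤q-p d)))
        (0≤* (p≤q⇒0≤q-p c) (ℚ.<⇒≤ 0<ε)))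
      (solve 5 (λ κ D k w ε → (k :* w :+ ε) :- κ :* D :=
        ((k :- κ) :* w :+ κ :* ((w :+ ε) :- D)) :+ (con 1ℚ :- κ) :* ε) refl (κ n) (D n) k w ε) })
    (ev-zip (λ _ → _,_) κ≤k 0≤κ) (ev-zip (λ _ → _,_) κ≤1 (within D≲w ε 0<ε))

*-cancelʳ-≤ : ∀ {p q r} → 0ℚ < r → p * r ≤ q * r → p ≤ q
*-cancelʳ-≤ {r = r} 0<r = ℚ.*-cancelʳ-≤-pos r {{ℚ.positive 0<r}}

*-cancelʳ-< : ∀ {p q r} → 0ℚ < r → p * r < q * r → p < q
*-cancelʳ-< {r = r} 0<r = ℚ.*-cancelʳ-<-nonNeg r {{ℚ.pos⇒nonNeg r {{ℚ.positive 0<r}}}}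

*-monoʳ-≤ : ∀ {p q r} → 0ℚ ≤ r → p ≤ q → p * r ≤ q * r
*-monoʳ-≤ {r = r} 0≤r = ℚ.*-monoʳ-≤-nonNeg r {{ℚ.nonNegative 0≤r}}

recip-inverse : ∀ {p} → 0ℚ < p → p * recip p ≡ 1ℚ
recip-inverse {p} 0<p = recip-inverseʳ p λ { refl → ℚ.<-irrefl refl 0<p }

≤-recip : ∀ {p q} → 0ℚ < p → q * p ≤ 1ℚ → q ≤ recip p
≤-recip {p} {q} 0<p qp≤1 = *-cancelʳ-≤ 0<p
  (subst (q * p ≤_) (sym (trans (ℚ.*-comm (recip p) p) (recip-inverse 0<p))) qp≤1)

recip-≤ : ∀ {p q} → 0ℚ < p → 1ℚ ≤ q * p → recip p ≤ q
recip-≤ {p} {q} 0<p 1≤qp = *-cancelʳ-≤ 0<p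
  (subst (_≤ q * p) (sym (trans (ℚ.*-comm (recip p) p) (recip-inverse 0<p))) 1≤qp)

-- Bounds for φ⁻¹

-- The bounds 7/3 and 11/5 for √5 become 5/3 and 8/5 for `φ`, whose reciprocals are the 3/5 and 5/8
-- used throughout. Here 45 < 49 is 5 < (7/3)² cleared of denominators.
√5≤7/3 : ∀ n → √-approx 5 n ≤ + 7 / 3
√5≤7/3 n = ℚ.<⇒≤ (/-cancel-< a n 7 2 (square-cancel-< (a ℕ.* 3) (7 ℕ.* K)
  (ℕ.≤-<-trans
    (subst₂ ℕ._≤_
      (solve 1 (λ a → a :* a :* con 9 := a :* con 3 :* (a :* con 3)) refl a)
      (solve 1 (λ k → con 5 :* (k :* k) :* con 9 := con 45 :* (k :* k)) refl K)
      (ℕ.*-monoˡ-≤ 9 (⌊√⌋-lower (5 ℕ.* (K ℕ.* K)))))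
    (subst (45 ℕ.* (K ℕ.* K) ℕ.<_)
      (solve 1 (λ k → con 49 :* (k :* k) := con 7 :* k :* (con 7 :* k)) refl K)
      (ℕ.*-monoˡ-< (K ℕ.* K) (from-yes (45 ℕ.<? 49)))))))
  where
  open ℕ-Solver
  K = suc n
  a = ⌊√ 5 ℕ.* (K ℕ.* K) ⌋

-- The floor of the square root is controlled from above only through its successor, which turns 11
-- k into 11 k + 5. What remains is 110 k + 25 ≤ 4 k², and 28 is the first positive k where it
-- holds.
[11k+5]²≤125k² : ∀ k → 28 ℕ.≤ k →
  (11 ℕ.* k ℕ.+ 5) ℕ.* (11 ℕ.* k ℕ.+ 5) ℕ.≤ 25 ℕ.* (5 ℕ.* (k ℕ.* k))
[11k+5]²≤125k² k 28≤k = subst₂ ℕ._≤_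
  (solve 1 (λ k → con 121 :* (k :* k) :+ (con 110 :* k :+ con 25) :=
    (con 11 :* k :+ con 5) :* (con 11 :* k :+ con 5)) refl k)
  (solve 1 (λ k → con 121 :* (k :* k) :+ con 4 :* (k :* k) :=
    con 25 :* (con 5 :* (k :* k))) refl k)
  (ℕ.+-monoʳ-≤ (121 ℕ.* (k ℕ.* k)) (ℕ.≤-trans
    (ℕ.+-monoʳ-≤ (110 ℕ.* k) (ℕ.≤-trans (from-yes (25 ℕ.≤? 56)) (ℕ.*-monoʳ-≤ 2 28≤k)))
    (subst (ℕ._≤ 4 ℕ.* (k ℕ.* k))
      (solve 1 (λ k → con 4 :* (con 28 :* k) := con 110 :* k :+ con 2 :* k) refl k)
      (ℕ.*-monoʳ-≤ 4 (ℕ.*-monoˡ-≤ k 28≤k)))))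
  where open ℕ-Solver

11/5≤√5 : ∀ n → 27 ℕ.≤ n → + 11 / 5 ≤ √-approx 5 n
11/5≤√5 n 27≤n = ℚ.<⇒≤ (/-cancel-< 11 4 a n (ℕ.≰⇒> λ 5a≤11K →
  ℕ.<⇒≱ (⌊√⌋-upper (5 ℕ.* (K ℕ.* K)))
    (ℕ.*-cancelˡ-≤ 25 (ℕ.≤-trans (small 5a≤11K) ([11k+5]²≤125k² K (ℕ.s≤s 27≤n))))))
  where
  open ℕ-Solver
  K = suc n
  a = ⌊√ 5 ℕ.* (K ℕ.* K) ⌋
  small : a ℕ.* 5 ℕ.≤ 11 ℕ.* K →
    25 ℕ.* (suc a ℕ.* suc a) ℕ.≤ (11 ℕ.* K ℕ.+ 5) ℕ.* (11 ℕ.* K ℕ.+ 5)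
  small h = subst (ℕ._≤ (11 ℕ.* K ℕ.+ 5) ℕ.* (11 ℕ.* K ℕ.+ 5))
    (solve 1 (λ a → (a :* con 5 :+ con 5) :* (a :* con 5 :+ con 5) :=
      con 25 :* ((con 1 :+ a) :* (con 1 :+ a))) refl a)
    (ℕ.*-mono-≤ (ℕ.+-monoˡ-≤ 5 h) (ℕ.+-monoˡ-≤ 5 h))
φ-lower : ∀ n → 27 ℕ.≤ n → + 8 / 5 ≤ seq φ n
φ-lower n 27≤n = ℚ.*-monoˡ-≤-nonNeg ½ (ℚ.+-monoʳ-≤ 1ℚ (11/5≤√5 n 27≤n))

φ-upper : ∀ n → seq φ n ≤ + 5 / 3
φ-upper n = ℚ.*-monoˡ-≤-nonNeg ½ (ℚ.+-monoʳ-≤ 1ℚ (√5≤7/3 n))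

0<φ : ∀ n → 27 ℕ.≤ n → 0ℚ < seq φ n
0<φ n 27≤n = ℚ.<-≤-trans (ℚ.positive⁻¹ (+ 8 / 5)) (φ-lower n 27≤n)

φ⁻¹-lower : Eventually (λ n → + 3 / 5 ≤ seq φ⁻¹ n)
φ⁻¹-lower = 27 , λ n 27≤n → ≤-recip (0<φ n 27≤n) (ℚ.*-monoˡ-≤-nonNeg (+ 3 / 5) (φ-upper n))

φ⁻¹-upper : Eventually (λ n → seq φ⁻¹ n ≤ + 5 / 8)
φ⁻¹-upper = 27 , λ n 27≤n → recip-≤ (0<φ n 27≤n) (ℚ.*-monoˡ-≤-nonNeg (+ 5 / 8) (φ-lower n 27≤n))

-- Opaque because + n / 1 unfolds to a division by gcd n 1.
opaque
  ι : ℕ → ℚ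
  ι n = + n / 1

  ι≡/1 : ∀ n → ι n ≡ + n / 1
  ι≡/1 n = refl

  ι-zero : ι 0 ≡ 0ℚ
  ι-zero = refl

  ι-suc : ∀ n → ι (suc n) ≡ 1ℚ + ι n
  ι-suc n = trans (suc-/ n 0) (ℚ.+-comm (ι n) 1ℚ)

  0≤ι : ∀ n → 0ℚ ≤ ι n
  0≤ι n = ℚ.nonNegative⁻¹ (ι n) {{ℚ.normalize-nonNeg n 1}}

  0<ι : ∀ n → 0ℚ < ι (suc n)
  0<ι n = ℚ.positive⁻¹ (ι (suc n)) {{ℚ.normalize-pos (suc n) 1}}

  mkℚ-*-ι : ∀ n d .(c : Coprime n (suc d)) → mkℚ (+ n) d c * ι (suc d) ≡ ι n
  mkℚ-*-ι n d c = ℚ.toℚᵘ-injective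
    (ℚᵘ.≃-trans (ℚ.toℚᵘ-homo-* (mkℚ (+ n) d c) (ι (suc d)))
      (ℚᵘ.≃-trans (ℚᵘ.*-congˡ {mkℚᵘ (+ n) d} (ℚ.toℚᵘ-fromℚᵘ (mkℚᵘ (+ suc d) 0)))
        (ℚᵘ.≃-trans (*≡* (ℤ.*-assoc (+ n) (+ suc d) (+ 1)))
          (ℚᵘ.≃-sym (ℚ.toℚᵘ-fromℚᵘ (mkℚᵘ (+ n) 0))))))

ι-+ : ∀ m n → ι (m ℕ.+ n) ≡ ι m + ι n
ι-+ zero n = sym (trans (cong (_+ ι n) ι-zero) (ℚ.+-identityˡ (ι n)))
ι-+ (suc m) n = trans (ι-suc (m ℕ.+ n)) (trans (cong (λ p → 1ℚ + p) (ι-+ m n))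
  (trans (sym (ℚ.+-assoc 1ℚ (ι m) (ι n))) (cong (_+ ι n) (sym (ι-suc m)))))

ι-* : ∀ m n → ι (m ℕ.* n) ≡ ι m * ι n
ι-* zero n = trans ι-zero (sym (trans (cong (_* ι n) ι-zero) (ℚ.*-zeroˡ (ι n))))
ι-* (suc m) n = trans (ι-+ n (m ℕ.* n)) (trans (cong (λ p → ι n + p) (ι-* m n))
  (trans (solve 2 (λ m n → n :+ m :* n := (con 1ℚ :+ m) :* n) refl (ι m) (ι n))
    (cong (_* ι n) (sym (ι-suc m)))))
  where open ℚ-Solver

ι-mono-≤ : ∀ {m n} → m ℕ.≤ n → ι m ≤ ι n
ι-mono-≤ {m} {n} m≤n with ℕ.m≤n⇒∃[o]m+o≡n m≤n
... | o , refl = subst (ι m ≤_) (sym (ι-+ m o)) (≤+ε (0≤ι o) ℚ.≤-refl)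

-- Farey intervals

-- Neighbours p/q < r/s with r q - p s = 1. The determinant makes both fractions reduced, so the
-- endpoints are built by `mkℚ` without a gcd and mediants are plain sums of components;
-- denominators are stored as predecessors because `mkℚ` takes them so.
record Farey : Set where
  constructor farey
  field
    lnum ldn-1 rnum rdn-1 : ℕ
    det : rnum ℕ.* suc ldn-1 ≡ suc (lnum ℕ.* suc rdn-1)
    rnum≤rdn : rnum ℕ.≤ suc rdn-1

  ldn rdn : ℕ
  ldn = suc ldn-1
  rdn = suc rdn-1

  lcoprime : Coprime lnum ldn
  lcoprime {d} (d∣p , d∣q) = ∣1⇒≡1 (∣m+n∣m⇒∣n
    (subst (d ∣_) (trans det (ℕ.+-comm 1 (lnum ℕ.* rdn))) (∣n⇒∣m*n rnum d∣q))
    (∣m⇒∣m*n rdn d∣p))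

  rcoprime : Coprime rnum rdn
  rcoprime {d} (d∣r , d∣s) = ∣1⇒≡1 (∣m+n∣m⇒∣n
    (subst (d ∣_) (trans det (ℕ.+-comm 1 (lnum ℕ.* rdn))) (∣m⇒∣m*n ldn d∣r))
    (∣n⇒∣m*n lnum d∣s))

  left right : ℚ
  left  = mkℚ (+ lnum) ldn-1 lcoprime
  right = mkℚ (+ rnum) rdn-1 rcoprime

open Farey

left-*-ldn : ∀ I → left I * ι (ldn I) ≡ ι (lnum I)
left-*-ldn I = mkℚ-*-ι (lnum I) (ldn-1 I) (lcoprime I)

right-*-rdn : ∀ I → right I * ι (rdn I) ≡ ι (rnum I)
right-*-rdn I = mkℚ-*-ι (rnum I) (rdn-1 I) (rcoprime I)

width : Farey → ℚ
width I = right I - left I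

width-*-dens : ∀ I → width I * (ι (ldn I) * ι (rdn I)) ≡ 1ℚ
width-*-dens I = trans
  (solve 4 (λ l r q s → (r :- l) :* (q :* s) := (r :* s) :* q :- (l :* q) :* s) refl
    (left I) (right I) (ι (ldn I)) (ι (rdn I)))
  (trans (cong₂ (λ a b → a * ι (ldn I) - b * ι (rdn I)) (right-*-rdn I) (left-*-ldn I))
    (trans (cong₂ _-_ (trans (sym (ι-* (rnum I) (ldn I))) (trans (cong ι (det I)) (ι-suc (lnum I ℕ.* rdn I))))
        (sym (ι-* (lnum I) (rdn I))))
      (solve 1 (λ a → (con 1ℚ :+ a) :- a := con 1ℚ) refl (ι (lnum I ℕ.* rdn I)))))
  where open ℚ-Solver

0<dens : ∀ I → 0ℚ < ι (ldn I) * ι (rdn I)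
0<dens I = 0<* (0<ι (ldn-1 I)) (0<ι (rdn-1 I))

0<width : ∀ I → 0ℚ < width I
0<width I = *-cancelʳ-< (0<dens I)
  (subst₂ _<_ (sym (ℚ.*-zeroˡ (ι (ldn I) * ι (rdn I)))) (sym (width-*-dens I)) 0<1)

left<right : ∀ I → left I < right I
left<right I = <-by (0<width I) refl

0≤left : ∀ I → 0ℚ ≤ left I
0≤left I = ℚ.nonNegative⁻¹ (left I)

right≤1 : ∀ I → right I ≤ 1ℚ
right≤1 I = *-cancelʳ-≤ (0<ι (rdn-1 I)) (subst₂ _≤_ (sym (right-*-rdn I))
  (sym (ℚ.*-identityˡ _)) (ι-mono-≤ (rnum≤rdn I)))

left≤1 : ∀ I → left I ≤ 1ℚ
left≤1 I = ℚ.≤-trans (ℚ.<⇒≤ (left<right I)) (right≤1 I)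

0≤right : ∀ I → 0ℚ ≤ right I
0≤right I = ℚ.≤-trans (0≤left I) (ℚ.<⇒≤ (left<right I))

-- For z = a/b the determinant gives b = b (r q - p s) = s (a q - p b) + q (r b - a s), and both
-- brackets are at least 1. The term `t` is added to both sides to avoid subtraction in ℕ.
interior-denominator : ∀ I z → left I < z → z < right I → ldn I ℕ.+ rdn I ℕ.≤ ↧ₙ z
interior-denominator I (mkℚ -[1+ a ] b c) l<z z<r =
  ⊥-elim (ℚ.<-asym (ℚ.≤-<-trans (0≤left I) l<z) (ℚ.negative⁻¹ (mkℚ -[1+ a ] b c)))
interior-denominator I (mkℚ (+ a) b-1 c) l<z z<r = ℕ.+-cancelʳ-≤ t (q ℕ.+ s) b
  (subst₂ ℕ._≤_
    (solve 5 (λ p q s a b → (con 1 :+ p :* b) :* s :+ q :* (con 1 :+ a :* s) :=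
       (q :+ s) :+ (p :* s :* b :+ q :* (a :* s))) refl p q s a b)
    (trans (solve 5 (λ a q s r b → a :* q :* s :+ q :* (r :* b) := r :* q :* b :+ q :* (a :* s))
        refl a q s r b)
      (trans (cong (λ d → d ℕ.* b ℕ.+ q ℕ.* (a ℕ.* s)) (det I))
        (ℕ.+-assoc b (p ℕ.* s ℕ.* b) (q ℕ.* (a ℕ.* s)))))
    (ℕ.+-mono-≤ (ℕ.*-monoˡ-≤ s pb<aq) (ℕ.*-monoʳ-≤ q as<rb)))
  where
  open ℕ-Solver
  p = lnum I
  q = ldn I
  r = rnum I
  s = rdn I
  b = suc b-1
  t = p ℕ.* s ℕ.* b ℕ.+ q ℕ.* (a ℕ.* s)
  pb<aq : p ℕ.* b ℕ.< a ℕ.* q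
  pb<aq = ℤ.drop‿+<+ (subst₂ ℤ._<_ (sym (ℤ.pos-* p b)) (sym (ℤ.pos-* a q)) (ℚ.drop-*<* l<z))
  as<rb : a ℕ.* s ℕ.< r ℕ.* b
  as<rb = ℤ.drop‿+<+ (subst₂ ℤ._<_ (sym (ℤ.pos-* a s)) (sym (ℤ.pos-* r b)) (ℚ.drop-*<* z<r))

unit : Farey
unit = farey 0 0 1 0 refl ℕ.≤-refl

lnum≤ldn : ∀ I → lnum I ℕ.≤ ldn I
lnum≤ldn I = ℕ.<⇒≤ (ℕ.*-cancelʳ-< (rdn I) (lnum I) (ldn I) (subst₂ ℕ._≤_ (det I)
  (ℕ.*-comm (rdn I) (ldn I)) (ℕ.*-monoˡ-≤ (ldn I) (rnum≤rdn I))))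

lc rc : Farey → Farey
lc I@(farey p q-1 r s-1 det r≤s) = farey p q-1 (p ℕ.+ r) (q-1 ℕ.+ suc s-1)
  (trans (ℕ.*-distribʳ-+ (suc q-1) p r)
    (trans (cong (p ℕ.* suc q-1 ℕ.+_) det)
      (trans (ℕ.+-suc (p ℕ.* suc q-1) (p ℕ.* suc s-1))
        (cong suc (sym (ℕ.*-distribˡ-+ p (suc q-1) (suc s-1)))))))
  (ℕ.+-mono-≤ (lnum≤ldn I) r≤s)
rc I@(farey p q-1 r s-1 det r≤s) = farey (p ℕ.+ r) (q-1 ℕ.+ suc s-1) r s-1
  (trans (ℕ.*-distribˡ-+ r (suc q-1) (suc s-1))
    (trans (cong (ℕ._+ r ℕ.* suc s-1) det)
      (cong suc (sym (ℕ.*-distribʳ-+ (suc s-1) p r)))))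
  r≤s

mid : Farey → ℚ
mid I = right (lc I)

left<mid : ∀ I → left I < mid I
left<mid I = left<right (lc I)

mid<right : ∀ I → mid I < right I
mid<right I = left<right (rc I)

mediant≡mid : ∀ I → mediant (left I) (right I) ≡ mid I
mediant≡mid I = ℚ.↥p/↧p≡p (mid I)

-- The order is one less than the denominator of the mediant: large enough for both endpoints, too
-- small for any fraction strictly between them.
consecutive : ∀ I → ConsecutiveFarey (left I) (right I)
consecutive I = n
  , (0≤left I , ℚ.≤-trans (ℚ.<⇒≤ (left<right I)) (right≤1 I) , ℕ.m≤n+m (ldn I) (rdn-1 I))
  , (ℚ.≤-trans (0≤left I) (ℚ.<⇒≤ (left<right I)) , right≤1 I
    , subst (rdn I ℕ.≤_) (sym (ℕ.+-suc (rdn-1 I) (ldn-1 I))) (ℕ.m≤m+n (rdn I) (ldn-1 I)))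
  , left<right I
  , λ { z (_ , _ , ↧z≤n) (l<z , z<r) → ℕ.<⇒≱ (subst (n ℕ.<_) (ℕ.+-comm (rdn I) (ldn I)) ℕ.≤-refl)
      (ℕ.≤-trans (interior-denominator I z l<z z<r) ↧z≤n) }
  where n = rdn-1 I ℕ.+ ldn I

dens-lc : ∀ I → ldn I ℕ.+ rdn I ℕ.< ldn (lc I) ℕ.+ rdn (lc I)
dens-lc I = ℕ.+-monoˡ-≤ (ldn I ℕ.+ rdn I) (ℕ.s≤s ℕ.z≤n)

dens-rc : ∀ I → ldn I ℕ.+ rdn I ℕ.< ldn (rc I) ℕ.+ rdn (rc I)
dens-rc I = subst (ℕ._≤ ldn (rc I) ℕ.+ rdn I) (ℕ.+-comm (ldn I ℕ.+ rdn I) 1)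
  (ℕ.+-monoʳ-≤ (ldn I ℕ.+ rdn I) (ℕ.s≤s ℕ.z≤n))

spend : ∀ {a} n {d d′} → a ℕ.< suc n ℕ.+ d → d ℕ.< d′ → a ℕ.< n ℕ.+ d′
spend n {d} {d′} fuel d<d′ = ℕ.<-≤-trans fuel
  (subst (ℕ._≤ n ℕ.+ d′) (ℕ.+-suc n d) (ℕ.+-monoʳ-≤ n d<d′))

φ⁻¹-nonneg : Eventually (λ n → 0ℚ ≤ seq φ⁻¹ n)
φ⁻¹-nonneg = ev-map (λ n → ℚ.≤-trans (ℚ.nonNegative⁻¹ (+ 3 / 5))) φ⁻¹-lower

φ⁻¹≤1 : Eventually (λ n → seq φ⁻¹ n ≤ 1ℚ)
φ⁻¹≤1 = ev-map (λ n h → ℚ.≤-trans h (from-yes (+ 5 / 8 ℚ.≤? 1ℚ))) φ⁻¹-upper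

1-φ⁻¹ : ℕ → ℚ
1-φ⁻¹ n = 1ℚ + - seq φ⁻¹ n

1-mono : ∀ {p q} → p ≤ q → 1ℚ + - q ≤ 1ℚ + - p
1-mono p≤q = ℚ.+-monoʳ-≤ 1ℚ (ℚ.neg-antimono-≤ p≤q)

1-φ⁻¹-lower : Eventually (λ n → + 3 / 8 ≤ 1-φ⁻¹ n)
1-φ⁻¹-lower = ev-map (λ n → 1-mono) φ⁻¹-upper

1-φ⁻¹-upper : Eventually (λ n → 1-φ⁻¹ n ≤ + 2 / 5)
1-φ⁻¹-upper = ev-map (λ n → 1-mono) φ⁻¹-lower

1-φ⁻¹-nonneg : Eventually (λ n → 0ℚ ≤ 1-φ⁻¹ n)
1-φ⁻¹-nonneg = ev-map (λ n → 1-mono) φ⁻¹≤1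

1-φ⁻¹≤1 : Eventually (λ n → 1-φ⁻¹ n ≤ 1ℚ)
1-φ⁻¹≤1 = ev-map (λ n → 1-mono) φ⁻¹-nonneg

-- The function g on the rationals

≤⇒≡⊎< : ∀ {p q} → p ≤ q → p ≡ q ⊎ p < q
≤⇒≡⊎< {p} {q} p≤q with ℚ.<-cmp p q
... | tri< p<q _ _ = inj₂ p<q
... | tri≈ _ p≡q _ = inj₁ p≡q
... | tri> _ _ q<p = ⊥-elim (ℚ.<-irrefl refl (ℚ.<-≤-trans q<p p≤q))

module DTU (g : ℝ → ℝ) (dtu : IsDenjoyTichyUitz φ⁻¹ g) where

  open IsDenjoyTichyUitz dtu

  G : ℚ → ℕ → ℚ
  G z = seq (g (fromℚ z))

  rise : Farey → ℕ → ℚ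
  rise I n = G (right I) n - G (left I) n

  average : Farey → ℕ → ℚ
  average I n = 1-φ⁻¹ n * G (left I) n + seq φ⁻¹ n * G (right I) n

  averageℝ : Farey → ℝ
  averageℝ I = (1ℝ ℝ.- φ⁻¹) ℝ.* g (fromℚ (left I)) ℝ.+ φ⁻¹ ℝ.* g (fromℚ (right I))

  at-mid : ∀ I → g (fromℚ (mid I)) ℝ.≃ averageℝ I
  at-mid I = subst (λ z → g (fromℚ z) ℝ.≃ averageℝ I)
    (mediant≡mid I) (at-mediant (left I) (right I) (consecutive I))

  mid≲average : ∀ I → G (mid I) ≲ average I
  mid≲average I = ≃⇒≲ {g (fromℚ (mid I))} {averageℝ I} (at-mid I)

  average≲mid : ∀ I → average I ≲ G (mid I)
  average≲mid I = ≃⇒≲ {averageℝ I} {g (fromℚ (mid I))}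
    (≃-sym {g (fromℚ (mid I))} {averageℝ I} (at-mid I))

  module _ (I : Farey) where
    open ℚ-Solver

    private
      lc-eq : ∀ n → seq φ⁻¹ n * rise I n - rise (lc I) n ≡ average I n - G (mid I) n
      lc-eq n = solve 4 (λ κ l m r → κ :* (r :- l) :- (m :- l) :=
        ((con 1ℚ :+ :- κ) :* l :+ κ :* r) :- m) refl
        (seq φ⁻¹ n) (G (left I) n) (G (mid I) n) (G (right I) n)

      lc-eq′ : ∀ n → rise (lc I) n - seq φ⁻¹ n * rise I n ≡ G (mid I) n - average I n
      lc-eq′ n = solve 4 (λ κ l m r → (m :- l) :- κ :* (r :- l) :=
        m :- ((con 1ℚ :+ :- κ) :* l :+ κ :* r)) refl
        (seq φ⁻¹ n) (G (left I) n) (G (mid I) n) (G (right I) n)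

      rc-eq : ∀ n → rise (rc I) n - 1-φ⁻¹ n * rise I n ≡ average I n - G (mid I) n
      rc-eq n = solve 4 (λ κ l m r → (r :- m) :- (con 1ℚ :+ :- κ) :* (r :- l) :=
        ((con 1ℚ :+ :- κ) :* l :+ κ :* r) :- m) refl
        (seq φ⁻¹ n) (G (left I) n) (G (mid I) n) (G (right I) n)

      rc-eq′ : ∀ n → 1-φ⁻¹ n * rise I n - rise (rc I) n ≡ G (mid I) n - average I n
      rc-eq′ n = solve 4 (λ κ l m r → (con 1ℚ :+ :- κ) :* (r :- l) :- (r :- m) :=
        m :- ((con 1ℚ :+ :- κ) :* l :+ κ :* r)) refl
        (seq φ⁻¹ n) (G (left I) n) (G (mid I) n) (G (right I) n)

    rise-lc-lower : ∀ {w} → 0ℚ ≤ w → const w ≲ rise I → const (+ 3 / 5 * w) ≲ rise (lc I)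
    rise-lc-lower 0≤w = scale-lower 0≤w φ⁻¹-lower φ⁻¹-nonneg φ⁻¹≤1
      (≲-shift lc-eq′ (average≲mid I))

    rise-lc-upper : ∀ {w} → 0ℚ ≤ w → rise I ≲ const w → rise (lc I) ≲ const (+ 5 / 8 * w)
    rise-lc-upper 0≤w = scale-upper 0≤w φ⁻¹-upper φ⁻¹-nonneg φ⁻¹≤1
      (≲-shift lc-eq (mid≲average I))

    rise-rc-lower : ∀ {w} → 0ℚ ≤ w → const w ≲ rise I → const (+ 3 / 8 * w) ≲ rise (rc I)
    rise-rc-lower 0≤w = scale-lower 0≤w 1-φ⁻¹-lower 1-φ⁻¹-nonneg 1-φ⁻¹≤1
      (≲-shift rc-eq (mid≲average I))

    rise-rc-upper : ∀ {w} → 0ℚ ≤ w → rise I ≲ const w → rise (rc I) ≲ const (+ 2 / 5 * w)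
    rise-rc-upper 0≤w = scale-upper 0≤w 1-φ⁻¹-upper 1-φ⁻¹-nonneg 1-φ⁻¹≤1
      (≲-shift rc-eq′ (average≲mid I))

  Increasing : Farey → Set
  Increasing I = const 0ℚ ≲ rise I

  increasing-lc : ∀ I → Increasing I → Increasing (lc I)
  increasing-lc I = rise-lc-lower I ℚ.≤-refl

  increasing-rc : ∀ I → Increasing I → Increasing (rc I)
  increasing-rc I = rise-rc-lower I ℚ.≤-refl

  G-left≲right : ∀ I → Increasing I → G (left I) ≲ G (right I)
  G-left≲right I = ≲-shift λ n →
    solve 2 (λ l r → r :- l := (r :- l) :- con 0ℚ) refl (G (left I) n) (G (right I) n)
    where open ℚ-Solver

  rise-unit-lower : const 1ℚ ≲ rise unit
  rise-unit-lower = approx λ ε 0<ε → ev-zip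
    (λ n h k → ≤-by (0≤+ (p≤q⇒0≤q-p h) (p≤q⇒0≤q-p k))
      (solve 3 (λ a b ε → ((b :- a) :+ ε) :- con 1ℚ :=
        ((con 0ℚ :+ con ½ :* ε) :- a) :+ ((b :+ con ½ :* ε) :- con 1ℚ)) refl
        (seq (g 0ℝ) n) (seq (g 1ℝ) n) ε))
    (within (≃⇒≲ {g 0ℝ} {0ℝ} at-0) _ (half-< 0<ε))
    (within (≃⇒≲ {1ℝ} {g 1ℝ} (≃-sym {g 1ℝ} {1ℝ} at-1)) _ (half-< 0<ε))
    where open ℚ-Solver

  rise-unit-upper : rise unit ≲ const 1ℚ
  rise-unit-upper = approx λ ε 0<ε → ev-zip
    (λ n h k → ≤-by (0≤+ (p≤q⇒0≤q-p h) (p≤q⇒0≤q-p k))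
      (solve 3 (λ a b ε → (con 1ℚ :+ ε) :- (b :- a) :=
        ((a :+ con ½ :* ε) :- con 0ℚ) :+ ((con 1ℚ :+ con ½ :* ε) :- b)) refl
        (seq (g 0ℝ) n) (seq (g 1ℝ) n) ε))
    (within (≃⇒≲ {0ℝ} {g 0ℝ} (≃-sym {g 0ℝ} {0ℝ} at-0)) _ (half-< 0<ε))
    (within (≃⇒≲ {g 1ℝ} {1ℝ} at-1) _ (half-< 0<ε))
    where open ℚ-Solver

  increasing-unit : Increasing unit
  increasing-unit = ≲-trans (ev≤⇒≲ (always λ _ → ℚ.<⇒≤ 0<1)) rise-unit-lower

  Between : Farey → ℚ → Set
  Between I z = G (left I) ≲ G z × G z ≲ G (right I)

  -- A rational inside I has denominator at least ldn I + rdn I, and this sum grows along the descent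
  -- towards it: n bounds the number of steps left.
  G-between : ∀ n I z → Increasing I → left I ≤ z → z ≤ right I →
    ↧ₙ z ℕ.< n ℕ.+ (ldn I ℕ.+ rdn I) → Between I z

  G-between-interior : ∀ n I z → Increasing I → left I < z → z < right I →
    ↧ₙ z ℕ.< n ℕ.+ (ldn I ℕ.+ rdn I) → Between I z
  G-between-interior zero I z inc l<z z<r fuel =
    ⊥-elim (ℕ.<⇒≱ fuel (interior-denominator I z l<z z<r))
  G-between-interior (suc n) I z inc l<z z<r fuel = [ inLeft , inRight ]′ (ℚ.≤-total z (mid I))
    where
    inLeft : z ≤ mid I → Between I z
    inLeft z≤m = proj₁ b , ≲-trans (proj₂ b) (G-left≲right (rc I) (increasing-rc I inc))
      where
      b : Between (lc I) z
      b = G-between n (lc I) z (increasing-lc I inc) (ℚ.<⇒≤ l<z) z≤m (spend n fuel (dens-lc I))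
    inRight : mid I ≤ z → Between I z
    inRight m≤z = ≲-trans (G-left≲right (lc I) (increasing-lc I inc)) (proj₁ b) , proj₂ b
      where
      b : Between (rc I) z
      b = G-between n (rc I) z (increasing-rc I inc) m≤z (ℚ.<⇒≤ z<r) (spend n fuel (dens-rc I))

  G-between n I z inc l≤z z≤r fuel =
    [ (λ l≡z → subst (Between I) l≡z (≲-refl , G-left≲right I inc))
    , (λ l<z → [ (λ z≡r → subst (Between I) (sym z≡r) (G-left≲right I inc , ≲-refl))
               , (λ z<r → G-between-interior n I z inc l<z z<r fuel) ]′ (≤⇒≡⊎< z≤r)) ]′
    (≤⇒≡⊎< l≤z)

  G-between-bounds : ∀ I z → Increasing I → left I ≤ z → z ≤ right I →
    G (left I) ≲ G z × G z ≲ G (right I)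
  G-between-bounds I z inc l≤z z≤r =
    G-between (↧ₙ z) I z inc l≤z z≤r (ℕ.m<m+n (↧ₙ z) (ℕ.s≤s ℕ.z≤n))

  -- The descent follows `u` alone. As soon as the midpoint separates `u` from `v`, its value is
  -- compared with both by `G-between-bounds`.
  G-monotone-on : ∀ n I u v → Increasing I → left I ≤ u → u ≤ v → v ≤ right I →
    ↧ₙ u ℕ.< n ℕ.+ (ldn I ℕ.+ rdn I) → G u ≲ G v

  G-monotone-interior : ∀ n I u v → Increasing I → left I < u → u < right I → u ≤ v → v ≤ right I →
    ↧ₙ u ℕ.< n ℕ.+ (ldn I ℕ.+ rdn I) → G u ≲ G v
  G-monotone-interior zero I u v inc l<u u<r u≤v v≤r fuel =
    ⊥-elim (ℕ.<⇒≱ fuel (interior-denominator I u l<u u<r))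
  G-monotone-interior (suc n) I u v inc l<u u<r u≤v v≤r fuel =
    [ (λ u≤m → [ bothLeft u≤m , split u≤m ]′ (ℚ.≤-total v (mid I))) , bothRight ]′
      (ℚ.≤-total u (mid I))
    where
    bothLeft : u ≤ mid I → v ≤ mid I → G u ≲ G v
    bothLeft u≤m v≤m = G-monotone-on n (lc I) u v (increasing-lc I inc) (ℚ.<⇒≤ l<u) u≤v v≤m
      (spend n fuel (dens-lc I))
    split : u ≤ mid I → mid I ≤ v → G u ≲ G v
    split u≤m m≤v = ≲-trans
      (proj₂ (G-between-bounds (lc I) u (increasing-lc I inc) (ℚ.<⇒≤ l<u) u≤m))
      (proj₁ (G-between-bounds (rc I) v (increasing-rc I inc) m≤v v≤r))
    bothRight : mid I ≤ u → G u ≲ G v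
    bothRight m≤u = G-monotone-on n (rc I) u v (increasing-rc I inc) m≤u u≤v v≤r
      (spend n fuel (dens-rc I))

  G-monotone-on n I u v inc l≤u u≤v v≤r fuel =
    [ (λ l≡u → subst (λ z → G z ≲ G v) l≡u
        (proj₁ (G-between-bounds I v inc (ℚ.≤-trans l≤u u≤v) v≤r)))
    , (λ l<u → [ (λ u≡r → subst (λ z → G u ≲ G z)
                   (ℚ.≤-antisym u≤v (subst (v ≤_) (sym u≡r) v≤r)) ≲-refl)
               , (λ u<r → G-monotone-interior n I u v inc l<u u<r u≤v v≤r fuel) ]′
               (≤⇒≡⊎< (ℚ.≤-trans u≤v v≤r))) ]′
    (≤⇒≡⊎< l≤u)

  G-monotone : ∀ {u v} → 0ℚ ≤ u → u ≤ v → v ≤ 1ℚ → G u ≲ G v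
  G-monotone {u} {v} 0≤u u≤v v≤1 =
    G-monotone-on (↧ₙ u) unit u v increasing-unit 0≤u u≤v v≤1 (ℕ.m<m+n (↧ₙ u) (ℕ.s≤s ℕ.z≤n))

-- Continued fractions

infix 4 _⊑_

_⊑_ : Farey → Farey → Set
I ⊑ J = left J ≤ left I × right I ≤ right J

⊑-refl : ∀ {I} → I ⊑ I
⊑-refl = ℚ.≤-refl , ℚ.≤-refl

⊑-trans : ∀ {I J K} → I ⊑ J → J ⊑ K → I ⊑ K
⊑-trans (l , r) (l′ , r′) = ℚ.≤-trans l′ l , ℚ.≤-trans r r′

lc-⊑ : ∀ I → lc I ⊑ I
lc-⊑ I = ℚ.≤-refl , ℚ.<⇒≤ (mid<right I)

rc-⊑ : ∀ I → rc I ⊑ I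
rc-⊑ I = ℚ.<⇒≤ (left<mid I) , ℚ.≤-refl

lcs rcs : ℕ → Farey → Farey
lcs zero    I = I
lcs (suc n) I = lcs n (lc I)
rcs zero    I = I
rcs (suc n) I = rcs n (rc I)

lcs-⊑ : ∀ n I → lcs n I ⊑ I
lcs-⊑ zero    I = ⊑-refl {I}
lcs-⊑ (suc n) I = ⊑-trans {lcs n (lc I)} {lc I} {I} (lcs-⊑ n (lc I)) (lc-⊑ I)

rcs-⊑ : ∀ n I → rcs n I ⊑ I
rcs-⊑ zero    I = ⊑-refl {I}
rcs-⊑ (suc n) I = ⊑-trans {rcs n (rc I)} {rc I} {I} (rcs-⊑ n (rc I)) (rc-⊑ I)

left-lcs : ∀ n I → left (lcs n I) ≡ left I
left-lcs zero    I = refl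
left-lcs (suc n) I = left-lcs n (lc I)

lnum-lcs : ∀ n I → lnum (lcs n I) ≡ lnum I
lnum-lcs zero    I = refl
lnum-lcs (suc n) I = lnum-lcs n (lc I)

ldn-lcs : ∀ n I → ldn (lcs n I) ≡ ldn I
ldn-lcs zero    I = refl
ldn-lcs (suc n) I = ldn-lcs n (lc I)

rnum-rcs : ∀ n I → rnum (rcs n I) ≡ rnum I
rnum-rcs zero    I = refl
rnum-rcs (suc n) I = rnum-rcs n (rc I)

rdn-rcs : ∀ n I → rdn (rcs n I) ≡ rdn I
rdn-rcs zero    I = refl
rdn-rcs (suc n) I = rdn-rcs n (rc I)

rnum-lcs : ∀ n I → rnum (lcs n I) ≡ n ℕ.* lnum I ℕ.+ rnum I
rnum-lcs zero    I = refl
rnum-lcs (suc n) I = trans (rnum-lcs n (lc I))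
  (solve 3 (λ n p r → n :* p :+ (p :+ r) := (p :+ n :* p) :+ r) refl n (lnum I) (rnum I))
  where open ℕ-Solver

rdn-lcs : ∀ n I → rdn (lcs n I) ≡ n ℕ.* ldn I ℕ.+ rdn I
rdn-lcs zero    I = refl
rdn-lcs (suc n) I = trans (rdn-lcs n (lc I))
  (solve 3 (λ n q s → n :* q :+ (q :+ s) := (q :+ n :* q) :+ s) refl n (ldn I) (rdn I))
  where open ℕ-Solver

lnum-rcs : ∀ n I → lnum (rcs n I) ≡ n ℕ.* rnum I ℕ.+ lnum I
lnum-rcs zero    I = refl
lnum-rcs (suc n) I = trans (lnum-rcs n (rc I))
  (solve 3 (λ n p r → n :* r :+ (p :+ r) := (r :+ n :* r) :+ p) refl n (lnum I) (rnum I))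
  where open ℕ-Solver

ldn-rcs : ∀ n I → ldn (rcs n I) ≡ n ℕ.* rdn I ℕ.+ ldn I
ldn-rcs zero    I = refl
ldn-rcs (suc n) I = trans (ldn-rcs n (rc I))
  (solve 3 (λ n q s → n :* s :+ (q :+ s) := (s :+ n :* s) :+ q) refl n (ldn I) (rdn I))
  where open ℕ-Solver

block : ℕ → ℕ → Farey → Farey
block a b I = rcs b (lcs a I)

block-⊑ : ∀ a b I → block a b I ⊑ I
block-⊑ a b I = ⊑-trans {block a b I} {lcs a I} {I} (rcs-⊑ b (lcs a I)) (lcs-⊑ a I)

right-block≤mid : ∀ a b I → 1 ℕ.≤ a → right (block a b I) ≤ mid I
right-block≤mid (suc a) b I _ = ℚ.≤-trans (proj₂ (rcs-⊑ b (lcs a (lc I)))) (proj₂ (lcs-⊑ a (lc I)))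

mid-lcs≤left-block : ∀ a b I → 1 ℕ.≤ b → mid (lcs a I) ≤ left (block a b I)
mid-lcs≤left-block a (suc b) I _ = proj₁ (rcs-⊑ b (rc (lcs a I)))

left<left-block : ∀ a b I → 1 ℕ.≤ b → left I < left (block a b I)
left<left-block a b I 1≤b = ℚ.<-≤-trans
  (subst (_< mid (lcs a I)) (left-lcs a I) (left<mid (lcs a I))) (mid-lcs≤left-block a b I 1≤b)

right-block<right : ∀ a b I → 1 ℕ.≤ a → right (block a b I) < right I
right-block<right a b I 1≤a = ℚ.≤-<-trans (right-block≤mid a b I 1≤a) (mid<right I)

ldn<ldn-block : ∀ a b I → 1 ℕ.≤ b → ldn I ℕ.< ldn (block a b I)
ldn<ldn-block a (suc b) I _ = subst (ldn I ℕ.<_) (sym (ldn-rcs (suc b) (lcs a I)))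
  (subst (ℕ._< suc b ℕ.* rdn (lcs a I) ℕ.+ ldn (lcs a I)) (ldn-lcs a I)
    (ℕ.m<n+m (ldn (lcs a I)) (ℕ.s≤s ℕ.z≤n)))

-- A shift by 2 k places, since one block uses two partial quotients.
drop : ℕ → (ℕ → ℕ) → ℕ → ℕ
drop zero    a = a
drop (suc k) a = λ i → drop k a (2 ℕ.+ i)

drop-all : ∀ {P : ℕ → Set} {a} → (∀ i → P (a i)) → ∀ k i → P (drop k a i)
drop-all h zero    i = h i
drop-all {P} h (suc k) i = drop-all {P} h k (2 ℕ.+ i)

-- interval a k consists of the reals whose expansion starts with a 0, …, a (2 k + 1);
-- the first block is shortened by one because the tree is entered at [0, 1], not at [0, ∞].
interval : (ℕ → ℕ) → ℕ → Farey
interval a zero    = rcs (a 1) (lcs (ℕ.pred (a 0)) unit)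
interval a (suc k) = block (drop (suc k) a 0) (drop (suc k) a 1) (interval a k)

-- c = (r u + p) / (s u + q), cleared of the denominator.
Möbius : (p q r s c u : ℚ) → Set
Möbius p q r s c u = c * (s * u + q) ≡ r * u + p

-- Substituting 1/(a + 1/(b + u)) for the variable and multiplying through by (a + 1/(b + u)) (b +
-- u) changes the coefficients exactly as a left steps followed by b right steps change the
-- endpoints. Positivity keeps `recip` away from its value at 0.
möbius-step : ∀ {p q r s} c a b u → 0ℚ < b + u → 0ℚ < a + recip (b + u) →
  Möbius p q r s c (recip (a + recip (b + u))) →
  Möbius (b * (a * p + r) + p) (b * (a * q + s) + q) (a * p + r) (a * q + s) c u
möbius-step {p} {q} {r} {s} c a b u 0<B 0<A h =
  trans (cong (c *_) (expand s q)) (trans (sym (ℚ.*-assoc c (s * v + q) (A * B)))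
    (trans (cong (_* (A * B)) h) (sym (expand r p))))
  where
  open ℚ-Solver
  B = b + u
  ρ = recip B
  A = a + ρ
  v = recip A
  expand : ∀ x y → (a * y + x) * u + (b * (a * y + x) + y) ≡ (x * v + y) * (A * B)
  expand x y = trans
    (solve 5 (λ x y a b u → (a :* y :+ x) :* u :+ (b :* (a :* y :+ x) :+ y) :=
      x :* con 1ℚ :* (b :+ u) :+ y :* (a :* (b :+ u) :+ con 1ℚ)) refl x y a b u)
    (trans (cong₂ (λ i j → x * i * B + y * (a * B + j))
        (sym (recip-inverse 0<A)) (sym (recip-inverse 0<B)))
      (solve 6 (λ x y a B ρ v → x :* ((a :+ ρ) :* v) :* B :+ y :* (a :* B :+ B :* ρ) :=
        (x :* v :+ y) :* ((a :+ ρ) :* B)) refl x y a B ρ v))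

Represents : Farey → ℚ → ℚ → Set
Represents I = Möbius (ι (lnum I)) (ι (ldn I)) (ι (rnum I)) (ι (rdn I))

möbius-cong : ∀ {p q r s p′ q′ r′ s′ u} c → p ≡ p′ → q ≡ q′ → r ≡ r′ → s ≡ s′ →
  Möbius p q r s c u → Möbius p′ q′ r′ s′ c u
möbius-cong c refl refl refl refl h = h

ι-affine : ∀ n x y {z} → z ≡ n ℕ.* x ℕ.+ y → ι n * ι x + ι y ≡ ι z
ι-affine n x y eq = trans (cong (_+ ι y) (sym (ι-* n x)))
  (trans (sym (ι-+ (n ℕ.* x) y)) (cong ι (sym eq)))

0<recip : ∀ {p} → 0ℚ < p → 0ℚ < recip p
0<recip {p} 0<p = *-cancelʳ-< 0<p (subst₂ _<_ (sym (ℚ.*-zeroˡ p))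
  (sym (trans (ℚ.*-comm (recip p) p) (recip-inverse 0<p))) 0<1)

0<ι+ : ∀ {n u} → 1 ℕ.≤ n → 0ℚ ≤ u → 0ℚ < ι n + u
0<ι+ {suc n} _ = 0<+ (0<ι n)

0<ι+0< : ∀ n {u} → 0ℚ < u → 0ℚ < ι n + u
0<ι+0< n {u} 0<u = subst (0ℚ <_) (ℚ.+-comm u (ι n)) (0<+ 0<u (0≤ι n))

block-represents : ∀ a b I {c u} → 1 ℕ.≤ b → 0ℚ ≤ u →
  Represents I c (recip (ι a + recip (ι b + u))) → Represents (block a b I) c u
block-represents a b I {c} {u} 1≤b 0≤u h = möbius-cong c
  (outer (lnum-lcs a I) (rnum-lcs a I) (lnum-rcs b (lcs a I)))
  (outer (ldn-lcs a I) (rdn-lcs a I) (ldn-rcs b (lcs a I)))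
  (ι-affine a (lnum I) (rnum I) (trans (rnum-rcs b (lcs a I)) (rnum-lcs a I)))
  (ι-affine a (ldn I) (rdn I) (trans (rdn-rcs b (lcs a I)) (rdn-lcs a I)))
  (möbius-step c (ι a) (ι b) u 0<B (0<ι+0< a (0<recip 0<B)) h)
  where
  0<B = 0<ι+ 1≤b 0≤u
  outer : ∀ {x y x′ y′ z} → x′ ≡ x → y′ ≡ a ℕ.* x ℕ.+ y → z ≡ b ℕ.* y′ ℕ.+ x′ →
    ι b * (ι a * ι x + ι y) + ι x ≡ ι z
  outer {x} {y} refl refl eq =
    trans (cong (λ w → ι b * w + ι x) (ι-affine a x y refl)) (ι-affine b (a ℕ.* x ℕ.+ y) x eq)

-- On [0, 1] the Möbius map is u ↦ u/(1 + u), and it sends 1/(a + ρ) to 1/(a + 1 + ρ). This is the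
-- one left step by which the first block is shortened.
unit-represents : ∀ a {ρ} → 0ℚ < ρ → Represents unit (recip (ι (suc a) + ρ)) (recip (ι a + ρ))
unit-represents a {ρ} 0<ρ = möbius-cong c (sym ι-zero) (sym ι1) (sym ι1) (sym ι1)
  (trans (cong (λ w → c * (1ℚ * v + w)) (sym (recip-inverse 0<A)))
    (trans (solve 4 (λ c v a ρ → c :* (con 1ℚ :* v :+ (a :+ ρ) :* v) := v :* (((con 1ℚ :+ a) :+ ρ) :* c))
        refl c v (ι a) ρ)
      (trans (cong (λ w → v * ((w + ρ) * c)) (sym (ι-suc a)))
        (trans (cong (v *_) (recip-inverse (0<ι+0< (suc a) 0<ρ)))
          (solve 1 (λ v → v :* con 1ℚ := con 1ℚ :* v :+ con 0ℚ) refl v)))))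
  where
  open ℚ-Solver
  0<A = 0<ι+0< a 0<ρ
  c = recip (ι (suc a) + ρ)
  v = recip (ι a + ρ)
  ι1 : ι 1 ≡ 1ℚ
  ι1 = trans (ι-suc 0) (trans (cong (λ p → 1ℚ + p) ι-zero) (ℚ.+-identityʳ 1ℚ))

-- `c` is the mean of `right I` and `left I` with the nonnegative weights s u and q.
represents⇒bounds : ∀ I {c u} → 0ℚ ≤ u → Represents I c u → left I ≤ c × c ≤ right I
represents⇒bounds I {c} {u} 0≤u h =
    *-cancelʳ-≤ 0<D (≤-by (0≤* (0≤* (ℚ.<⇒≤ (0<width I)) (0≤ι (rdn I))) 0≤u)
      (trans (cong (_- left I * D) h′)
        (solve 5 (λ l r q s u → (r :* s :* u :+ l :* q) :- l :* (s :* u :+ q) := (r :- l) :* s :* u)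
          refl (left I) (right I) q s u)))
  , *-cancelʳ-≤ 0<D (≤-by (0≤* (ℚ.<⇒≤ (0<width I)) (0≤ι (ldn I)))
      (trans (cong (λ w → right I * D - w) h′)
        (solve 5 (λ l r q s u → r :* (s :* u :+ q) :- (r :* s :* u :+ l :* q) := (r :- l) :* q)
          refl (left I) (right I) q s u)))
  where
  open ℚ-Solver
  q = ι (ldn I)
  s = ι (rdn I)
  D = s * u + q
  0<D : 0ℚ < D
  0<D = subst (0ℚ <_) (ℚ.+-comm q (s * u)) (0<+ (0<ι (ldn-1 I)) (0≤* (0≤ι (rdn I)) 0≤u))
  h′ : c * D ≡ right I * s * u + left I * q
  h′ = trans h (sym (cong₂ (λ r p → r * u + p) (right-*-rdn I) (left-*-ldn I)))

0≤convergent : ∀ {a} → (∀ i → 1 ℕ.≤ a i) → ∀ n → 0ℚ ≤ convergent a n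
0≤convergent 1≤a zero = ℚ.≤-refl
0≤convergent {a} 1≤a (suc n) = ℚ.<⇒≤ (0<recip
  (subst (λ p → 0ℚ < p + convergent (λ i → a (suc i)) n) (ι≡/1 (a 0))
    (0<ι+ (1≤a 0) (0≤convergent (λ i → 1≤a (suc i)) n))))

convergent-2+ : ∀ a n → convergent a (2 ℕ.+ n) ≡
  recip (ι (a 0) + recip (ι (a 1) + convergent (λ i → a (2 ℕ.+ i)) n))
convergent-2+ a n = cong₂ (λ p q → recip (p + recip (q + convergent (λ i → a (2 ℕ.+ i)) n)))
  (sym (ι≡/1 (a 0))) (sym (ι≡/1 (a 1)))

-- Equal to 2 k + 2 + n, but accumulated in `n` so that the step of `convergent-represents` from `k`
-- to `suc k` is the previous case at `2 + n` by definition.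
advance : ℕ → ℕ → ℕ
advance zero    n = 2 ℕ.+ n
advance (suc k) n = advance k (2 ℕ.+ n)

advance≡ : ∀ k n → advance k n ≡ (k ℕ.+ k) ℕ.+ (2 ℕ.+ n)
advance≡ zero    n = refl
advance≡ (suc k) n = trans (advance≡ k (2 ℕ.+ n))
  (solve 2 (λ k n → (k :+ k) :+ (con 4 :+ n) := ((con 1 :+ k) :+ (con 1 :+ k)) :+ (con 2 :+ n))
    refl k n)
  where open ℕ-Solver

*-mono-≤ : ∀ {p q r s} → 0ℚ ≤ p → 0ℚ ≤ r → p ≤ q → r ≤ s → p * r ≤ q * s
*-mono-≤ {p} {q} {r} {s} 0≤p 0≤r p≤q r≤s = ℚ.≤-trans (*-monoʳ-≤ 0≤r p≤q)
  (subst₂ _≤_ (ℚ.*-comm r q) (ℚ.*-comm s q) (*-monoʳ-≤ (ℚ.≤-trans 0≤p p≤q) r≤s))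

1≤ι : ∀ n → 1ℚ ≤ ι (suc n)
1≤ι n = subst (1ℚ ≤_) (sym (ι-suc n)) (≤+ε (0≤ι n) ℚ.≤-refl)

p≤∣p∣ : ∀ p → p ≤ ∣ p ∣
p≤∣p∣ p = [ (λ 0≤p → ℚ.≤-reflexive (sym (ℚ.0≤p⇒∣p∣≡p 0≤p))) , (λ p≤0 → ℚ.≤-trans p≤0 (ℚ.0≤∣p∣ p)) ]′
  (ℚ.≤-total 0ℚ p)

opaque
  unfolding ι

  1/suc-*-ι : ∀ n → (+ 1 / suc n) * ι (suc n) ≡ 1ℚ
  1/suc-*-ι n = trans (cong (_* ι (suc n)) (ℚ.normalize-coprime (1-coprimeTo (suc n))))
    (mkℚ-*-ι 1 n (1-coprimeTo (suc n)))

module _ {a : ℕ → ℕ} (1≤a : ∀ i → 1 ℕ.≤ a i) where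

  digit-positive : ∀ k i → 1 ℕ.≤ drop k a i
  digit-positive = drop-all {λ n → 1 ℕ.≤ n} 1≤a

  convergent-represents : ∀ k n →
    Represents (interval a k) (convergent a (advance k n)) (convergent (drop (suc k) a) n)
  convergent-represents zero n = block-represents (ℕ.pred (a 0)) (a 1) unit
    {convergent a (2 ℕ.+ n)} (1≤a 1) (0≤convergent (digit-positive 1) n)
    (subst (λ c → Represents unit c (recip (ι (ℕ.pred (a 0)) + recip (ι (a 1) + convergent (drop 1 a) n))))
      (trans (cong (λ m → recip (ι m + recip (ι (a 1) + convergent (drop 1 a) n)))
          (ℕ.suc-pred (a 0) {{ℕ.>-nonZero (1≤a 0)}}))
        (sym (convergent-2+ a n)))
      (unit-represents (ℕ.pred (a 0))
        (0<recip (0<ι+ (1≤a 1) (0≤convergent (digit-positive 1) n)))))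
  convergent-represents (suc k) n = block-represents (drop (suc k) a 0) (drop (suc k) a 1) (interval a k)
    {convergent a (advance k (2 ℕ.+ n))}
    (digit-positive (suc k) 1) (0≤convergent (digit-positive (suc (suc k))) n)
    (subst (Represents (interval a k) (convergent a (advance k (2 ℕ.+ n))))
      (convergent-2+ (drop (suc k) a) n) (convergent-represents k (2 ℕ.+ n)))

  convergent-bounds : ∀ k m → 2 ℕ.+ (k ℕ.+ k) ℕ.≤ m →
    left (interval a k) ≤ convergent a m × convergent a m ≤ right (interval a k)
  convergent-bounds k m le with ℕ.m≤n⇒∃[o]m+o≡n le
  ... | o , refl = subst (λ m → left (interval a k) ≤ convergent a m × convergent a m ≤ right (interval a k))
    (trans (advance≡ k o)
      (solve 2 (λ k o → (k :+ k) :+ (con 2 :+ o) := (con 2 :+ (k :+ k)) :+ o) refl k o))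
    (represents⇒bounds (interval a k) (0≤convergent (digit-positive (suc k)) o)
      (convergent-represents k o))
    where open ℕ-Solver

  interval-suc-⊑ : ∀ k → interval a (suc k) ⊑ interval a k
  interval-suc-⊑ k = block-⊑ (drop (suc k) a 0) (drop (suc k) a 1) (interval a k)

  interval-⊑ : ∀ {j k} → k ℕ.≤′ j → interval a j ⊑ interval a k
  interval-⊑ {j} (ℕ.≤′-reflexive refl) = ⊑-refl {interval a j}
  interval-⊑ {suc j} {k} (ℕ.≤′-step le) = ⊑-trans {interval a (suc j)} {interval a j} {interval a k}
    (interval-suc-⊑ j) (interval-⊑ le)

  -- Linear growth of the denominators is crude, but it already makes the widths tend to 0 and
  -- excludes rational limits.
  suc≤ldn-interval : ∀ k → suc k ℕ.≤ ldn (interval a k)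
  suc≤ldn-interval zero    = ℕ.s≤s ℕ.z≤n
  suc≤ldn-interval (suc k) = ℕ.≤-trans (ℕ.s≤s (suc≤ldn-interval k))
    (ldn<ldn-block (drop (suc k) a 0) (drop (suc k) a 1) (interval a k) (digit-positive (suc k) 1))

  width-interval-≤ : ∀ k → width (interval a k) * ι (suc k) ≤ 1ℚ
  width-interval-≤ k = ℚ.≤-trans
    (subst₂ _≤_ (ℚ.*-comm (ι (suc k)) w) (ℚ.*-comm (ι (ldn I) * ι (rdn I)) w)
      (*-monoʳ-≤ (ℚ.<⇒≤ (0<width I)) (subst (_≤ ι (ldn I) * ι (rdn I)) (ℚ.*-identityʳ (ι (suc k)))
        (*-mono-≤ (0≤ι (suc k)) (ℚ.<⇒≤ 0<1) (ι-mono-≤ (suc≤ldn-interval k)) (1≤ι (rdn-1 I))))))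
    (ℚ.≤-reflexive (width-*-dens I))
    where
    I = interval a k
    w = width I

  width-interval-small : ∀ ε → 0ℚ < ε → Eventually (λ k → width (interval a k) < ε)
  width-interval-small ε 0<ε = ev-map (λ k 1/k<ε → ℚ.≤-<-trans
      (*-cancelʳ-≤ (0<ι k) (ℚ.≤-trans (width-interval-≤ k) (ℚ.≤-reflexive (sym (1/suc-*-ι k))))) 1/k<ε)
    (archimedean ε 0<ε)

-- Growth of the denominators

scale : ℚ → ℕ → ℚ → ℚ
scale κ zero    w = w
scale κ (suc n) w = scale κ n (κ * w)

0≤scale : ∀ {κ} → 0ℚ ≤ κ → ∀ n {w} → 0ℚ ≤ w → 0ℚ ≤ scale κ n w
0≤scale 0≤κ zero    0≤w = 0≤w
0≤scale 0≤κ (suc n) 0≤w = 0≤scale 0≤κ n (0≤* 0≤κ 0≤w)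

0<scale : ∀ {κ} → 0ℚ < κ → ∀ n {w} → 0ℚ < w → 0ℚ < scale κ n w
0<scale 0<κ zero    0<w = 0<w
0<scale 0<κ (suc n) 0<w = 0<scale 0<κ n (0<* 0<κ 0<w)

-- With factors 3/5 and 3/8 for left and right steps this is a lower bound for the increment of `g`
-- over `interval a k`; with 5/8 and 2/5 it is an upper bound.
weight : ℚ → ℚ → (ℕ → ℕ) → ℕ → ℚ
weight κ μ a zero    = scale μ (a 1) (scale κ (ℕ.pred (a 0)) 1ℚ)
weight κ μ a (suc k) = scale μ (drop (suc k) a 1) (scale κ (drop (suc k) a 0) (weight κ μ a k))

0<weight : ∀ {κ μ} → 0ℚ < κ → 0ℚ < μ → ∀ a k → 0ℚ < weight κ μ a k
0<weight 0<κ 0<μ a zero    = 0<scale 0<μ (a 1) (0<scale 0<κ (ℕ.pred (a 0)) 0<1)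
0<weight 0<κ 0<μ a (suc k) =
  0<scale 0<μ (drop (suc k) a 1) (0<scale 0<κ (drop (suc k) a 0) (0<weight 0<κ 0<μ a k))

eventually-large : ∀ {t} → 0ℚ < t → ∀ M → Eventually (λ k → M ≤ t * ι (suc k))
eventually-large {t} 0<t M = ev-map large (archimedean (t * recip B) (0<* 0<t (0<recip 0<B)))
  where
  open ℚ-Solver
  B = ∣ M ∣ + 1ℚ
  0<B : 0ℚ < B
  0<B = subst (0ℚ <_) (ℚ.+-comm 1ℚ ∣ M ∣) (0<+ 0<1 (ℚ.0≤∣p∣ M))
  M≤B : M ≤ B
  M≤B = ≤+ε (ℚ.<⇒≤ 0<1) (p≤∣p∣ M)
  large : ∀ k → + 1 / suc k < t * recip B → M ≤ t * ι (suc k)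
  large k h = ℚ.≤-trans M≤B (subst₂ _≤_
    (trans (cong (_* B) (1/suc-*-ι k)) (ℚ.*-identityˡ B))
    (trans (solve 4 (λ t r n b → t :* r :* n :* b := t :* n :* (b :* r)) refl t (recip B) (ι (suc k)) B)
      (trans (cong (t * ι (suc k) *_) (recip-inverse 0<B)) (ℚ.*-identityʳ (t * ι (suc k)))))
    (*-monoʳ-≤ (ℚ.<⇒≤ 0<B) (*-monoʳ-≤ (0≤ι (suc k)) (ℚ.<⇒≤ h))))

-- Bernoulli's inequality in place of powers: f k ≥ f 0 (1 + k/32), by induction.
growing⇒unbounded : ∀ {f : ℕ → ℚ} → 0ℚ < f 0 → (∀ k → + 33 / 32 * f k ≤ f (suc k)) →
  ∀ M → Eventually (λ k → M ≤ f k)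
growing⇒unbounded {f} 0<f step M = ev-map
  (λ k h → ℚ.≤-trans h (ℚ.≤-trans (≤-by (0≤* (ℚ.nonNegative⁻¹ (+ 31 / 32)) (ℚ.<⇒≤ 0<f))
      (trans (cong (λ x → c * f 0 * (ι k + + 32 / 1) - c * f 0 * x) (ι-suc k))
        (solve 2 (λ f n → con (+ 1 / 32) :* f :* (n :+ con (+ 32 / 1)) :-
            con (+ 1 / 32) :* f :* (con 1ℚ :+ n) := con (+ 31 / 32) :* f) refl (f 0) (ι k))))
    (linear k)))
  (eventually-large (0<* (ℚ.positive⁻¹ (+ 1 / 32)) 0<f) M)
  where
  open ℚ-Solver
  c = + 1 / 32
  linear : ∀ k → c * f 0 * (ι k + + 32 / 1) ≤ f k
  linear zero = ℚ.≤-reflexive (trans (cong (λ x → c * f 0 * (x + + 32 / 1)) ι-zero)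
    (solve 1 (λ f → con (+ 1 / 32) :* f :* (con 0ℚ :+ con (+ 32 / 1)) := f) refl (f 0)))
  linear (suc k) = ℚ.≤-trans
    (≤-by (0≤+ (0≤* (ℚ.nonNegative⁻¹ (+ 33 / 32)) (p≤q⇒0≤q-p (linear k)))
        (0≤* (ℚ.nonNegative⁻¹ (+ 1 / 1024)) (0≤* (ℚ.<⇒≤ 0<f) (0≤ι k))))
      (trans (cong (λ x → + 33 / 32 * f k - c * f 0 * (x + + 32 / 1)) (ι-suc k))
        (solve 3 (λ f₀ f n →
            con (+ 33 / 32) :* f :- con (+ 1 / 32) :* f₀ :* ((con 1ℚ :+ n) :+ con (+ 32 / 1)) :=
            con (+ 33 / 32) :* (f :- con (+ 1 / 32) :* f₀ :* (n :+ con (+ 32 / 1))) :+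
              con (+ 1 / 1024) :* (f₀ :* n)) refl (f 0) (f k) (ι k))))
    (step k)

-- The product f k (k + 12) does not increase, because (12/13) (k + 13) ≤ k + 12; so f k is at most
-- 12 f 0 / (k + 12).
shrinking⇒vanishing : ∀ {f : ℕ → ℚ} → (∀ k → 0ℚ ≤ f k) → (∀ k → f (suc k) ≤ + 12 / 13 * f k) →
  ∀ ε → 0ℚ < ε → Eventually (λ k → f k ≤ ε)
shrinking⇒vanishing {f} 0≤f step ε 0<ε = ev-map
  (λ k h → *-cancelʳ-≤ (0<d k) (ℚ.≤-trans (bound k) (ℚ.≤-trans h
    (≤-by (0≤* (ℚ.nonNegative⁻¹ (+ 11 / 1)) (ℚ.<⇒≤ 0<ε))
      (trans (cong (λ x → ε * d k - ε * x) (ι-suc k))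
        (solve 2 (λ e n → e :* (n :+ con (+ 12 / 1)) :- e :* (con 1ℚ :+ n) := con (+ 11 / 1) :* e)
          refl ε (ι k)))))))
  (eventually-large 0<ε (+ 12 / 1 * f 0))
  where
  open ℚ-Solver
  d : ℕ → ℚ
  d k = ι k + + 12 / 1
  0<d : ∀ k → 0ℚ < d k
  0<d k = subst (0ℚ <_) (ℚ.+-comm (+ 12 / 1) (ι k)) (0<+ (ℚ.positive⁻¹ (+ 12 / 1)) (0≤ι k))
  bound : ∀ k → f k * d k ≤ + 12 / 1 * f 0
  bound zero = ℚ.≤-reflexive (trans (cong (λ x → f 0 * (x + + 12 / 1)) ι-zero)
    (solve 1 (λ f → f :* (con 0ℚ :+ con (+ 12 / 1)) := con (+ 12 / 1) :* f) refl (f 0)))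
  bound (suc k) = ℚ.≤-trans (*-monoʳ-≤ (ℚ.<⇒≤ (0<d (suc k))) (step k)) (ℚ.≤-trans
    (≤-by (0≤* (ℚ.nonNegative⁻¹ (+ 1 / 13)) (0≤* (0≤f k) (0≤ι k)))
      (trans (cong (λ x → f k * d k - + 12 / 13 * f k * (x + + 12 / 1)) (ι-suc k))
        (solve 2 (λ f n → f :* (n :+ con (+ 12 / 1)) :-
            con (+ 12 / 13) :* f :* ((con 1ℚ :+ n) :+ con (+ 12 / 1)) :=
            con (+ 1 / 13) :* (f :* n)) refl (f k) (ι k))))
    (bound k))

ι-rdn-block : ∀ a b I → ι (rdn (block a b I)) ≡ ι a * ι (ldn I) + ι (rdn I)
ι-rdn-block a b I = sym (ι-affine a (ldn I) (rdn I) (trans (rdn-rcs b (lcs a I)) (rdn-lcs a I)))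

ι-ldn-block : ∀ a b I → ι (ldn (block a b I)) ≡ ι b * (ι a * ι (ldn I) + ι (rdn I)) + ι (ldn I)
ι-ldn-block a b I = sym (trans (cong₂ (λ x y → ι b * x + ι y)
    (sym (trans (cong ι (rdn-lcs a I)) (sym (ι-affine a (ldn I) (rdn I) refl)))) (sym (ldn-lcs a I)))
  (ι-affine b (rdn (lcs a I)) (ldn (lcs a I)) (ldn-rcs b (lcs a I))))

potential : ℚ → ℚ → Farey → ℚ
potential x y I = x * ι (ldn I) + y * ι (rdn I)

potential-block : ∀ x y a b I → potential x y (block a b I) ≡
  x * ((+ b / 1) * ((+ a / 1) * ι (ldn I) + ι (rdn I)) + ι (ldn I)) +
    y * ((+ a / 1) * ι (ldn I) + ι (rdn I))
potential-block x y a b I = cong₂ (λ p q → x * p + y * q)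
  (trans (ι-ldn-block a b I) (cong₂ (λ a b → b * (a * ι (ldn I) + ι (rdn I)) + ι (ldn I)) (ι≡/1 a) (ι≡/1 b)))
  (trans (ι-rdn-block a b I) (cong (λ a → a * ι (ldn I) + ι (rdn I)) (ι≡/1 a)))

0≤potential : ∀ {x y} → 0ℚ ≤ x → 0ℚ ≤ y → ∀ I → 0ℚ ≤ potential x y I
0≤potential 0≤x 0≤y I = 0≤+ (0≤* 0≤x (0≤ι (ldn I))) (0≤* 0≤y (0≤ι (rdn I)))

2ℚ : ℚ
2ℚ = + 2 / 1

-- Over one block `c` is the factor of the increment and `ρ` a lower bound for the factor of the
-- potential, namely the least ratio of new to old coefficients; the energy then gains at least c
-- ρ².
square-grow : ∀ c ρ σ {w v v′} → 0ℚ ≤ c → 0ℚ ≤ ρ → 0ℚ ≤ w → 0ℚ ≤ v → σ ≤ c * (ρ * ρ) →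
  ρ * v ≤ v′ → σ * (w * (v * v)) ≤ (c * w) * (v′ * v′)
square-grow c ρ σ {w} {v} {v′} 0≤c 0≤ρ 0≤w 0≤v σ≤ ρv≤v′ = ≤-by
  (0≤+ (0≤* (0≤* 0≤c 0≤w) (0≤* (p≤q⇒0≤q-p ρv≤v′) (0≤+ (ℚ.≤-trans (0≤* 0≤ρ 0≤v) ρv≤v′) (0≤* 0≤ρ 0≤v))))
    (0≤* (p≤q⇒0≤q-p σ≤) (0≤* 0≤w (0≤* 0≤v 0≤v))))
  (solve 6 (λ c ρ σ w v v′ → (c :* w) :* (v′ :* v′) :- σ :* (w :* (v :* v)) :=
    (c :* w) :* ((v′ :- ρ :* v) :* (v′ :+ ρ :* v)) :+ (c :* (ρ :* ρ) :- σ) :* (w :* (v :* v)))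
    refl c ρ σ w v v′)
  where open ℚ-Solver

square-shrink : ∀ c ρ σ {w v v′} → 0ℚ ≤ c → 0ℚ ≤ ρ → 0ℚ ≤ w → 0ℚ ≤ v → 0ℚ ≤ v′ → c * (ρ * ρ) ≤ σ →
  v′ ≤ ρ * v → (c * w) * (v′ * v′) ≤ σ * (w * (v * v))
square-shrink c ρ σ {w} {v} {v′} 0≤c 0≤ρ 0≤w 0≤v 0≤v′ ≤σ v′≤ρv = ≤-by
  (0≤+ (0≤* (0≤* 0≤c 0≤w) (0≤* (p≤q⇒0≤q-p v′≤ρv) (0≤+ 0≤v′ (0≤* 0≤ρ 0≤v))))
    (0≤* (p≤q⇒0≤q-p ≤σ) (0≤* 0≤w (0≤* 0≤v 0≤v))))
  (solve 6 (λ c ρ σ w v v′ → σ :* (w :* (v :* v)) :- (c :* w) :* (v′ :* v′) :=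
    (c :* w) :* ((ρ :* v :- v′) :* (v′ :+ ρ :* v)) :+ (σ :- c :* (ρ :* ρ)) :* (w :* (v :* v)))
    refl c ρ σ w v v′)
  where open ℚ-Solver

1or2 : ∀ {n} → 1 ℕ.≤ n → n ℕ.≤ 2 → n ≡ 1 ⊎ n ≡ 2
1or2 {1} _ _ = inj₁ refl
1or2 {2} _ _ = inj₂ refl
1or2 {suc (suc (suc _))} _ (ℕ.s≤s (ℕ.s≤s ()))

linear-≤ : ∀ {u v} A B I → 0ℚ ≤ A → 0ℚ ≤ B →
  v - u ≡ A * ι (ldn I) + B * ι (rdn I) → u ≤ v
linear-≤ A B I 0≤A 0≤B = ≤-by (0≤+ (0≤* 0≤A (0≤ι (ldn I))) (0≤* 0≤B (0≤ι (rdn I))))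

nonneg : ∀ p .{{_ : ℚ.NonNegative p}} → 0ℚ ≤ p
nonneg p = ℚ.nonNegative⁻¹ p

energy : ℚ → ℚ → Farey → ℚ → ℚ
energy x y I w = w * (potential x y I * potential x y I)

-- The weights 2, 1 in the potential make the worst of the four blocks, (1, 2), still gain
-- (3/5) (3/8)² (7/2)² ≥ 33/32.
energy-grows : ∀ {a b w} I → a ≡ 1 ⊎ a ≡ 2 → b ≡ 1 ⊎ b ≡ 2 → 0ℚ ≤ w →
  + 33 / 32 * energy 2ℚ 1ℚ I w ≤ energy 2ℚ 1ℚ (block a b I) (scale (+ 3 / 8) b (scale (+ 3 / 5) a w))
energy-grows {a} {b} {w} I a≡ b≡ 0≤w = cases a≡ b≡
  where
  open ℚ-Solver
  q = ι (ldn I)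
  s = ι (rdn I)
  V : Farey → ℚ
  V = potential 2ℚ 1ℚ
  cases : a ≡ 1 ⊎ a ≡ 2 → b ≡ 1 ⊎ b ≡ 2 →
    + 33 / 32 * energy 2ℚ 1ℚ I w ≤ energy 2ℚ 1ℚ (block a b I) (scale (+ 3 / 8) b (scale (+ 3 / 5) a w))
  via : ∀ a b c ρ → 0ℚ ≤ c → 0ℚ ≤ ρ → + 33 / 32 ≤ c * (ρ * ρ) → ρ * V I ≤ V (block a b I) →
    c * w ≡ scale (+ 3 / 8) b (scale (+ 3 / 5) a w) →
    + 33 / 32 * energy 2ℚ 1ℚ I w ≤ energy 2ℚ 1ℚ (block a b I) (scale (+ 3 / 8) b (scale (+ 3 / 5) a w))
  via a b c ρ 0≤c 0≤ρ h ρV≤ eq = subst (λ w′ → + 33 / 32 * energy 2ℚ 1ℚ I w ≤ energy 2ℚ 1ℚ (block a b I) w′)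
    eq (square-grow c ρ (+ 33 / 32) 0≤c 0≤ρ 0≤w (0≤potential (nonneg 2ℚ) (nonneg 1ℚ) I) h ρV≤)
  cases (inj₁ refl) (inj₁ refl) = via 1 1 (+ 9 / 40) (+ 5 / 2) (nonneg _) (nonneg _)
    (from-yes (+ 33 / 32 ℚ.≤? + 9 / 40 * (+ 5 / 2 * (+ 5 / 2))))
    (linear-≤ 0ℚ ½ I (nonneg _) (nonneg _) (trans (cong (_- + 5 / 2 * V I) (potential-block 2ℚ 1ℚ 1 1 I))
      (solve 2 (λ q s → let t = con 1ℚ :* q :+ s in
        (con 2ℚ :* (con 1ℚ :* t :+ q) :+ con 1ℚ :* t) :- con (+ 5 / 2) :* (con 2ℚ :* q :+ con 1ℚ :* s) :=
        con 0ℚ :* q :+ con ½ :* s) refl q s)))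
    (solve 1 (λ w → con (+ 9 / 40) :* w := con (+ 3 / 8) :* (con (+ 3 / 5) :* w)) refl w)
  cases (inj₁ refl) (inj₂ refl) = via 1 2 (+ 27 / 320) (+ 7 / 2) (nonneg _) (nonneg _)
    (from-yes (+ 33 / 32 ℚ.≤? + 27 / 320 * (+ 7 / 2 * (+ 7 / 2))))
    (linear-≤ 0ℚ (+ 3 / 2) I (nonneg _) (nonneg _) (trans (cong (_- + 7 / 2 * V I) (potential-block 2ℚ 1ℚ 1 2 I))
      (solve 2 (λ q s → let t = con 1ℚ :* q :+ s in
        (con 2ℚ :* (con 2ℚ :* t :+ q) :+ con 1ℚ :* t) :- con (+ 7 / 2) :* (con 2ℚ :* q :+ con 1ℚ :* s) :=
        con 0ℚ :* q :+ con (+ 3 / 2) :* s) refl q s)))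
    (solve 1 (λ w → con (+ 27 / 320) :* w := con (+ 3 / 8) :* (con (+ 3 / 8) :* (con (+ 3 / 5) :* w))) refl w)
  cases (inj₂ refl) (inj₁ refl) = via 2 1 (+ 27 / 200) (+ 3 / 1) (nonneg _) (nonneg _)
    (from-yes (+ 33 / 32 ℚ.≤? + 27 / 200 * (+ 3 / 1 * (+ 3 / 1))))
    (linear-≤ 2ℚ 0ℚ I (nonneg _) (nonneg _) (trans (cong (_- + 3 / 1 * V I) (potential-block 2ℚ 1ℚ 2 1 I))
      (solve 2 (λ q s → let t = con 2ℚ :* q :+ s in
        (con 2ℚ :* (con 1ℚ :* t :+ q) :+ con 1ℚ :* t) :- con (+ 3 / 1) :* (con 2ℚ :* q :+ con 1ℚ :* s) :=
        con 2ℚ :* q :+ con 0ℚ :* s) refl q s)))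
    (solve 1 (λ w → con (+ 27 / 200) :* w := con (+ 3 / 8) :* (con (+ 3 / 5) :* (con (+ 3 / 5) :* w))) refl w)
  cases (inj₂ refl) (inj₂ refl) = via 2 2 (+ 81 / 1600) (+ 5 / 1) (nonneg _) (nonneg _)
    (from-yes (+ 33 / 32 ℚ.≤? + 81 / 1600 * (+ 5 / 1 * (+ 5 / 1))))
    (linear-≤ 2ℚ 0ℚ I (nonneg _) (nonneg _) (trans (cong (_- + 5 / 1 * V I) (potential-block 2ℚ 1ℚ 2 2 I))
      (solve 2 (λ q s → let t = con 2ℚ :* q :+ s in
        (con 2ℚ :* (con 2ℚ :* t :+ q) :+ con 1ℚ :* t) :- con (+ 5 / 1) :* (con 2ℚ :* q :+ con 1ℚ :* s) :=
        con 2ℚ :* q :+ con 0ℚ :* s) refl q s)))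
    (solve 1 (λ w → con (+ 81 / 1600) :* w :=
      con (+ 3 / 8) :* (con (+ 3 / 8) :* (con (+ 3 / 5) :* (con (+ 3 / 5) :* w)))) refl w)

-- (5/8) (2/5)³ (24/5)² ≤ 12/13, the factor 24/5 being just above the eigenvalue (5 + √21)/2.
energy-shrinks : ∀ {w} I → 0ℚ ≤ w →
  energy (+ 5 / 1) (+ 4 / 1) (block 1 3 I) (scale (+ 2 / 5) 3 (scale (+ 5 / 8) 1 w)) ≤
    + 12 / 13 * energy (+ 5 / 1) (+ 4 / 1) I w
energy-shrinks {w} I 0≤w = subst
  (λ w′ → energy (+ 5 / 1) (+ 4 / 1) (block 1 3 I) w′ ≤ + 12 / 13 * energy (+ 5 / 1) (+ 4 / 1) I w)
  (solve 1 (λ w → con (+ 1 / 25) :* w :=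
    con (+ 2 / 5) :* (con (+ 2 / 5) :* (con (+ 2 / 5) :* (con (+ 5 / 8) :* w)))) refl w)
  (square-shrink (+ 1 / 25) (+ 24 / 5) (+ 12 / 13) (nonneg _) (nonneg _) 0≤w
    (0≤potential (nonneg _) (nonneg _) I) (0≤potential (nonneg _) (nonneg _) (block 1 3 I))
    (from-yes (+ 1 / 25 * (+ 24 / 5 * (+ 24 / 5)) ℚ.≤? + 12 / 13))
    (linear-≤ 0ℚ (+ 1 / 5) I (nonneg _) (nonneg _)
      (trans (cong (λ v → + 24 / 5 * potential (+ 5 / 1) (+ 4 / 1) I - v)
          (potential-block (+ 5 / 1) (+ 4 / 1) 1 3 I))
        (solve 2 (λ q s → let t = con 1ℚ :* q :+ s in
          con (+ 24 / 5) :* (con (+ 5 / 1) :* q :+ con (+ 4 / 1) :* s) :-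
            (con (+ 5 / 1) :* (con (+ 3 / 1) :* t :+ q) :+ con (+ 4 / 1) :* t) :=
          con 0ℚ :* q :+ con (+ 1 / 5) :* s) refl (ι (ldn I)) (ι (rdn I))))))
  where open ℚ-Solver

-- Partial quotients at most 2: the slope grows

Balanced : Farey → Set
Balanced I = rdn I ℕ.≤ ldn I × ldn I ℕ.≤ 3 ℕ.* rdn I

rcs-balanced : ∀ {b} I → 1 ℕ.≤ b → b ℕ.≤ 2 → ldn I ℕ.≤ rdn I → Balanced (rcs b I)
rcs-balanced {b} I 1≤b b≤2 q≤s = subst₂ (λ q s → s ℕ.≤ q × q ℕ.≤ 3 ℕ.* s) (sym (ldn-rcs b I)) (sym (rdn-rcs b I))
  ( ℕ.≤-trans (ℕ.m≤m*n (rdn I) b {{ℕ.>-nonZero 1≤b}}) (ℕ.≤-trans (ℕ.≤-reflexive (ℕ.*-comm (rdn I) b))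
      (ℕ.m≤m+n (b ℕ.* rdn I) (ldn I)))
  , subst (b ℕ.* rdn I ℕ.+ ldn I ℕ.≤_) (ℕ.+-comm (2 ℕ.* rdn I) (rdn I))
      (ℕ.+-mono-≤ (ℕ.*-monoˡ-≤ (rdn I) b≤2) q≤s))

lcs-wide : ∀ {a} I → 1 ℕ.≤ a → ldn (lcs a I) ℕ.≤ rdn (lcs a I)
lcs-wide {a} I 1≤a = subst₂ ℕ._≤_ (sym (ldn-lcs a I)) (sym (rdn-lcs a I)) (ℕ.≤-trans
  (ℕ.m≤m*n (ldn I) a {{ℕ.>-nonZero 1≤a}}) (ℕ.≤-trans (ℕ.≤-reflexive (ℕ.*-comm (ldn I) a))
    (ℕ.m≤m+n (a ℕ.* ldn I) (rdn I))))

-- Expanding (2 Q + S)², the term 4 Q² is at most 12 Q S and S² is at most Q S; with 4 Q S this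
-- makes 17. Without a bound on Q / S the square is not controlled by the product.
balanced-potential² : ∀ I → Balanced I →
  potential 2ℚ 1ℚ I * potential 2ℚ 1ℚ I ≤ + 17 / 1 * (ι (ldn I) * ι (rdn I))
balanced-potential² I (s≤q , q≤3s) = ≤-by
  (0≤+ (0≤* (0≤* (nonneg (+ 4 / 1)) (0≤ι (ldn I))) (p≤q⇒0≤q-p q≤3s′))
    (0≤* (0≤ι (rdn I)) (p≤q⇒0≤q-p (ι-mono-≤ s≤q))))
  (solve 2 (λ q s → con (+ 17 / 1) :* (q :* s) :- (con 2ℚ :* q :+ con 1ℚ :* s) :* (con 2ℚ :* q :+ con 1ℚ :* s) :=
    (con (+ 4 / 1) :* q) :* (con (+ 3 / 1) :* s :- q) :+ s :* (q :- s)) refl (ι (ldn I)) (ι (rdn I)))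
  where
  open ℚ-Solver
  q≤3s′ : ι (ldn I) ≤ + 3 / 1 * ι (rdn I)
  q≤3s′ = subst (ι (ldn I) ≤_) (trans (ι-* 3 (rdn I)) (cong (_* ι (rdn I)) (ι≡/1 3))) (ι-mono-≤ q≤3s)

≤-*-width : ∀ I {w e} → w * (ι (ldn I) * ι (rdn I)) ≤ e → w ≤ e * width I
≤-*-width I {w} {e} h = subst (_≤ e * width I)
  (trans (ℚ.*-assoc w d (width I)) (trans (cong (w *_) (trans (ℚ.*-comm d (width I)) (width-*-dens I)))
    (ℚ.*-identityʳ w)))
  (*-monoʳ-≤ (ℚ.<⇒≤ (0<width I)) h)
  where d = ι (ldn I) * ι (rdn I)

*-width-≤ : ∀ I {w e} → e ≤ w * (ι (ldn I) * ι (rdn I)) → e * width I ≤ w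
*-width-≤ I {w} {e} h = subst (e * width I ≤_)
  (trans (ℚ.*-assoc w d (width I)) (trans (cong (w *_) (trans (ℚ.*-comm d (width I)) (width-*-dens I)))
    (ℚ.*-identityʳ w)))
  (*-monoʳ-≤ (ℚ.<⇒≤ (0<width I)) h)
  where d = ι (ldn I) * ι (rdn I)

scale-≥ : ∀ κ → 0ℚ ≤ κ → κ ≤ 1ℚ → ∀ {n w} → n ≡ 1 ⊎ n ≡ 2 → 0ℚ ≤ w → κ * κ * w ≤ scale κ n w
scale-≥ κ 0≤κ κ≤1 {w = w} (inj₁ refl) 0≤w = ≤-by (0≤* (0≤* 0≤κ 0≤w) (p≤q⇒0≤q-p κ≤1))
  (solve 2 (λ κ w → κ :* w :- κ :* κ :* w := κ :* w :* (con 1ℚ :- κ)) refl κ w)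
  where open ℚ-Solver
scale-≥ κ 0≤κ κ≤1 {w = w} (inj₂ refl) 0≤w = ℚ.≤-reflexive (ℚ.*-assoc κ κ w)

-- interval a (suc (suc k)) lies to the left of rightGap a k and to the right of leftGap a k.
rightGap leftGap : (ℕ → ℕ) → ℕ → Farey
rightGap a k = rc (interval a (suc k))
leftGap  a k = lc (lcs (drop (suc (suc k)) a 0) (interval a (suc k)))

module Steep {a : ℕ → ℕ} (1≤a : ∀ i → 1 ℕ.≤ a i) (a≤2 : ∀ i → a i ℕ.≤ 2) where

  w : ℕ → ℚ
  w = weight (+ 3 / 5) (+ 3 / 8) a

  0<w : ∀ k → 0ℚ < w k
  0<w = 0<weight (ℚ.positive⁻¹ (+ 3 / 5)) (ℚ.positive⁻¹ (+ 3 / 8)) a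

  digit : ∀ k i → drop k a i ≡ 1 ⊎ drop k a i ≡ 2
  digit = drop-all {λ n → n ≡ 1 ⊎ n ≡ 2} λ i → 1or2 (1≤a i) (a≤2 i)

  balanced : ∀ k → Balanced (interval a k)
  balanced zero = rcs-balanced (lcs (ℕ.pred (a 0)) unit) (1≤a 1) (a≤2 1)
    (subst (ℕ._≤ rdn (lcs (ℕ.pred (a 0)) unit)) (sym (ldn-lcs (ℕ.pred (a 0)) unit)) (ℕ.s≤s ℕ.z≤n))
  balanced (suc k) = rcs-balanced (lcs (drop (suc k) a 0) (interval a k))
    (drop-all {λ n → 1 ℕ.≤ n} 1≤a (suc k) 1) (drop-all {λ n → n ℕ.≤ 2} a≤2 (suc k) 1)
    (lcs-wide (interval a k) (drop-all {λ n → 1 ℕ.≤ n} 1≤a (suc k) 0))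

  0<energy : 0ℚ < energy 2ℚ 1ℚ (interval a 0) (w 0)
  0<energy = 0<* (0<w 0) (0<* 0<V 0<V)
    where
    0<V : 0ℚ < potential 2ℚ 1ℚ (interval a 0)
    0<V = 0<+ (0<* (ℚ.positive⁻¹ 2ℚ) (0<ι (ldn-1 (interval a 0)))) (0≤* (ℚ.<⇒≤ 0<1) (0≤ι (rdn (interval a 0))))

  energy-unbounded : ∀ M → Eventually (λ k → M ≤ energy 2ℚ 1ℚ (interval a k) (w k))
  energy-unbounded = growing⇒unbounded {λ k → energy 2ℚ 1ℚ (interval a k) (w k)} 0<energy
    λ k → energy-grows (interval a k) (digit (suc k) 0) (digit (suc k) 1) (ℚ.<⇒≤ (0<w k))

  -- Dividing `w k` by the width gives w Q S, which is at least a seventeenth of the unbounded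
  -- energy; hence 1700 = 17 * 100. The factor 1/100 pays for passing from `interval a k` to the
  -- much smaller gaps inside `interval a (suc k)`.
  width-negligible : ∀ M → Eventually (λ k → M * width (interval a k) ≤ + 1 / 100 * w k)
  width-negligible M = ev-map step (energy-unbounded (+ 1700 / 1 * M))
    where
    open ℚ-Solver
    step : ∀ k → + 1700 / 1 * M ≤ energy 2ℚ 1ℚ (interval a k) (w k) →
      M * width (interval a k) ≤ + 1 / 100 * w k
    step k h = *-width-≤ (interval a k) (≤-by
      (0≤* (nonneg (+ 1 / 1700)) (p≤q⇒0≤q-p (ℚ.≤-trans h
        (subst₂ _≤_ (ℚ.*-comm _ (w k)) (ℚ.*-comm _ (w k))
          (*-monoʳ-≤ (ℚ.<⇒≤ (0<w k)) (balanced-potential² (interval a k) (balanced k)))))))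
      (solve 3 (λ M w d → con (+ 1 / 100) :* w :* d :- M :=
        con (+ 1 / 1700) :* (w :* (con (+ 17 / 1) :* d) :- con (+ 1700 / 1) :* M)) refl
        M (w k) (ι (ldn (interval a k)) * ι (rdn (interval a k)))))

  -- The block (2, 2) costs most: (3/5)² (3/8)² = 81/1600. One more right step for the right gap, or
  -- at most three left steps for the left gap, leaves 3/8 or (3/5)³ of this, and both are above
  -- 1/100, the second one barely.
  w-suc : ∀ k → + 81 / 1600 * w k ≤ w (suc k)
  w-suc k = ℚ.≤-trans
    (ℚ.≤-trans (ℚ.≤-reflexive (solve 1 (λ w → con (+ 81 / 1600) :* w :=
        con (+ 9 / 25) :* w :* con (+ 9 / 64)) refl (w k)))
      (ℚ.≤-trans (*-monoʳ-≤ (nonneg (+ 9 / 64)) (scale-≥ (+ 3 / 5) (nonneg _) (from-yes (+ 3 / 5 ℚ.≤? 1ℚ))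
          (digit (suc k) 0) (ℚ.<⇒≤ (0<w k))))
        (ℚ.≤-reflexive (ℚ.*-comm u (+ 9 / 64)))))
    (scale-≥ (+ 3 / 8) (nonneg _) (from-yes (+ 3 / 8 ℚ.≤? 1ℚ)) (digit (suc k) 1)
      (0≤scale (nonneg (+ 3 / 5)) (drop (suc k) a 0) (ℚ.<⇒≤ (0<w k))))
    where
    open ℚ-Solver
    u = scale (+ 3 / 5) (drop (suc k) a 0) (w k)

  rightGap-weight : ∀ k → + 1 / 100 * w k ≤ + 3 / 8 * w (suc k)
  rightGap-weight k = ≤-by (0≤+ (0≤* (nonneg (+ 3 / 8)) (p≤q⇒0≤q-p (w-suc k)))
      (0≤* (nonneg (+ 3 / 8 * (+ 81 / 1600) - + 1 / 100)) (ℚ.<⇒≤ (0<w k))))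
    (solve 2 (λ w w′ → con (+ 3 / 8) :* w′ :- con (+ 1 / 100) :* w :=
      con (+ 3 / 8) :* (w′ :- con (+ 81 / 1600) :* w) :+
        con (+ 3 / 8 * (+ 81 / 1600) - + 1 / 100) :* w) refl (w k) (w (suc k)))
    where open ℚ-Solver

  leftGap-weight : ∀ k →
    + 1 / 100 * w k ≤ + 3 / 5 * scale (+ 3 / 5) (drop (suc (suc k)) a 0) (w (suc k))
  leftGap-weight k = ≤-by
      (0≤+ (0≤* (nonneg (+ 3 / 5)) (p≤q⇒0≤q-p (scale-≥ (+ 3 / 5) (nonneg _) (from-yes (+ 3 / 5 ℚ.≤? 1ℚ))
          (digit (suc (suc k)) 0) (ℚ.<⇒≤ (0<w (suc k))))))
        (0≤+ (0≤* (nonneg (+ 27 / 125)) (p≤q⇒0≤q-p (w-suc k)))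
          (0≤* (nonneg (+ 27 / 125 * (+ 81 / 1600) - + 1 / 100)) (ℚ.<⇒≤ (0<w k)))))
    (solve 3 (λ w w′ w″ → con (+ 3 / 5) :* w″ :- con (+ 1 / 100) :* w :=
      con (+ 3 / 5) :* (w″ :- con (+ 3 / 5 * (+ 3 / 5)) :* w′) :+
        (con (+ 27 / 125) :* (w′ :- con (+ 81 / 1600) :* w) :+
          con (+ 27 / 125 * (+ 81 / 1600) - + 1 / 100) :* w)) refl
      (w k) (w (suc k)) (scale (+ 3 / 5) (drop (suc (suc k)) a 0) (w (suc k))))
    where open ℚ-Solver

-- The expansion [0; 1, 3, 1, 3, ...]: the slope decays

alternating : ℕ → ℕ
alternating zero          = 1
alternating (suc zero)    = 3
alternating (suc (suc i)) = alternating i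

1≤alternating : ∀ i → 1 ℕ.≤ alternating i
1≤alternating zero          = ℕ.s≤s ℕ.z≤n
1≤alternating (suc zero)    = ℕ.s≤s ℕ.z≤n
1≤alternating (suc (suc i)) = 1≤alternating i

alternating≤3 : ∀ i → alternating i ℕ.≤ 3
alternating≤3 zero          = ℕ.s≤s ℕ.z≤n
alternating≤3 (suc zero)    = ℕ.≤-refl
alternating≤3 (suc (suc i)) = alternating≤3 i

drop-alternating : ∀ k i → drop k alternating i ≡ alternating i
drop-alternating zero    i = refl
drop-alternating (suc k) i = drop-alternating k (2 ℕ.+ i)

module Flat where

  W : ℕ → ℚ
  W = weight (+ 5 / 8) (+ 2 / 5) alternating

  0≤W : ∀ k → 0ℚ ≤ W k
  0≤W k = ℚ.<⇒≤ (0<weight (ℚ.positive⁻¹ (+ 5 / 8)) (ℚ.positive⁻¹ (+ 2 / 5)) alternating k)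

  V : Farey → ℚ
  V = potential (+ 5 / 1) (+ 4 / 1)

  I : ℕ → Farey
  I = interval alternating

  interval-suc : ∀ k → I (suc k) ≡ block 1 3 (I k)
  interval-suc k = cong₂ (λ a b → block a b (I k))
    (drop-alternating (suc k) 0) (drop-alternating (suc k) 1)

  W-suc : ∀ k → W (suc k) ≡ scale (+ 2 / 5) 3 (scale (+ 5 / 8) 1 (W k))
  W-suc k = cong₂ (λ a b → scale (+ 2 / 5) b (scale (+ 5 / 8) a (W k)))
    (drop-alternating (suc k) 0) (drop-alternating (suc k) 1)

  energy-vanishes : ∀ ε → 0ℚ < ε → Eventually (λ k → energy (+ 5 / 1) (+ 4 / 1) (I k) (W k) ≤ ε)
  energy-vanishes = shrinking⇒vanishing {λ k → energy (+ 5 / 1) (+ 4 / 1) (I k) (W k)}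
    (λ k → 0≤* (0≤W k) (0≤* (0≤potential (nonneg _) (nonneg _) (I k)) (0≤potential (nonneg _) (nonneg _) (I k))))
    (λ k → subst₂ (λ J w → energy (+ 5 / 1) (+ 4 / 1) J w ≤ + 12 / 13 * energy (+ 5 / 1) (+ 4 / 1) (I k) (W k))
      (sym (interval-suc k)) (sym (W-suc k)) (energy-shrinks (I k) (0≤W k)))

  ι-ldn-13 : ∀ J → ι (ldn (block 1 3 J)) ≡ + 4 / 1 * ι (ldn J) + + 3 / 1 * ι (rdn J)
  ι-ldn-13 J = trans (ι-ldn-block 1 3 J)
    (trans (cong₂ (λ a b → b * (a * ι (ldn J) + ι (rdn J)) + ι (ldn J)) (ι≡/1 1) (ι≡/1 3))
      (solve 2 (λ q s → con (+ 3 / 1) :* (con 1ℚ :* q :+ s) :+ q := con (+ 4 / 1) :* q :+ con (+ 3 / 1) :* s)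
        refl (ι (ldn J)) (ι (rdn J))))
    where open ℚ-Solver

  ι-rdn-13 : ∀ J → ι (rdn (block 1 3 J)) ≡ ι (ldn J) + ι (rdn J)
  ι-rdn-13 J = trans (ι-rdn-block 1 3 J) (cong (_+ ι (rdn J))
    (trans (cong (_* ι (ldn J)) (ι≡/1 1)) (ℚ.*-identityˡ (ι (ldn J)))))

  -- After the block (1, 3) the denominators are 4 Q + 3 S and Q + S, so the left denominator of the
  -- gap is 5 Q + 4 S, the potential itself, and the right one is smaller.
  rightGap-dens : ∀ J → ι (ldn (rc (block 1 3 J))) * ι (rdn (rc (block 1 3 J))) ≤ 2ℚ * (V J * V J)
  rightGap-dens J = subst (_≤ 2ℚ * (V J * V J))
    (sym (cong₂ _*_ (trans (ι-+ (ldn (block 1 3 J)) (rdn (block 1 3 J))) (cong₂ _+_ (ι-ldn-13 J) (ι-rdn-13 J)))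
      (ι-rdn-13 J)))
    (≤-by (0≤* (0≤potential (nonneg (+ 5 / 1)) (nonneg (+ 4 / 1)) J)
        (0≤potential (nonneg (+ 9 / 1)) (nonneg (+ 7 / 1)) J))
      (solve 2 (λ q s → let v = con (+ 5 / 1) :* q :+ con (+ 4 / 1) :* s in
        con 2ℚ :* (v :* v) :- ((con (+ 4 / 1) :* q :+ con (+ 3 / 1) :* s) :+ (q :+ s)) :* (q :+ s) :=
        v :* (con (+ 9 / 1) :* q :+ con (+ 7 / 1) :* s)) refl (ι (ldn J)) (ι (rdn J))))
    where open ℚ-Solver

  leftGap-dens : ∀ J → ι (ldn (lc (lcs 1 (block 1 3 J)))) * ι (rdn (lc (lcs 1 (block 1 3 J)))) ≤ 2ℚ * (V J * V J)
  leftGap-dens J = subst (_≤ 2ℚ * (V J * V J))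
    (sym (cong₂ _*_ (ι-ldn-13 J) (trans (ι-+ (ldn B) (ldn B ℕ.+ rdn B))
      (cong₂ _+_ (ι-ldn-13 J) (trans (ι-+ (ldn B) (rdn B)) (cong₂ _+_ (ι-ldn-13 J) (ι-rdn-13 J)))))))
    (≤-by (0≤* (0≤potential (nonneg 1ℚ) (nonneg 1ℚ) J) (0≤potential (nonneg (+ 14 / 1)) (nonneg (+ 11 / 1)) J))
      (solve 2 (λ q s → let v = con (+ 5 / 1) :* q :+ con (+ 4 / 1) :* s
                            p = con (+ 4 / 1) :* q :+ con (+ 3 / 1) :* s in
        con 2ℚ :* (v :* v) :- p :* (p :+ (p :+ (q :+ s))) :=
        (con 1ℚ :* q :+ con 1ℚ :* s) :* (con (+ 14 / 1) :* q :+ con (+ 11 / 1) :* s)) refl (ι (ldn J)) (ι (rdn J))))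
    where
    open ℚ-Solver
    B = block 1 3 J

  -- Dividing by the width of the gap multiplies by the product of its denominators, so the quotient
  -- is at most twice the energy, which tends to 0.
  gap-dominates : ∀ (J : ℕ → Farey) → (∀ k → ι (ldn (J k)) * ι (rdn (J k)) ≤ 2ℚ * (V (I k) * V (I k))) →
    ∀ ε → 0ℚ < ε → Eventually (λ k → W k ≤ ε * width (J k))
  gap-dominates J dens≤ ε 0<ε = ev-map
    (λ k h → ≤-*-width (J k) {W k} {ε} (≤-by
      (0≤+ (0≤* (0≤W k) (p≤q⇒0≤q-p (dens≤ k))) (0≤* (nonneg 2ℚ) (p≤q⇒0≤q-p h)))
      (solve 4 (λ w d v ε → ε :- w :* d :=
        w :* (con 2ℚ :* v :- d) :+ con 2ℚ :* (con ½ :* ε :- w :* v)) refl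
        (W k) (ι (ldn (J k)) * ι (rdn (J k))) (V (I k) * V (I k)) ε)))
    (energy-vanishes (½ * ε) (half-< 0<ε))
    where open ℚ-Solver

  rightGap-wide : ∀ ε → 0ℚ < ε → Eventually (λ k → W k ≤ ε * width (rightGap alternating k))
  rightGap-wide = gap-dominates (rightGap alternating) λ k →
    subst (λ J → ι (ldn (rc J)) * ι (rdn (rc J)) ≤ 2ℚ * (V (I k) * V (I k)))
      (sym (interval-suc k)) (rightGap-dens (I k))

  leftGap-wide : ∀ ε → 0ℚ < ε → Eventually (λ k → W k ≤ ε * width (leftGap alternating k))
  leftGap-wide = gap-dominates (leftGap alternating) λ k →
    subst₂ (λ a J → ι (ldn (lc (lcs a J))) * ι (rdn (lc (lcs a J))) ≤ 2ℚ * (V (I k) * V (I k)))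
      (sym (drop-alternating (suc (suc k)) 0)) (sym (interval-suc k)) (leftGap-dens (I k))

-- Limits and secants

∣p-q∣+e≤ε⇒near : ∀ {p q e ε} → 0ℚ < e → ∣ p - q ∣ + e ≤ ε → p ≤ q + ε × q ≤ p + ε
∣p-q∣+e≤ε⇒near {p} {q} {e} {ε} 0<e h = bound p q h , bound q p (subst (λ t → t + e ≤ ε) (∣p-q∣≡∣q-p∣ p q) h)
  where
  open ℚ-Solver
  bound : ∀ p q → ∣ p - q ∣ + e ≤ ε → p ≤ q + ε
  bound p q h = ≤-by (0≤+ (p≤q⇒0≤q-p (p≤∣p∣ (p - q))) (0≤+ (p≤q⇒0≤q-p h) (ℚ.<⇒≤ 0<e)))
    (solve 5 (λ p q a e ε → (q :+ ε) :- p := (a :- (p :- q)) :+ ((ε :- (a :+ e)) :+ e)) refl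
      p q ∣ p - q ∣ e ε)

near⇒∣p-q∣≤ε : ∀ {p q ε} → p ≤ q + ε → q ≤ p + ε → ∣ p - q ∣ ≤ ε
near⇒∣p-q∣≤ε {p} {q} {ε} h k = ∣p-q∣-elim (_≤ ε) p q (p-q≤r h) (p-q≤r k)

0ℝ<fromℚ : ∀ {ε} → 0ℚ < ε → 0ℝ ℝ.< fromℚ ε
0ℝ<fromℚ {ε} 0<ε = ε , 0<ε , 0 , λ _ _ → ℚ.≤-reflexive (ℚ.+-identityˡ ε)

≤-or-> : ∀ p q → p ≤ q ⊎ q < p
≤-or-> p q with p ℚ.≤? q
... | yes p≤q = inj₁ p≤q
... | no p≰q = inj₂ (ℚ.≰⇒> p≰q)

infix 4 _⇝_

-- Convergence of a sequence of reals: `j` counts the reals, `m` their rational approximations. The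
-- bound on `m` is chosen after `j`, since no modulus uniform in `j` is at hand.
record _⇝_ (u : ℕ → ℕ → ℚ) (x : ℕ → ℚ) : Set where
  constructor tends
  field
    within-η : ∀ η → 0ℚ < η →
      Eventually (λ j → Eventually (λ m → u j m ≤ x m + η × x m ≤ u j m + η))

open _⇝_

limit-≲ : ∀ {fu fv hu hv : ℕ → ℕ → ℚ} {Fx Fy Hx Hy : ℕ → ℚ} {α β} → 0ℚ ≤ α → 0ℚ ≤ β →
  fu ⇝ Fx → fv ⇝ Fy → hu ⇝ Hx → hv ⇝ Hy →
  Eventually (λ j → (λ m → α * (fv j m - fu j m)) ≲ (λ m → β * (hv j m - hu j m))) →
  (λ m → α * (Fy m - Fx m)) ≲ (λ m → β * (Hy m - Hx m))
limit-≲ {fu} {fv} {hu} {hv} {Fx} {Fy} {Hx} {Hy} {α} {β} 0≤α 0≤β fu⇝ fv⇝ hu⇝ hv⇝ rel =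
  approx λ ε 0<ε → bound ε 0<ε
  where
  open ℚ-Solver
  -- With ε = 4 C η, the inequality at index j may err by 2 C η and the four limits by 2 α η + 2 β η
  -- together; the summand 1 makes C positive and leaves 2 η to spare.
  C = (α + β) + 1ℚ
  0<C : 0ℚ < C
  0<C = subst (0ℚ <_) (ℚ.+-comm 1ℚ (α + β)) (0<+ 0<1 (0≤+ 0≤α 0≤β))
  bound : ∀ ε → 0ℚ < ε → Eventually (λ m → α * (Fy m - Fx m) ≤ β * (Hy m - Hx m) + ε)
  bound ε 0<ε = conclude (ev-witness
      (ev-zip (λ _ → _,_) rel (ev-zip (λ _ → _,_) (ev-zip (λ _ → _,_) (within-η fu⇝ η 0<η) (within-η fv⇝ η 0<η))
        (ev-zip (λ _ → _,_) (within-η hu⇝ η 0<η) (within-η hv⇝ η 0<η)))))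
    where
    η = + 1 / 4 * (ε * recip C)
    0<η : 0ℚ < η
    0<η = 0<* (ℚ.positive⁻¹ (+ 1 / 4)) (0<* 0<ε (0<recip 0<C))
    ε≡4Cη : ε ≡ + 4 / 1 * (C * η)
    ε≡4Cη = sym (trans (solve 3 (λ c e r → con (+ 4 / 1) :* (c :* (con (+ 1 / 4) :* (e :* r))) := e :* (c :* r))
      refl C ε (recip C)) (trans (cong (ε *_) (recip-inverse 0<C)) (ℚ.*-identityʳ ε)))
    Near : (ℕ → ℚ) → (ℕ → ℚ) → Set
    Near u x = Eventually (λ m → u m ≤ x m + η × x m ≤ u m + η)
    conclude : ∃[ j ] ((λ m → α * (fv j m - fu j m)) ≲ (λ m → β * (hv j m - hu j m))) ×
        (Near (fu j) Fx × Near (fv j) Fy) × (Near (hu j) Hx × Near (hv j) Hy) →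
      Eventually (λ m → α * (Fy m - Fx m) ≤ β * (Hy m - Hx m) + ε)
    conclude (j , r , (nfu , nfv) , (nhu , nhv)) = ev-zip
      (λ { m rm (((a , _) , (_ , b)) , ((_ , c) , (d , _))) →
        subst (λ e → α * (Fy m - Fx m) ≤ β * (Hy m - Hx m) + e)
        (sym ε≡4Cη) (≤-by
          (0≤+ (0≤+ (p≤q⇒0≤q-p rm) (0≤* 0≤β (0≤+ (p≤q⇒0≤q-p c) (p≤q⇒0≤q-p d))))
            (0≤+ (0≤* 0≤α (0≤+ (p≤q⇒0≤q-p a) (p≤q⇒0≤q-p b))) (0≤* (nonneg 2ℚ) (ℚ.<⇒≤ 0<η))))
          (cert (Fx m) (Fy m) (Hx m) (Hy m) (fu j m) (fv j m) (hu j m) (hv j m) η)) })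
      (within r (2ℚ * (C * η)) (0<* (ℚ.positive⁻¹ 2ℚ) (0<* 0<C 0<η)))
      (ev-zip (λ _ → _,_) (ev-zip (λ _ → _,_) nfu nfv) (ev-zip (λ _ → _,_) nhu nhv))
      where
      cert : ∀ Fx Fy Hx Hy fu fv hu hv η →
        (β * (Hy - Hx) + + 4 / 1 * (C * η)) - α * (Fy - Fx) ≡
        (((β * (hv - hu) + 2ℚ * (C * η)) - α * (fv - fu)) + β * (((hu + η) - Hx) + ((Hy + η) - hv))) +
          (α * (((Fx + η) - fu) + ((fv + η) - Fy)) + 2ℚ * η)
      cert Fx Fy Hx Hy fu fv hu hv η = solve 11
        (λ Fx Fy Hx Hy fu fv hu hv η α β → let C = (α :+ β) :+ con 1ℚ in
          (β :* (Hy :- Hx) :+ con (+ 4 / 1) :* (C :* η)) :- α :* (Fy :- Fx) :=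
          (((β :* (hv :- hu) :+ con 2ℚ :* (C :* η)) :- α :* (fv :- fu)) :+
              β :* (((hu :+ η) :- Hx) :+ ((Hy :+ η) :- hv))) :+
            (α :* (((Fx :+ η) :- fu) :+ ((fv :+ η) :- Fy)) :+ con 2ℚ :* η))
        refl Fx Fy Hx Hy fu fv hu hv η α β

Encloses : (ℕ → ℕ) → ℝ → Set
Encloses a x = ∀ k → const (left (interval a k)) ≲ seq x × seq x ≲ const (right (interval a k))

continued-fraction⇒encloses : ∀ {a x} → IsContinuedFraction a x → Encloses a x
continued-fraction⇒encloses {a} {x} cf k =
    approx (λ ε 0<ε → near ε 0<ε (λ _ l c≤x+ε _ → ℚ.≤-trans (proj₁ l) c≤x+ε))
  , approx (λ ε 0<ε → near ε 0<ε (λ _ l _ x≤c+ε → ℚ.≤-trans x≤c+ε (ℚ.+-monoˡ-≤ ε (proj₂ l))))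
  where
  open IsContinuedFraction cf
  near : ∀ ε → 0ℚ < ε → {P : ℕ → Set} →
    (∀ m {c} → left (interval a k) ≤ c × c ≤ right (interval a k) →
      c ≤ seq x m + ε → seq x m ≤ c + ε → P m) → Eventually P
  near ε 0<ε f with ev-zip (λ _ → _,_) (converges (fromℚ ε) (0ℝ<fromℚ 0<ε))
      (2 ℕ.+ (k ℕ.+ k) , convergent-bounds positive k)
  ... | N , h with h N ℕ.≤-refl
  ... | (e , 0<e , close) , b = ev-map (λ m h → let p , q = ∣p-q∣+e≤ε⇒near 0<e h in f m b p q) close

-- The place of a nearby real among the enclosing intervals

module Location {a : ℕ → ℕ} (1≤a : ∀ i → 1 ℕ.≤ a i) {x : ℝ} (enc : Encloses a x) where

  I : ℕ → Farey
  I = interval a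

  I-⊑ : ∀ {j k} → k ℕ.≤ j → I j ⊑ I k
  I-⊑ k≤j = interval-⊑ 1≤a (ℕ.≤⇒≤′ k≤j)

  left<left-suc : ∀ k → left (I k) < left (I (suc k))
  left<left-suc k = left<left-block (drop (suc k) a 0) (drop (suc k) a 1) (I k)
    (digit-positive 1≤a (suc k) 1)

  right-suc<right : ∀ k → right (I (suc k)) < right (I k)
  right-suc<right k = right-block<right (drop (suc k) a 0) (drop (suc k) a 1) (I k)
    (digit-positive 1≤a (suc k) 0)

  left≤right : ∀ J → left J ≤ right J
  left≤right J = ℚ.<⇒≤ (left<right J)

  -- A rational p equal to `x` would lie strictly inside every interval, strictness coming from the
  -- next one. At level `↧ₙ p` the left denominator alone exceeds that of p, against
  -- `interior-denominator`.
  encloses⇒irrational : Irrational x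
  encloses⇒irrational p x≃p = ℕ.<⇒≱ (suc≤ldn-interval 1≤a k)
    (ℕ.≤-trans (ℕ.m≤m+n (ldn (I k)) (rdn (I k))) (interior-denominator (I k) p
      (ℚ.<-≤-trans (left<left-suc k) (const-≲-cancel (≲-trans (proj₁ (enc (suc k))) (≃⇒≲ {x} {fromℚ p} x≃p))))
      (ℚ.≤-<-trans (const-≲-cancel (≲-trans (≃⇒≲ {fromℚ p} {x} (≃-sym {x} {fromℚ p} x≃p)) (proj₂ (enc (suc k)))))
        (right-suc<right k))))
    where k = ↧ₙ p

  left⇝x : (λ j _ → left (I j)) ⇝ seq x
  left⇝x = tends λ η 0<η → ev-map
    (λ j w<η → ev-zip
      (λ m l r →
          ≤-by (0≤+ (p≤q⇒0≤q-p l) (ℚ.<⇒≤ (half-< 0<η)))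
            (solve 3 (λ l x η → (x :+ η) :- l := ((x :+ con ½ :* η) :- l) :+ con ½ :* η) refl
              (left (I j)) (seq x m) η)
        , ≤-by (0≤+ (p≤q⇒0≤q-p r) (p≤q⇒0≤q-p (ℚ.<⇒≤ w<η)))
            (solve 4 (λ l r x η → (l :+ η) :- x :=
              ((r :+ con ½ :* η) :- x) :+ (con ½ :* η :- (r :- l))) refl
              (left (I j)) (right (I j)) (seq x m) η))
      (within (proj₁ (enc j)) (½ * η) (half-< 0<η)) (within (proj₂ (enc j)) (½ * η) (half-< 0<η)))
    (width-interval-small 1≤a (½ * η) (half-< 0<η))
    where open ℚ-Solver

  right⇝x : (λ j _ → right (I j)) ⇝ seq x
  right⇝x = tends λ η 0<η → ev-map
    (λ j w<η → ev-zip
      (λ m l r →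
          ≤-by (0≤+ (p≤q⇒0≤q-p l) (p≤q⇒0≤q-p (ℚ.<⇒≤ w<η)))
            (solve 4 (λ l r x η → (x :+ η) :- r :=
              ((x :+ con ½ :* η) :- l) :+ (con ½ :* η :- (r :- l))) refl
              (left (I j)) (right (I j)) (seq x m) η)
        , ≤-by (0≤+ (p≤q⇒0≤q-p r) (ℚ.<⇒≤ (half-< 0<η)))
            (solve 3 (λ r x η → (r :+ η) :- x := ((r :+ con ½ :* η) :- x) :+ con ½ :* η) refl
              (right (I j)) (seq x m) η))
      (within (proj₁ (enc j)) (½ * η) (half-< 0<η)) (within (proj₂ (enc j)) (½ * η) (half-< 0<η)))
    (width-interval-small 1≤a (½ * η) (half-< 0<η))
    where open ℚ-Solver

  -- The search goes outwards from depth `j + K`, where `z` is known to be outside. It is decidable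
  -- because `z` is rational, a single approximation of y.
  locate-right : ∀ j K z → right (I (j ℕ.+ K)) ≤ z → z < right (I K) →
    ∃[ k ] K ℕ.≤ k × k ℕ.< j ℕ.+ K × right (I (suc k)) ≤ z × z < right (I k)
  locate-right zero    K z r≤z z<r = ⊥-elim (ℚ.<-irrefl refl (ℚ.≤-<-trans r≤z z<r))
  locate-right (suc j) K z r≤z z<r = [ recurse , (λ z<rⱼ → j ℕ.+ K , ℕ.m≤n+m K j , ℕ.≤-refl , r≤z , z<rⱼ) ]′
    (≤-or-> (right (I (j ℕ.+ K))) z)
    where
    recurse : right (I (j ℕ.+ K)) ≤ z →
      ∃[ k ] K ℕ.≤ k × k ℕ.< suc j ℕ.+ K × right (I (suc k)) ≤ z × z < right (I k)
    recurse r≤z = let k , K≤k , k< , h = locate-right j K z r≤z z<r in k , K≤k , ℕ.m≤n⇒m≤1+n k< , h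

  locate-left : ∀ j K z → z ≤ left (I (j ℕ.+ K)) → left (I K) < z →
    ∃[ k ] K ℕ.≤ k × k ℕ.< j ℕ.+ K × z ≤ left (I (suc k)) × left (I k) < z
  locate-left zero    K z z≤l l<z = ⊥-elim (ℚ.<-irrefl refl (ℚ.<-≤-trans l<z z≤l))
  locate-left (suc j) K z z≤l l<z = [ recurse , (λ lⱼ<z → j ℕ.+ K , ℕ.m≤n+m K j , ℕ.≤-refl , z≤l , lⱼ<z) ]′
    (≤-or-> z (left (I (j ℕ.+ K))))
    where
    recurse : z ≤ left (I (j ℕ.+ K)) →
      ∃[ k ] K ℕ.≤ k × k ℕ.< suc j ℕ.+ K × z ≤ left (I (suc k)) × left (I k) < z
    recurse z≤l = let k , K≤k , k< , h = locate-left j K z z≤l l<z in k , K≤k , ℕ.m≤n⇒m≤1+n k< , h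

  left-rightGap : ∀ {k n} → suc k ℕ.< n → left (I n) ≤ left (rightGap a k)
  left-rightGap {k} {n} k<n = ℚ.≤-trans (left≤right (I n)) (ℚ.≤-trans (proj₂ (I-⊑ k<n))
    (right-block≤mid (drop (suc (suc k)) a 0) (drop (suc (suc k)) a 1) (I (suc k))
      (digit-positive 1≤a (suc (suc k)) 0)))

  right-leftGap : ∀ {k n} → suc k ℕ.< n → right (leftGap a k) ≤ right (I n)
  right-leftGap {k} {n} k<n = ℚ.≤-trans
    (mid-lcs≤left-block (drop (suc (suc k)) a 0) (drop (suc (suc k)) a 1) (I (suc k))
      (digit-positive 1≤a (suc (suc k)) 1))
    (ℚ.≤-trans (proj₁ (I-⊑ k<n)) (left≤right (I n)))

  left-leftGap : ∀ k → left (leftGap a k) ≡ left (I (suc k))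
  left-leftGap k = left-lcs (drop (suc (suc k)) a 0) (I (suc k))

  Spanning : (ℚ → ℚ → Set) → Farey → ℕ → Set
  Spanning Q J k = ∀ u v → left (I k) ≤ u → u ≤ left J → right J ≤ v → v ≤ right (I k) → Q u v

  -- The level at which `y n` leaves the intervals may vary with `n`, so the gap hypotheses cover
  -- every level from `K` on and no level is ever attached to the real y. The separation `d` only
  -- bounds the depth of the search: beyond level `N + K` the intervals are too narrow to reach y.
  module Secant (Q : ℚ → ℚ → Set) (K : ℕ)
    (right-gap : ∀ k → K ℕ.≤ k → Spanning Q (rightGap a k) k)
    (left-gap : ∀ k → K ℕ.≤ k → Spanning Q (leftGap a k) k)
    (y : ℕ → ℚ) (d : ℚ) (0<d : 0ℚ < d) where

    private
      tail = width-interval-small 1≤a (½ * d) (half-< 0<d)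
      N = proj₁ tail
      small : width (I (N ℕ.+ K)) ≤ ½ * d
      small = ℚ.<⇒≤ (proj₂ tail (N ℕ.+ K) (ℕ.m≤m+n N K))

    secant-right : Eventually (λ n → seq x n + d ≤ y n) → Eventually (λ n → y n < right (I K)) →
      Eventually (λ n → Q (left (I n)) (y n))
    secant-right x+d≤y y<r = ev-zip step
      -- The index bound is kept as a hypothesis: the level found satisfies k < N + K, and
      -- `left-rightGap` places `left (I n)` before the gap once k + 1 < n.
      (ev-zip (λ _ → _,_) (N ℕ.+ K ℕ.+ 1 , λ _ h → h) y<r)
      (ev-zip (λ _ → _,_) x+d≤y (within (proj₁ (enc (N ℕ.+ K))) (½ * d) (half-< 0<d)))
      where
      open ℚ-Solver
      step : ∀ n → N ℕ.+ K ℕ.+ 1 ℕ.≤ n × y n < right (I K) →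
        seq x n + d ≤ y n × left (I (N ℕ.+ K)) ≤ seq x n + ½ * d → Q (left (I n)) (y n)
      step n (N<n , y<r) (x+d≤y , l≤x) = right-gap k K≤k (left (I n)) (y n)
        (proj₁ (I-⊑ (ℕ.≤-trans (ℕ.n≤1+n k) (ℕ.<⇒≤ k+1<n)))) (left-rightGap k+1<n) r≤y (ℚ.<⇒≤ y<rₖ)
        where
        r≤yₙ : right (I (N ℕ.+ K)) ≤ y n
        r≤yₙ = ≤-by (0≤+ (p≤q⇒0≤q-p x+d≤y) (0≤+ (p≤q⇒0≤q-p l≤x) (p≤q⇒0≤q-p small)))
          (solve 5 (λ l r x y d → y :- r :=
            (y :- (x :+ d)) :+ (((x :+ con ½ :* d) :- l) :+ (con ½ :* d :- (r :- l))))
            refl (left (I (N ℕ.+ K))) (right (I (N ℕ.+ K))) (seq x n) (y n) d)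
        found = locate-right N K (y n) r≤yₙ y<r
        k = proj₁ found
        K≤k = proj₁ (proj₂ found)
        k+1<n : suc k ℕ.< n
        k+1<n = ℕ.≤-trans (ℕ.s≤s (proj₁ (proj₂ (proj₂ found)))) (subst (ℕ._≤ n) (ℕ.+-comm (N ℕ.+ K) 1) N<n)
        r≤y = proj₁ (proj₂ (proj₂ (proj₂ found)))
        y<rₖ = proj₂ (proj₂ (proj₂ (proj₂ found)))

    secant-left : Eventually (λ n → y n + d ≤ seq x n) → Eventually (λ n → left (I K) < y n) →
      Eventually (λ n → Q (y n) (right (I n)))
    secant-left y+d≤x l<y = ev-zip step
      (ev-zip (λ _ → _,_) (N ℕ.+ K ℕ.+ 1 , λ _ h → h) l<y)
      (ev-zip (λ _ → _,_) y+d≤x (within (proj₂ (enc (N ℕ.+ K))) (½ * d) (half-< 0<d)))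
      where
      open ℚ-Solver
      step : ∀ n → N ℕ.+ K ℕ.+ 1 ℕ.≤ n × left (I K) < y n →
        y n + d ≤ seq x n × seq x n ≤ right (I (N ℕ.+ K)) + ½ * d → Q (y n) (right (I n))
      step n (N<n , l<y) (y+d≤x , x≤r) = left-gap k K≤k (y n) (right (I n))
        (ℚ.<⇒≤ lₖ<y) (subst (y n ≤_) (sym (left-leftGap k)) y≤l) (right-leftGap k+1<n)
        (proj₂ (I-⊑ (ℕ.≤-trans (ℕ.n≤1+n k) (ℕ.<⇒≤ k+1<n))))
        where
        yₙ≤l : y n ≤ left (I (N ℕ.+ K))
        yₙ≤l = ≤-by (0≤+ (p≤q⇒0≤q-p y+d≤x) (0≤+ (p≤q⇒0≤q-p x≤r) (p≤q⇒0≤q-p small)))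
          (solve 5 (λ l r x y d → l :- y :=
            (x :- (y :+ d)) :+ (((r :+ con ½ :* d) :- x) :+ (con ½ :* d :- (r :- l))))
            refl (left (I (N ℕ.+ K))) (right (I (N ℕ.+ K))) (seq x n) (y n) d)
        found = locate-left N K (y n) yₙ≤l l<y
        k = proj₁ found
        K≤k = proj₁ (proj₂ found)
        k+1<n : suc k ℕ.< n
        k+1<n = ℕ.≤-trans (ℕ.s≤s (proj₁ (proj₂ (proj₂ found)))) (subst (ℕ._≤ n) (ℕ.+-comm (N ℕ.+ K) 1) N<n)
        y≤l = proj₁ (proj₂ (proj₂ (proj₂ found)))
        lₖ<y = proj₂ (proj₂ (proj₂ (proj₂ found)))

  -- The smaller distance from `I (suc K)`, which encloses `x`, to the endpoints of `I K`: a point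
  -- nearer to `x` than this stays inside `I K`.
  radius : ℕ → ℚ
  radius K = (left (I (suc K)) - left (I K)) ℚ.⊓ (right (I K) - right (I (suc K)))

  0<radius : ∀ K → 0ℚ < radius K
  0<radius K = [ (λ eq → subst (0ℚ <_) (sym eq) (p<q⇒0<q-p (left<left-suc K)))
               , (λ eq → subst (0ℚ <_) (sym eq) (p<q⇒0<q-p (right-suc<right K))) ]′
    (ℚ.⊓-sel (left (I (suc K)) - left (I K)) (right (I K) - right (I (suc K))))

  near⇒inside : ∀ K {y : ℝ} → ℝ.∣ y ℝ.- x ∣ ℝ.< fromℚ (radius K) →
    Eventually (λ n → left (I K) < seq y n × seq y n < right (I K))
  near⇒inside K {y} (e , 0<e , close) = ev-zip
    (λ { n c (l , r) → let p , q = y-near n c in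
        <-by (0<+ 0<η (0≤+ (p≤q⇒0≤q-p (ℚ.p⊓q≤p gapₗ gapᵣ)) (0≤+ (p≤q⇒0≤q-p l) (p≤q⇒0≤q-p q))))
          (solve 6 (λ l l′ x y ρ η → y :- l :=
            η :+ (((l′ :- l) :- ρ) :+ (((x :+ η) :- l′) :+ ((y :+ (ρ :- con 2ℚ :* η)) :- x))))
            refl (left (I K)) (left (I (suc K))) (seq x n) (seq y n) (radius K) η)
      , <-by (0<+ 0<η (0≤+ (p≤q⇒0≤q-p (ℚ.p⊓q≤q gapₗ gapᵣ)) (0≤+ (p≤q⇒0≤q-p r) (p≤q⇒0≤q-p p))))
          (solve 6 (λ r r′ x y ρ η → r :- y :=
            η :+ (((r :- r′) :- ρ) :+ (((r′ :+ η) :- x) :+ ((x :+ (ρ :- con 2ℚ :* η)) :- y))))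
            refl (right (I K)) (right (I (suc K))) (seq x n) (seq y n) (radius K) η) })
    close
    (ev-zip (λ _ → _,_) (within (proj₁ (enc (suc K))) η 0<η) (within (proj₂ (enc (suc K))) η 0<η))
    where
    open ℚ-Solver
    -- The margin e is 4 η: two parts remain as the positive slack demanded by `∣p-q∣+e≤ε⇒near`, one
    -- covers the error in enclosing `x`, and one makes the conclusion strict.
    η = + 1 / 4 * e
    0<η : 0ℚ < η
    0<η = 0<* (ℚ.positive⁻¹ (+ 1 / 4)) 0<e
    gapₗ = left (I (suc K)) - left (I K)
    gapᵣ = right (I K) - right (I (suc K))
    y-near : ∀ n → ∣ seq y n - seq x n ∣ + e ≤ radius K →
      seq y n ≤ seq x n + (radius K - 2ℚ * η) × seq x n ≤ seq y n + (radius K - 2ℚ * η)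
    y-near n c = ∣p-q∣+e≤ε⇒near {seq y n} {seq x n} {½ * e} (half-< 0<e)
      (≤-by (p≤q⇒0≤q-p c) (solve 3 (λ t ρ e →
          (ρ :- con 2ℚ :* (con (+ 1 / 4) :* e)) :- (t :+ con ½ :* e) := ρ :- (t :+ e)) refl
        (∣ seq y n - seq x n ∣) (radius K) e))

-- From secant inequalities to difference quotients

quotient-≥ : ∀ {c Δ D} → D ≢ 0ℚ → c * (D * D) ≤ Δ * D → c ≤ Δ * recip D
-- The hypothesis is multiplied by the square of `recip D`, which is nonnegative for either sign of
-- `D`.
quotient-≥ {c} {Δ} {D} D≢0 h = subst₂ _≤_
  (cancel c) (trans (solve 3 (λ Δ D r → Δ :* D :* (r :* r) := Δ :* r :* (D :* r)) refl Δ D (recip D))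
    (trans (cong (Δ * recip D *_) (recip-inverseʳ D D≢0)) (ℚ.*-identityʳ (Δ * recip D))))
  (*-monoʳ-≤ (0≤p*p (recip D)) h)
  where
  open ℚ-Solver
  0≤p*p : ∀ p → 0ℚ ≤ p * p
  0≤p*p p = [ (λ 0≤p → 0≤* 0≤p 0≤p)
            , (λ p≤0 → subst (0ℚ ≤_) (solve 1 (λ p → (:- p) :* (:- p) := p :* p) refl p)
                (0≤* (ℚ.neg-antimono-≤ p≤0) (ℚ.neg-antimono-≤ p≤0))) ]′ (ℚ.≤-total 0ℚ p)
  cancel : ∀ c → c * (D * D) * (recip D * recip D) ≡ c
  cancel c = trans (solve 3 (λ c D r → c :* (D :* D) :* (r :* r) := c :* ((D :* r) :* (D :* r))) refl c D (recip D))
    (trans (cong (λ t → c * (t * t)) (recip-inverseʳ D D≢0)) (ℚ.*-identityʳ c))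

quotient-≤ : ∀ {c Δ D} → D ≢ 0ℚ → Δ * D ≤ c * (D * D) → Δ * recip D ≤ c
quotient-≤ {c} {Δ} {D} D≢0 h = ≤-by
  (p≤q⇒0≤q-p (quotient-≥ {c = - c} {Δ = - Δ} D≢0 (≤-by (p≤q⇒0≤q-p h)
    (solve 3 (λ c Δ D → (:- Δ) :* D :- (:- c) :* (D :* D) := c :* (D :* D) :- Δ :* D) refl c Δ D))))
  (solve 3 (λ c Δ r → c :- Δ :* r := (:- Δ) :* r :- (:- c)) refl c Δ (recip D))
  where open ℚ-Solver

-- (D′, Δ′) is (D, Δ) or (- D, - Δ), whichever makes the first component positive.
record Oriented (D Δ D′ Δ′ d : ℚ) : Set where
  field
    0<d   : 0ℚ < d
    d≤D′  : d ≤ D′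
    D*D   : D * D ≡ D′ * D′
    Δ*D   : Δ * D ≡ Δ′ * D′

  0≤D′ : 0ℚ ≤ D′
  0≤D′ = ℚ.≤-trans (ℚ.<⇒≤ 0<d) d≤D′

  D≢0 : D ≢ 0ℚ
  D≢0 refl = ℚ.<-irrefl (trans (sym (ℚ.*-zeroˡ 0ℚ)) D*D) (0<* 0<D′ 0<D′)
    where 0<D′ = ℚ.<-≤-trans 0<d d≤D′

oriented⁺ : ∀ {x y gx gy d} → 0ℚ < d → x + d ≤ y →
  Oriented (y - x) (gy - gx) (y - x) (gy - gx) d
oriented⁺ {x} {y} {d = d} 0<d h = record
  { 0<d = 0<d
  ; d≤D′ = ≤-by (p≤q⇒0≤q-p h) (solve 3 (λ x y d → (y :- x) :- d := y :- (x :+ d)) refl x y d)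
  ; D*D = refl
  ; Δ*D = refl
  }
  where open ℚ-Solver

oriented⁻ : ∀ {x y gx gy d} → 0ℚ < d → y + d ≤ x →
  Oriented (y - x) (gy - gx) (x - y) (gx - gy) d
oriented⁻ {x} {y} {gx} {gy} {d} 0<d h = record
  { 0<d = 0<d
  ; d≤D′ = ≤-by (p≤q⇒0≤q-p h) (solve 3 (λ x y d → (x :- y) :- d := x :- (y :+ d)) refl x y d)
  ; D*D = solve 2 (λ x y → (y :- x) :* (y :- x) := (x :- y) :* (x :- y)) refl x y
  ; Δ*D = solve 4 (λ x y u v → (v :- u) :* (y :- x) := (u :- v) :* (x :- y)) refl x y gx gy
  }
  where open ℚ-Solver

-- The limit inequality is available up to any fixed positive error. An error of d/2, divided by a
-- distance of at least `d`, costs only 1/2 in the slope. In `flat-quotient` the error e d likewise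
-- costs `e`.
steep-quotient : ∀ {D Δ D′ Δ′ d} α → Oriented D Δ D′ Δ′ d → α * D′ ≤ 1ℚ * Δ′ + ½ * d → α - ½ ≤ Δ * recip D
steep-quotient {D} {Δ} {D′} {Δ′} {d} α o h = quotient-≥ {Δ = Δ} D≢0
  (subst₂ (λ s t → (α - ½) * s ≤ t) (sym D*D) (sym Δ*D)
    (≤-by (0≤+ (0≤* 0≤D′ (p≤q⇒0≤q-p h)) (0≤* (0≤* (nonneg ½) 0≤D′) (p≤q⇒0≤q-p d≤D′)))
      (solve 4 (λ α D Δ d → Δ :* D :- (α :- con ½) :* (D :* D) :=
        D :* ((con 1ℚ :* Δ :+ con ½ :* d) :- α :* D) :+ con ½ :* D :* (D :- d)) refl α D′ Δ′ d)))
  where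
  open ℚ-Solver
  open Oriented o

flat-quotient : ∀ {D Δ D′ Δ′ d e} → 0ℚ ≤ e → Oriented D Δ D′ Δ′ d →
  1ℚ * Δ′ ≤ e * D′ + e * d → 0ℚ * D′ ≤ 1ℚ * Δ′ + e * d → ∣ Δ * recip D - 0ℚ ∣ ≤ 2ℚ * e
flat-quotient {D} {Δ} {D′} {Δ′} {d} {e} 0≤e o h k = near⇒∣p-q∣≤ε {Δ * recip D} {0ℚ}
  (subst (Δ * recip D ≤_) (sym (ℚ.+-identityˡ (2ℚ * e))) (quotient-≤ {Δ = Δ} D≢0
    (subst₂ (λ s t → t ≤ 2ℚ * e * s) (sym D*D) (sym Δ*D)
      (≤-by (0≤+ (0≤* 0≤D′ (p≤q⇒0≤q-p h)) (0≤* (0≤* 0≤e 0≤D′) (p≤q⇒0≤q-p d≤D′)))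
        (solve 4 (λ e D Δ d → con 2ℚ :* e :* (D :* D) :- Δ :* D :=
          D :* ((e :* D :+ e :* d) :- con 1ℚ :* Δ) :+ e :* D :* (D :- d)) refl e D′ Δ′ d)))))
  (≤-by (p≤q⇒0≤q-p (quotient-≥ {c = - (2ℚ * e)} {Δ = Δ} D≢0
      (subst₂ (λ s t → - (2ℚ * e) * s ≤ t) (sym D*D) (sym Δ*D)
        (≤-by (0≤+ (0≤* 0≤D′ (p≤q⇒0≤q-p k))
            (0≤+ (0≤* (0≤* 0≤e 0≤D′) (p≤q⇒0≤q-p d≤D′)) (0≤* 0≤e (0≤* 0≤D′ 0≤D′))))
          (solve 4 (λ e D Δ d → Δ :* D :- (:- (con 2ℚ :* e)) :* (D :* D) :=
            D :* ((con 1ℚ :* Δ :+ e :* d) :- con 0ℚ :* D) :+ (e :* D :* (D :- d) :+ e :* (D :* D)))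
            refl e D′ Δ′ d)))))
    (solve 2 (λ t e → (t :+ con 2ℚ :* e) :- con 0ℚ := t :- (:- (con 2ℚ :* e))) refl (Δ * recip D) e))
  where
  open ℚ-Solver
  open Oriented o

fromℚ∈[0,1] : ∀ {p} → 0ℚ ≤ p → p ≤ 1ℚ → fromℚ p ∈[0,1]
fromℚ∈[0,1] {p} 0≤p p≤1 = not< 0≤p , not< p≤1
  where
  not< : ∀ {p q} → p ≤ q → ¬ (fromℚ q ℝ.< fromℚ p)
  not< {p} {q} p≤q (e , 0<e , N , h) = ℚ.<-irrefl refl
    (ℚ.<-≤-trans (<-by 0<e (solve 2 (λ q e → (q :+ e) :- q := e) refl q e)) (ℚ.≤-trans (h N ℕ.≤-refl) p≤q))
    where open ℚ-Solver

seq⇝ : (y : ℝ) → (λ j _ → seq y j) ⇝ seq y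
seq⇝ y = tends λ η 0<η → proj₁ (cauchy y η 0<η) , λ j N≤j → proj₁ (cauchy y η 0<η) , λ m N≤m →
    bound η j m (proj₂ (cauchy y η 0<η) j m N≤j N≤m) , bound η m j (proj₂ (cauchy y η 0<η) m j N≤m N≤j)
  where
  open ℚ-Solver
  bound : ∀ η j m → ∣ seq y j - seq y m ∣ < η → seq y j ≤ seq y m + η
  bound η j m h = ≤-by (p≤q⇒0≤q-p (ℚ.<⇒≤ (∣p∣<⇒< h)))
    (solve 3 (λ p q η → (q :+ η) :- p := η :- (p :- q)) refl (seq y j) (seq y m) η)

≲-minus : ∀ {u v u′ v′} → u ≲ u′ → v′ ≲ v → (λ n → v′ n - u′ n) ≲ (λ n → v n - u n)
≲-minus {u} {v} {u′} {v′} h k = approx λ ε 0<ε → ev-zip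
  (λ n p q → ≤-by (0≤+ (p≤q⇒0≤q-p p) (p≤q⇒0≤q-p q))
    (solve 5 (λ u v u′ v′ ε → ((v :- u) :+ ε) :- (v′ :- u′) :=
      ((u′ :+ con ½ :* ε) :- u) :+ ((v :+ con ½ :* ε) :- v′)) refl (u n) (v n) (u′ n) (v′ n) ε))
  (within h _ (half-< 0<ε)) (within k _ (half-< 0<ε))
  where open ℚ-Solver

-- The real number [0; 1, 3, 1, 3, ...]

module AlternatingPoint where

  bounds = convergent-bounds 1≤alternating

  ∣c-c∣≤width : ∀ k m n → 2 ℕ.+ (k ℕ.+ k) ℕ.≤ m → 2 ℕ.+ (k ℕ.+ k) ℕ.≤ n →
    ∣ convergent alternating m - convergent alternating n ∣ ≤ width (interval alternating k)
  ∣c-c∣≤width k m n k≤m k≤n = near⇒∣p-q∣≤ε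
      (near (proj₁ (bounds k n k≤n)) (proj₂ (bounds k m k≤m)))
      (near (proj₁ (bounds k m k≤m)) (proj₂ (bounds k n k≤n)))
    where
    open ℚ-Solver
    near : ∀ {p q l r} → l ≤ q → p ≤ r → p ≤ q + (r - l)
    near {p} {q} {l} {r} l≤q p≤r = ≤-by (0≤+ (p≤q⇒0≤q-p l≤q) (p≤q⇒0≤q-p p≤r))
      (solve 4 (λ p q l r → (q :+ (r :- l)) :- p := (q :- l) :+ (r :- p)) refl p q l r)

  point : ℝ
  point = mkℝ (convergent alternating) λ ε 0<ε →
    let k , w<ε = ev-witness (width-interval-small 1≤alternating ε 0<ε) in
    2 ℕ.+ (k ℕ.+ k) , λ m n k≤m k≤n → ℚ.≤-<-trans (∣c-c∣≤width k m n k≤m k≤n) w<ε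

  isContinuedFraction : IsContinuedFraction alternating point
  isContinuedFraction = record
    { positive = 1≤alternating
    ; converges = λ { ε (r , 0<r , M , r≤ε) →
        let N , close = cauchy point (½ * r) (half-< 0<r) in
        N , λ n N≤n → ½ * r , half-< 0<r , N ℕ.⊔ M , λ m le →
          ≤-by (0≤+ (p≤q⇒0≤q-p (ℚ.<⇒≤ (close n m N≤n (ℕ.≤-trans (ℕ.m≤m⊔n N M) le))))
              (p≤q⇒0≤q-p (r≤ε m (ℕ.≤-trans (ℕ.m≤n⊔m N M) le))))
            (solve 3 (λ t r ε → ε :- (t :+ con ½ :* r) := (con ½ :* r :- t) :+ (ε :- (con 0ℚ :+ r))) refl
              ∣ convergent alternating n - convergent alternating m ∣ r (seq ε m)) }
    }
    where open ℚ-Solver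

  point∈[0,1] : point ∈[0,1]
  point∈[0,1] =
      (λ { (e , 0<e , N , h) → contra (0≤convergent 1≤alternating N) 0<e (h N ℕ.≤-refl) })
    , (λ { (e , 0<e , N , h) → contra (ℚ.≤-trans (proj₂ (bounds 0 (2 ℕ.+ N) (ℕ.m≤m+n 2 N)))
          (right≤1 (interval alternating 0))) 0<e (h (2 ℕ.+ N) (ℕ.m≤n+m N 2)) })
    where
    open ℚ-Solver
    contra : ∀ {p q e} {A : Set} → p ≤ q → 0ℚ < e → q + e ≤ p → A
    contra {p} {q} {e} p≤q 0<e h = ⊥-elim (ℚ.<-irrefl refl
      (ℚ.<-≤-trans (<-by 0<e (solve 2 (λ q e → (q :+ e) :- q := e) refl q e)) (ℚ.≤-trans h p≤q)))

-- Secants of g and the two derivatives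

module Derivatives (g : ℝ → ℝ) (dtu : IsDenjoyTichyUitz φ⁻¹ g) where

  open DTU g dtu
  open IsDenjoyTichyUitz dtu

  rise-lcs-lower : ∀ n I {w} → 0ℚ ≤ w → const w ≲ rise I → const (scale (+ 3 / 5) n w) ≲ rise (lcs n I)
  rise-lcs-lower zero    I 0≤w h = h
  rise-lcs-lower (suc n) I 0≤w h =
    rise-lcs-lower n (lc I) (0≤* (nonneg (+ 3 / 5)) 0≤w) (rise-lc-lower I 0≤w h)

  rise-rcs-lower : ∀ n I {w} → 0ℚ ≤ w → const w ≲ rise I → const (scale (+ 3 / 8) n w) ≲ rise (rcs n I)
  rise-rcs-lower zero    I 0≤w h = h
  rise-rcs-lower (suc n) I 0≤w h =
    rise-rcs-lower n (rc I) (0≤* (nonneg (+ 3 / 8)) 0≤w) (rise-rc-lower I 0≤w h)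

  rise-lcs-upper : ∀ n I {w} → 0ℚ ≤ w → rise I ≲ const w → rise (lcs n I) ≲ const (scale (+ 5 / 8) n w)
  rise-lcs-upper zero    I 0≤w h = h
  rise-lcs-upper (suc n) I 0≤w h =
    rise-lcs-upper n (lc I) (0≤* (nonneg (+ 5 / 8)) 0≤w) (rise-lc-upper I 0≤w h)

  rise-rcs-upper : ∀ n I {w} → 0ℚ ≤ w → rise I ≲ const w → rise (rcs n I) ≲ const (scale (+ 2 / 5) n w)
  rise-rcs-upper zero    I 0≤w h = h
  rise-rcs-upper (suc n) I 0≤w h =
    rise-rcs-upper n (rc I) (0≤* (nonneg (+ 2 / 5)) 0≤w) (rise-rc-upper I 0≤w h)

  rise-block-lower : ∀ a b I {w} → 0ℚ ≤ w → const w ≲ rise I →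
    const (scale (+ 3 / 8) b (scale (+ 3 / 5) a w)) ≲ rise (block a b I)
  rise-block-lower a b I 0≤w h =
    rise-rcs-lower b (lcs a I) (0≤scale (nonneg (+ 3 / 5)) a 0≤w) (rise-lcs-lower a I 0≤w h)

  rise-block-upper : ∀ a b I {w} → 0ℚ ≤ w → rise I ≲ const w →
    rise (block a b I) ≲ const (scale (+ 2 / 5) b (scale (+ 5 / 8) a w))
  rise-block-upper a b I 0≤w h =
    rise-rcs-upper b (lcs a I) (0≤scale (nonneg (+ 5 / 8)) a 0≤w) (rise-lcs-upper a I 0≤w h)

  rise-interval-lower : ∀ a k → const (weight (+ 3 / 5) (+ 3 / 8) a k) ≲ rise (interval a k)
  rise-interval-lower a zero    = rise-block-lower (ℕ.pred (a 0)) (a 1) unit (ℚ.<⇒≤ 0<1) rise-unit-lower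
  rise-interval-lower a (suc k) = rise-block-lower (drop (suc k) a 0) (drop (suc k) a 1) (interval a k)
    (ℚ.<⇒≤ (0<weight (ℚ.positive⁻¹ (+ 3 / 5)) (ℚ.positive⁻¹ (+ 3 / 8)) a k)) (rise-interval-lower a k)

  rise-interval-upper : ∀ a k → rise (interval a k) ≲ const (weight (+ 5 / 8) (+ 2 / 5) a k)
  rise-interval-upper a zero    = rise-block-upper (ℕ.pred (a 0)) (a 1) unit (ℚ.<⇒≤ 0<1) rise-unit-upper
  rise-interval-upper a (suc k) = rise-block-upper (drop (suc k) a 0) (drop (suc k) a 1) (interval a k)
    (ℚ.<⇒≤ (0<weight (ℚ.positive⁻¹ (+ 5 / 8)) (ℚ.positive⁻¹ (+ 2 / 5)) a k)) (rise-interval-upper a k)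

  G-diff : ℚ → ℚ → ℕ → ℚ
  G-diff u v n = G v n - G u n

  1*-shift : ∀ {f : ℕ → ℚ} → f ≲ (λ n → 1ℚ * f n) × (λ n → 1ℚ * f n) ≲ f
  1*-shift {f} = ev≤⇒≲ (always λ n → ℚ.≤-reflexive (sym (ℚ.*-identityˡ (f n))))
    , ev≤⇒≲ (always λ n → ℚ.≤-reflexive (ℚ.*-identityˡ (f n)))

  rise≲G-diff : ∀ I J {u v} → left I ≤ u → u ≤ left J → right J ≤ v → v ≤ right I → rise J ≲ G-diff u v
  rise≲G-diff I J l≤u u≤J J≤v v≤r = ≲-minus
    (G-monotone (ℚ.≤-trans (0≤left I) l≤u) u≤J (ℚ.≤-trans (ℚ.<⇒≤ (left<right J)) (right≤1 J)))
    (G-monotone (ℚ.≤-trans (0≤left J) (ℚ.<⇒≤ (left<right J))) J≤v (ℚ.≤-trans v≤r (right≤1 I)))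

  G-diff≲rise : ∀ I {u v} → left I ≤ u → u ≤ 1ℚ → 0ℚ ≤ v → v ≤ right I → G-diff u v ≲ rise I
  G-diff≲rise I l≤u u≤1 0≤v v≤r = ≲-minus (G-monotone (0≤left I) l≤u u≤1) (G-monotone 0≤v v≤r (right≤1 I))

  -- The factors `1ℚ` bring both relations to the shape of `limit-≲`, which then serves for either
  -- by exchanging the roles of the increments of the argument and of `g`.
  SteepSecant FlatSecant : ℚ → ℚ → ℚ → Set
  SteepSecant α u v = (λ _ → α * (v - u)) ≲ (λ n → 1ℚ * G-diff u v n)
  FlatSecant e u v = (λ n → 1ℚ * G-diff u v n) ≲ (λ _ → e * (v - u))

  -- J lies in [u, v] and [u, v] lies in I, so the increment is at least that over J while v - u is
  -- at most the width of I.
  steep-secant : ∀ I J {α w u v} → 0ℚ ≤ α → α * width I ≤ w → const w ≲ rise J →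
    left I ≤ u → u ≤ left J → right J ≤ v → v ≤ right I → SteepSecant α u v
  steep-secant I J {α} {w} {u} {v} 0≤α α*width≤w w≲ l≤u u≤J J≤v v≤r =
    ≲-trans (ev≤⇒≲ (always λ _ → ℚ.≤-trans
        (≤-by (0≤* 0≤α (0≤+ (p≤q⇒0≤q-p l≤u) (p≤q⇒0≤q-p v≤r)))
          (solve 5 (λ α l r u v → α :* (r :- l) :- α :* (v :- u) := α :* ((u :- l) :+ (r :- v))) refl
            α (left I) (right I) u v))
        α*width≤w))
      (≲-trans w≲ (≲-trans (rise≲G-diff I J l≤u u≤J J≤v v≤r) (proj₁ 1*-shift)))
    where open ℚ-Solver

  -- Here the increment is at most that over I while v - u is at least the width of J.
  flat-secant : ∀ I J {e w u v} → 0ℚ ≤ e → w ≤ e * width J → rise I ≲ const w →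
    left I ≤ u → u ≤ left J → right J ≤ v → v ≤ right I → FlatSecant e u v
  flat-secant I J {e} {w} {u} {v} 0≤e w≤ ≲w l≤u u≤J J≤v v≤r =
    ≲-trans (proj₂ 1*-shift) (≲-trans
      (G-diff≲rise I l≤u (ℚ.≤-trans u≤J (ℚ.≤-trans (ℚ.<⇒≤ (left<right J)) (right≤1 J)))
        (ℚ.≤-trans (0≤left J) (ℚ.≤-trans (ℚ.<⇒≤ (left<right J)) J≤v)) v≤r)
      (≲-trans ≲w (ev≤⇒≲ (always λ _ → ℚ.≤-trans w≤
        (≤-by (0≤* 0≤e (0≤+ (p≤q⇒0≤q-p u≤J) (p≤q⇒0≤q-p J≤v)))
          (solve 5 (λ e l r u v → e :* (v :- u) :- e :* (r :- l) := e :* ((l :- u) :+ (v :- r))) refl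
            e (left J) (right J) u v))))))
    where open ℚ-Solver

  -- The secant bound with slope 0. It supplies the lower half of the estimate for the absolute
  -- value of the slope at the flat point.
  increasing-secant : ∀ I J {u v} → Increasing J → left I ≤ u → u ≤ left J → right J ≤ v → v ≤ right I →
    SteepSecant 0ℚ u v
  increasing-secant I J {u} {v} inc l≤u u≤J J≤v v≤r =
    ≲-trans (ev≤⇒≲ (always λ _ → ℚ.≤-reflexive (ℚ.*-zeroˡ (v - u))))
      (≲-trans inc (≲-trans (rise≲G-diff I J l≤u u≤J J≤v v≤r) (proj₁ 1*-shift)))

  rise-rightGap-lower : ∀ a k →
    const (+ 3 / 8 * weight (+ 3 / 5) (+ 3 / 8) a (suc k)) ≲ rise (rightGap a k)
  rise-rightGap-lower a k = rise-rc-lower (interval a (suc k))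
    (ℚ.<⇒≤ (0<weight (ℚ.positive⁻¹ (+ 3 / 5)) (ℚ.positive⁻¹ (+ 3 / 8)) a (suc k)))
    (rise-interval-lower a (suc k))

  rise-leftGap-lower : ∀ a k →
    const (+ 3 / 5 * scale (+ 3 / 5) (drop (suc (suc k)) a 0) (weight (+ 3 / 5) (+ 3 / 8) a (suc k)))
      ≲ rise (leftGap a k)
  rise-leftGap-lower a k = rise-lc-lower (lcs n (interval a (suc k))) (0≤scale (nonneg (+ 3 / 5)) n 0≤w)
      (rise-lcs-lower n (interval a (suc k)) 0≤w (rise-interval-lower a (suc k)))
    where
    n = drop (suc (suc k)) a 0
    0≤w = ℚ.<⇒≤ (0<weight (ℚ.positive⁻¹ (+ 3 / 5)) (ℚ.positive⁻¹ (+ 3 / 8)) a (suc k))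

  -- The only passage from rational arguments to real ones: continuity at `x` is tested at the reals
  -- `fromℚ (u j)`. It is applied to endpoints of the intervals and to the rational approximations
  -- of y.
  G⇝ : ∀ {x} → x ∈[0,1] → (u : ℕ → ℚ) → Eventually (λ j → 0ℚ ≤ u j × u j ≤ 1ℚ) →
    (λ j _ → u j) ⇝ seq x → (λ j → G (u j)) ⇝ seq (g x)
  G⇝ {x} x∈ u u∈ u⇝x = tends λ η 0<η → close η (continuous x x∈ (fromℚ η) (0ℝ<fromℚ 0<η))
    where
    open ℚ-Solver
    close : ∀ η → ∃[ δ ] 0ℝ ℝ.< δ × (∀ y → y ∈[0,1] → ℝ.∣ y ℝ.- x ∣ ℝ.< δ → ℝ.∣ g y ℝ.- g x ∣ ℝ.< fromℚ η) →
      Eventually (λ j → Eventually (λ m → G (u j) m ≤ seq (g x) m + η × seq (g x) m ≤ G (u j) m + η))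
    close η (δ , (r , 0<r , r≤δ) , h) = ev-zip
      (λ { j (0≤u , u≤1) near → conclude j (h (fromℚ (u j)) (fromℚ∈[0,1] 0≤u u≤1)
        (½ * r , half-< 0<r , ev-zip
          (λ m r≤ n → ≤-by (0≤+ (p≤q⇒0≤q-p r≤) (p≤q⇒0≤q-p (near⇒∣p-q∣≤ε (proj₁ n) (proj₂ n))))
            (solve 3 (λ t r δ → δ :- (t :+ con ½ :* r) := (δ :- (con 0ℚ :+ r)) :+ (con ½ :* r :- t)) refl
              (∣ u j - seq x m ∣) r (seq δ m)))
          r≤δ near)) })
      u∈ (within-η u⇝x (½ * r) (half-< 0<r))
      where
      conclude : ∀ j → ℝ.∣ g (fromℚ (u j)) ℝ.- g x ∣ ℝ.< fromℚ η →
        Eventually (λ m → G (u j) m ≤ seq (g x) m + η × seq (g x) m ≤ G (u j) m + η)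
      conclude j (e , 0<e , N , k) = N , λ m N≤m → ∣p-q∣+e≤ε⇒near 0<e (k m N≤m)

  module Limits {a : ℕ → ℕ} (1≤a : ∀ i → 1 ℕ.≤ a i) {x : ℝ} (enc : Encloses a x) (x∈ : x ∈[0,1]) where

    open Location {a} 1≤a {x} enc

    left∈ : Eventually (λ j → 0ℚ ≤ left (I j) × left (I j) ≤ 1ℚ)
    left∈ = 0 , λ j _ → 0≤left (I j) , left≤1 (I j)

    right∈ : Eventually (λ j → 0ℚ ≤ right (I j) × right (I j) ≤ 1ℚ)
    right∈ = 0 , λ j _ → 0≤right (I j) , right≤1 (I j)

    Inside : ℕ → ℝ → Set
    Inside K y = Eventually (λ n → left (I K) < seq y n × seq y n < right (I K))

    -- Membership of `y` in [0, 1] does not confine its individual approximations, which could stray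
    -- outside where `G` is not known to be monotone; lying strictly inside `I K` does.
    inside⇒∈ : ∀ K y → Inside K y → Eventually (λ j → 0ℚ ≤ seq y j × seq y j ≤ 1ℚ)
    inside⇒∈ K y (N , h) = N , λ j N≤j →
      ℚ.≤-trans (0≤left (I K)) (ℚ.<⇒≤ (proj₁ (h j N≤j))) ,
      ℚ.≤-trans (ℚ.<⇒≤ (proj₂ (h j N≤j))) (right≤1 (I K))

    steep-limit⁺ : ∀ {α y} → 0ℚ ≤ α → y ∈[0,1] → Eventually (λ j → 0ℚ ≤ seq y j × seq y j ≤ 1ℚ) →
      Eventually (λ j → SteepSecant α (left (I j)) (seq y j)) →
      (λ m → α * (seq y m - seq x m)) ≲ (λ m → 1ℚ * (seq (g y) m - seq (g x) m))
    steep-limit⁺ {y = y} 0≤α y∈ yⱼ∈ = limit-≲ 0≤α (nonneg 1ℚ) left⇝x (seq⇝ y)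
      (G⇝ x∈ (λ j → left (I j)) left∈ left⇝x) (G⇝ y∈ (seq y) yⱼ∈ (seq⇝ y))

    steep-limit⁻ : ∀ {α y} → 0ℚ ≤ α → y ∈[0,1] → Eventually (λ j → 0ℚ ≤ seq y j × seq y j ≤ 1ℚ) →
      Eventually (λ j → SteepSecant α (seq y j) (right (I j))) →
      (λ m → α * (seq x m - seq y m)) ≲ (λ m → 1ℚ * (seq (g x) m - seq (g y) m))
    steep-limit⁻ {y = y} 0≤α y∈ yⱼ∈ = limit-≲ 0≤α (nonneg 1ℚ) (seq⇝ y) right⇝x
      (G⇝ y∈ (seq y) yⱼ∈ (seq⇝ y)) (G⇝ x∈ (λ j → right (I j)) right∈ right⇝x)

    flat-limit⁺ : ∀ {e y} → 0ℚ ≤ e → y ∈[0,1] → Eventually (λ j → 0ℚ ≤ seq y j × seq y j ≤ 1ℚ) →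
      Eventually (λ j → FlatSecant e (left (I j)) (seq y j)) →
      (λ m → 1ℚ * (seq (g y) m - seq (g x) m)) ≲ (λ m → e * (seq y m - seq x m))
    flat-limit⁺ {y = y} 0≤e y∈ yⱼ∈ = limit-≲ (nonneg 1ℚ) 0≤e
      (G⇝ x∈ (λ j → left (I j)) left∈ left⇝x) (G⇝ y∈ (seq y) yⱼ∈ (seq⇝ y)) left⇝x (seq⇝ y)

    flat-limit⁻ : ∀ {e y} → 0ℚ ≤ e → y ∈[0,1] → Eventually (λ j → 0ℚ ≤ seq y j × seq y j ≤ 1ℚ) →
      Eventually (λ j → FlatSecant e (seq y j) (right (I j))) →
      (λ m → 1ℚ * (seq (g x) m - seq (g y) m)) ≲ (λ m → e * (seq x m - seq y m))
    flat-limit⁻ {y = y} 0≤e y∈ yⱼ∈ = limit-≲ (nonneg 1ℚ) 0≤e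
      (G⇝ y∈ (seq y) yⱼ∈ (seq⇝ y)) (G⇝ x∈ (λ j → right (I j)) right∈ right⇝x) (seq⇝ y) right⇝x

    module _ (a≤2 : ∀ i → a i ℕ.≤ 2) where

      open Steep {a} 1≤a a≤2

      steep-derivative : HasDerivative+∞At g x
      steep-derivative M = fromℚ (radius K) , 0ℝ<fromℚ (0<radius K) , λ y y∈ y#x y-near →
        [ below y y∈ y#x (near⇒inside K {y} y-near) , above y y∈ y#x (near⇒inside K {y} y-near) ]′ y#x
        where
        B = proj₁ (bounded M)
        -- `B` bounds M; of the extra 1, one half is lost in `steep-quotient` and the other half is
        -- the gap demanded by the strict order of reals.
        α = B + 1ℚ
        0≤α : 0ℚ ≤ α
        0≤α = 0≤+ (ℚ.<⇒≤ (proj₁ (proj₂ (bounded M)))) (nonneg 1ℚ)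
        K = proj₁ (width-negligible α)
        narrow : ∀ k → K ℕ.≤ k → α * width (I k) ≤ + 1 / 100 * w k
        narrow = proj₂ (width-negligible α)
        right-gap : ∀ k → K ℕ.≤ k → Spanning (SteepSecant α) (rightGap a k) k
        right-gap k K≤k u v = steep-secant (I k) (rightGap a k) 0≤α
          (ℚ.≤-trans (narrow k K≤k) (rightGap-weight k)) (rise-rightGap-lower a k)
        left-gap : ∀ k → K ℕ.≤ k → Spanning (SteepSecant α) (leftGap a k) k
        left-gap k K≤k u v = steep-secant (I k) (leftGap a k) 0≤α
          (ℚ.≤-trans (narrow k K≤k) (leftGap-weight k)) (rise-leftGap-lower a k)
        M+½≤ : Eventually (λ m → seq M m + ½ ≤ α - ½)
        M+½≤ = ev-map
          (λ m h → ≤-by (p≤q⇒0≤q-p (ℚ.≤-trans (p≤∣p∣ (seq M m)) h))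
            (solve 2 (λ M B → ((B :+ con 1ℚ) :- con ½) :- (M :+ con ½) := B :- M) refl (seq M m) B))
          (proj₂ (proj₂ (bounded M)))
          where open ℚ-Solver
        above : ∀ y → y ∈[0,1] → (y#x : (y ℝ.- x) # 0ℝ) → Inside K y → 0ℝ ℝ.< y ℝ.- x → M ℝ.< slope g x y y#x
        above y y∈ y#x inside (d , 0<d , d≤) = ½ , ℚ.positive⁻¹ ½ , ev-zip
            (λ { m M≤ (x+d≤y , s) → ℚ.≤-trans M≤ (steep-quotient α
              (oriented⁺ {gx = seq (g x) m} {seq (g y) m} 0<d x+d≤y) s) })
            M+½≤ (ev-zip (λ _ → _,_) x+d≤y
              (within (steep-limit⁺ {y = y} 0≤α y∈ (inside⇒∈ K y inside) secants) (½ * d) (half-< 0<d)))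
          where
          open ℚ-Solver
          x+d≤y : Eventually (λ n → seq x n + d ≤ seq y n)
          x+d≤y = ev-map (λ n h → ≤-by (p≤q⇒0≤q-p h)
            (solve 3 (λ x y d → y :- (x :+ d) := (y :+ :- x) :- (con 0ℚ :+ d)) refl (seq x n) (seq y n) d)) d≤
          secants : Eventually (λ n → SteepSecant α (left (I n)) (seq y n))
          secants = Secant.secant-right (SteepSecant α) K right-gap left-gap (seq y) d 0<d x+d≤y
            (ev-map (λ n → proj₂) inside)
        below : ∀ y → y ∈[0,1] → (y#x : (y ℝ.- x) # 0ℝ) → Inside K y → y ℝ.- x ℝ.< 0ℝ → M ℝ.< slope g x y y#x
        below y y∈ y#x inside (d , 0<d , d≤) = ½ , ℚ.positive⁻¹ ½ , ev-zip
            (λ { m M≤ (y+d≤x , s) → ℚ.≤-trans M≤ (steep-quotient α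
              (oriented⁻ {gx = seq (g x) m} {seq (g y) m} 0<d y+d≤x) s) })
            M+½≤ (ev-zip (λ _ → _,_) y+d≤x
              (within (steep-limit⁻ {y = y} 0≤α y∈ (inside⇒∈ K y inside) secants) (½ * d) (half-< 0<d)))
          where
          open ℚ-Solver
          y+d≤x : Eventually (λ n → seq y n + d ≤ seq x n)
          y+d≤x = ev-map (λ n h → ≤-by (p≤q⇒0≤q-p h)
            (solve 3 (λ x y d → x :- (y :+ d) := con 0ℚ :- ((y :+ :- x) :+ d)) refl (seq x n) (seq y n) d)) d≤
          secants : Eventually (λ n → SteepSecant α (seq y n) (right (I n)))
          secants = Secant.secant-left (SteepSecant α) K right-gap left-gap (seq y) d 0<d y+d≤x
            (ev-map (λ n → proj₁) inside)

  open AlternatingPoint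

  point-enclosed : Encloses alternating point
  point-enclosed = continued-fraction⇒encloses {alternating} {point} isContinuedFraction

  open Location {alternating} 1≤alternating {point} point-enclosed
  open Limits {alternating} 1≤alternating {point} point-enclosed point∈[0,1]
  open Flat using (W; rightGap-wide; leftGap-wide)

  flat-derivative : HasDerivativeAt g point 0ℝ
  flat-derivative ε (r , 0<r , R , r≤ε) = fromℚ (radius K) , 0ℝ<fromℚ (0<radius K) , λ y y∈ y#x y-near →
    [ below y y∈ y#x (near⇒inside K {y} y-near) , above y y∈ y#x (near⇒inside K {y} y-near) ]′ y#x
    where
    open ℚ-Solver
    -- `flat-quotient` bounds the slope by 2 e = r/2, which leaves r/2 as the gap demanded by the
    -- strict order of reals.
    e = + 1 / 4 * r
    0<e : 0ℚ < e
    0<e = 0<* (ℚ.positive⁻¹ (+ 1 / 4)) 0<r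
    wide : Eventually (λ k → W k ≤ e * width (rightGap alternating k) × W k ≤ e * width (leftGap alternating k))
    wide = ev-zip (λ _ → _,_) (rightGap-wide e 0<e) (leftGap-wide e 0<e)
    K = proj₁ wide
    Q : ℚ → ℚ → Set
    Q u v = FlatSecant e u v × SteepSecant 0ℚ u v
    increasing-interval : ∀ k → Increasing (I k)
    increasing-interval k = ≲-trans
      (ev≤⇒≲ (always λ _ → ℚ.<⇒≤ (0<weight (ℚ.positive⁻¹ (+ 3 / 5)) (ℚ.positive⁻¹ (+ 3 / 8)) alternating k)))
      (rise-interval-lower alternating k)
    increasing-leftGap : ∀ k → Increasing (leftGap alternating k)
    increasing-leftGap k = increasing-lc (lcs n (I (suc k))) (≲-trans
      (ev≤⇒≲ (always λ _ → 0≤scale (nonneg (+ 3 / 5)) n ℚ.≤-refl))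
      (rise-lcs-lower n (I (suc k)) ℚ.≤-refl (increasing-interval (suc k))))
      where n = drop (suc (suc k)) alternating 0
    right-gap : ∀ k → K ℕ.≤ k → Spanning Q (rightGap alternating k) k
    right-gap k K≤k u v l≤u u≤J J≤v v≤r =
        flat-secant (I k) (rightGap alternating k) (ℚ.<⇒≤ 0<e) (proj₁ (proj₂ wide k K≤k))
          (rise-interval-upper alternating k) l≤u u≤J J≤v v≤r
      , increasing-secant (I k) (rightGap alternating k)
          (increasing-rc (I (suc k)) (increasing-interval (suc k))) l≤u u≤J J≤v v≤r
    left-gap : ∀ k → K ℕ.≤ k → Spanning Q (leftGap alternating k) k
    left-gap k K≤k u v l≤u u≤J J≤v v≤r =
        flat-secant (I k) (leftGap alternating k) (ℚ.<⇒≤ 0<e) (proj₂ (proj₂ wide k K≤k))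
          (rise-interval-upper alternating k) l≤u u≤J J≤v v≤r
      , increasing-secant (I k) (leftGap alternating k) (increasing-leftGap k) l≤u u≤J J≤v v≤r
    2e+½r≤ε : Eventually (λ m → 2ℚ * e + ½ * r ≤ seq ε m)
    2e+½r≤ε = R , λ m R≤m → ≤-by (p≤q⇒0≤q-p (r≤ε m R≤m))
      (solve 2 (λ r ε → ε :- (con 2ℚ :* (con (+ 1 / 4) :* r) :+ con ½ :* r) := ε :- (con 0ℚ :+ r)) refl
        r (seq ε m))
    above : ∀ y → y ∈[0,1] → (y#x : (y ℝ.- point) # 0ℝ) →
      Inside K y → 0ℝ ℝ.< y ℝ.- point →
      ℝ.∣ slope g point y y#x ℝ.- 0ℝ ∣ ℝ.< ε
    above y y∈ y#x inside (d , 0<d , d≤) = ½ * r , half-< 0<r , ev-zip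
        (λ { m ≤ε (x+d≤y , (s , t)) → ℚ.≤-trans (ℚ.+-monoˡ-≤ (½ * r) (flat-quotient (ℚ.<⇒≤ 0<e)
          (oriented⁺ {gx = seq (g point) m} {seq (g y) m} 0<d x+d≤y) s t)) ≤ε })
        2e+½r≤ε (ev-zip (λ _ → _,_) x+d≤y (ev-zip (λ _ → _,_)
          (within (flat-limit⁺ {y = y} (ℚ.<⇒≤ 0<e) y∈ y∈′ (ev-map (λ n → proj₁) secants))
            (e * d) (0<* 0<e 0<d))
          (within (steep-limit⁺ {y = y} ℚ.≤-refl y∈ y∈′ (ev-map (λ n → proj₂) secants))
            (e * d) (0<* 0<e 0<d))))
      where
      y∈′ = inside⇒∈ K y inside
      x+d≤y : Eventually (λ n → seq point n + d ≤ seq y n)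
      x+d≤y = ev-map (λ n h → ≤-by (p≤q⇒0≤q-p h)
        (solve 3 (λ x y d → y :- (x :+ d) := (y :+ :- x) :- (con 0ℚ :+ d)) refl (seq point n) (seq y n) d)) d≤
      secants : Eventually (λ n → Q (left (I n)) (seq y n))
      secants = Secant.secant-right Q K right-gap left-gap (seq y) d 0<d x+d≤y (ev-map (λ n → proj₂) inside)
    below : ∀ y → y ∈[0,1] → (y#x : (y ℝ.- point) # 0ℝ) →
      Inside K y → y ℝ.- point ℝ.< 0ℝ →
      ℝ.∣ slope g point y y#x ℝ.- 0ℝ ∣ ℝ.< ε
    below y y∈ y#x inside (d , 0<d , d≤) = ½ * r , half-< 0<r , ev-zip
        (λ { m ≤ε (y+d≤x , (s , t)) → ℚ.≤-trans (ℚ.+-monoˡ-≤ (½ * r) (flat-quotient (ℚ.<⇒≤ 0<e)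
          (oriented⁻ {gx = seq (g point) m} {seq (g y) m} 0<d y+d≤x) s t)) ≤ε })
        2e+½r≤ε (ev-zip (λ _ → _,_) y+d≤x (ev-zip (λ _ → _,_)
          (within (flat-limit⁻ {y = y} (ℚ.<⇒≤ 0<e) y∈ y∈′ (ev-map (λ n → proj₁) secants))
            (e * d) (0<* 0<e 0<d))
          (within (steep-limit⁻ {y = y} ℚ.≤-refl y∈ y∈′ (ev-map (λ n → proj₂) secants))
            (e * d) (0<* 0<e 0<d))))
      where
      y∈′ = inside⇒∈ K y inside
      y+d≤x : Eventually (λ n → seq y n + d ≤ seq point n)
      y+d≤x = ev-map (λ n h → ≤-by (p≤q⇒0≤q-p h)
        (solve 3 (λ x y d → x :- (y :+ d) := con 0ℚ :- ((y :+ :- x) :+ d)) refl (seq point n) (seq y n) d)) d≤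
      secants : Eventually (λ n → Q (seq y n) (right (I n)))
      secants = Secant.secant-left Q K right-gap left-gap (seq y) d 0<d y+d≤x (ev-map (λ n → proj₁) inside)

theorem3 : (g : ℝ → ℝ) → IsDenjoyTichyUitz φ⁻¹ g →
    (∀ x → x ∈[0,1] → Irrational x → PartialQuotients≤ 2 x → HasDerivative+∞At g x)
    × (∃[ y ] y ∈[0,1] × Irrational y × PartialQuotients≤ 3 y × HasDerivativeAt g y 0ℝ)
theorem3 g dtu =
    (λ { x x∈ _ (a , cf , a≤2) → Limits.steep-derivative (IsContinuedFraction.positive cf) {x}
      (continued-fraction⇒encloses {a} {x} cf) x∈ a≤2 })
  , point , point∈[0,1] , encloses⇒irrational
  , (alternating , isContinuedFraction , alternating≤3) , flat-derivative
  where
  open AlternatingPoint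
  open Derivatives g dtu
  open Location {alternating} 1≤alternating {point} point-enclosed using (encloses⇒irrational)
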